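{- Let $\mathcal{H}_1=\{H_{1,1},\dots,H_{1,r}\}$ have the $(\mathcal{F},v,\eta)$-strong EH-property and $\mathcal{H}_2=\{H_{2,1},\dots,H_{2,s}\}$ have the $(\mathcal{G},v,\eta)$-strong EH-property, with the vertex sets of the tournaments of $\mathcal{H}_1$ disjoint from those of $\mathcal{H}_2$ and $\langle\mathcal{F},\mathcal{G}\rangle=0$. Then the family $\mathcal{H}_1^{\mathcal{F}}\oplus\mathcal{H}_2^{\mathcal{G}}$ satisfies the Erdős–Hajnal Conjecture, i.e. has the EH-property.
   Context: Tournaments are finite; subtournament = induced subtournament; transitive = no directed cycle; $tr(T)$ = maximum size of a transitive subtournament of $T$. $V_1$ is complete to $V_2$ if every vertex of $V_1$ has an edge to every vertex of $V_2$. For disjoint nonempty $X,Y$, $d(X,Y)=e_{X,Y}/(|X||Y|)$, $e_{X,Y}$ = number of edges $(x,y)$ with $x\in X,y\in Y$. For a $\{0,1\}$-vector $v$ of length $m$, $\zeta^v(i)=|\{j\le i:v(j)=1\}|$; $\eta$ is a vector of positive integers of length $\zeta^v(m)$; $k=|\{j:v(j)=0\}|+\sum_i\eta(i)$. For a tournament $T$, $c>0$, $0\le\lambda<1$, a $(v,\eta,c,\lambda)$-m-sequence in $T$ is a sequence $\chi=(S_1,\dots,S_m)$ of pairwise disjoint subsets of $V(T)$ such that: if $v(i)=1$, $S_i$ induces a transitive subtournament partitioned into $S_{i,1},\dots,S_{i,\eta(\zeta^v(i))}$ with $S_{i,a}$ complete to $S_{i,b}$ for $a<b$ and $|S_{i,a}|\ge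 c\,tr(T)$; if $v(i)=0$, $|S_i|\ge c|T|$; $d(S_i,S_j)\ge1-\lambda$ for $i<j$. Its long representation $l(\chi)=(T_1,\dots,T_k)$ replaces each $S_i$ with $v(i)=1$ by $S_{i,1},\dots,S_{i,\eta(\zeta^v(i))}$ in order; $V(\chi)=\bigcup S_i$. A $c'$-strong pair in $\chi$ is a pair $(A,B)$ of disjoint subsets of $V(\chi)$ with $|A|\ge c'|T|$, either $|B|\ge c'|T|$ or ($B$ transitive and $|B|\ge c'\,tr(T)$), and $d(A,B)=1$ or $d(B,A)=1$. For $\mathcal{H}=\{H_1,\dots,H_t\}$, $V(H_i)=\{h^i_1,\dots\}$, and $\mathcal{F}=\{f_1,\dots,f_t\}$ with $f_i:V(H_i)\to\{1,\dots,k\}$ injective, $\mathcal{H}$ has the $(\mathcal{F},v,\eta)$-strong EH-property if for every $c_1>0$ there exist $\lambda_0>0,c_2>0$ such that for every tournament $T$, $0\le\lambda\le\lambda_0$ and $(v,\eta,c_1,\lambda)$-m-sequence $\chi$ in $T$ with $l(\chi)=(T_1,\dots,T_k)$, either there are $i$ and $x_j\in T_{f_i(h^i_j)}$ with $x_j\mapsto h^i_j$ an isomorphism from the subtournament induced on $\{x_j\}$ onto $H_i$, or $\chi$ contains a $c_2$-strong pair. Products: an edge $(x,y)$ is backward under an ordering if $y$ precedes $x$. For tournaments $H_1,H_2$ with disjoint vertex sets and injective $f_1:V(H_1)\to\mathbb{N}$, $f_2:V(H_2)\to\mathbb{N}$ with $f_1(x)\ne f_2(y)$ for all $x,y$ ($\langle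 f_1,f_2\rangle=0$), let $\theta_i$ order $V(H_i)$ by increasing $f_i$ and $\theta$ order $V(H_1)\cup V(H_2)$ by increasing value of $f_1$ on $V(H_1)$ and $f_2$ on $V(H_2)$. $H_1^{f_1}\oplus H_2^{f_2}$ is the tournament on $V(H_1)\cup V(H_2)$ whose backward edges under $\theta$ are exactly those of $H_1$ under $\theta_1$ and those of $H_2$ under $\theta_2$. For $\mathcal{F}=\{f_1,\dots,f_r\}$, $\mathcal{G}=\{g_1,\dots,g_s\}$, $\langle\mathcal{F},\mathcal{G}\rangle=0$ means $\langle f,g\rangle=0$ for all $f\in\mathcal{F},g\in\mathcal{G}$, and $\mathcal{H}_1^{\mathcal{F}}\oplus\mathcal{H}_2^{\mathcal{G}}=\{H_{1,i}^{f_i}\oplus H_{2,j}^{g_j}\}$. A finite family $\mathcal{H}$ has the EH-property if there is $\epsilon>0$ such that every tournament $T$ containing no member of $\mathcal{H}$ as a subtournament contains a transitive subtournament on at least $|T|^{\epsilon}$ vertices. -}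

module Defs where

open import Data.Bool using (Bool; true; false; not; _∧_; if_then_else_)
open import Data.Nat as ℕ using (ℕ; zero; suc; _+_; _^_)
open import Data.Fin as Fin using (Fin; toℕ; splitAt; _↑ˡ_; _↑ʳ_)
open import Data.Fin.Properties using ()
open import Data.Vec as Vec using (Vec; []; _∷_; lookup)
open import Data.List as List using (List; []; _∷_)
open import Data.List.Relation.Unary.All using (All)
open import Data.List.Relation.Unary.Linked using (Linked)
open import Data.List.Relation.Unary.Unique.Propositional using (Unique)
open import Data.Integer using (+_)
open import Data.Rational as ℚ using (ℚ; 0ℚ; 1ℚ; _≤_; _<_; _*_; _-_)
open import Data.Product using (Σ; ∃; _×_; _,_)
open import Data.Sum using (_⊎_; inj₁; inj₂)
open import Relation.Binary.PropositionalEquality using (_≡_; _≢_)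
open import Relation.Nullary using (¬_)
open import Function.Definitions using (Injective)

record Tournament : Set where
  field
    size   : ℕ
    adj    : Fin size → Fin size → Bool
    irrefl : ∀ x → adj x x ≡ false
    tourn  : ∀ x y → x ≢ y → adj x y ≡ not (adj y x)
open Tournament public

Edge : (T : Tournament) → Fin (size T) → Fin (size T) → Set
Edge T x y = adj T x y ≡ true

VSet : ℕ → Set
VSet n = Fin n → Bool

_∈ₛ_ : ∀ {n} → Fin n → VSet n → Set
x ∈ₛ S = S x ≡ true

count : ∀ {n} → (Fin n → Bool) → ℕ
count {zero}  p = 0
count {suc n} p = (if p Fin.zero then 1 else 0) + count (λ i → p (Fin.suc i))

∣_∣ₛ : ∀ {n} → VSet n → ℕ
∣ S ∣ₛ = count S

Disjoint : ∀ {n} → VSet n → VSet n → Set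
Disjoint X Y = ∀ x → X x ≡ true → Y x ≡ false

_⊆ₛ_ : ∀ {n} → VSet n → VSet n → Set
X ⊆ₛ Y = ∀ x → X x ≡ true → Y x ≡ true

eXY : (T : Tournament) → VSet (size T) → VSet (size T) → ℕ
eXY T X Y = sumF (λ x → count (λ y → X x ∧ (Y y ∧ adj T x y)))
  where
  sumF : ∀ {m} → (Fin m → ℕ) → ℕ
  sumF {zero}  f = 0
  sumF {suc m} f = f Fin.zero + sumF (λ i → f (Fin.suc i))

ℕ→ℚ : ℕ → ℚ
ℕ→ℚ n = + n ℚ./ 1

DensityAtLeast1- : (T : Tournament) → ℚ → VSet (size T) → VSet (size T) → Set
DensityAtLeast1- T λ' X Y = (1ℚ - λ') * ℕ→ℚ (∣ X ∣ₛ ℕ.* ∣ Y ∣ₛ) ≤ ℕ→ℚ (eXY T X Y)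

DensityOne : (T : Tournament) → VSet (size T) → VSet (size T) → Set
DensityOne T X Y = eXY T X Y ≡ ∣ X ∣ₛ ℕ.* ∣ Y ∣ₛ

CompleteTo : (T : Tournament) → VSet (size T) → VSet (size T) → Set
CompleteTo T X Y = ∀ x y → x ∈ₛ X → y ∈ₛ Y → Edge T x y

last : ∀ {A : Set} → A → List A → A
last a []       = a
last a (b ∷ bs) = last b bs

DirectedCycle : (T : Tournament) → Fin (size T) → List (Fin (size T)) → Set
DirectedCycle T x xs =
  Unique (x ∷ xs) × Linked (Edge T) (x ∷ xs) × Edge T (last x xs) x

Transitive : (T : Tournament) → VSet (size T) → Set
Transitive T S =
  ¬ (Σ (Fin (size T)) λ x → Σ (List (Fin (size T))) λ xs →
       All (_∈ₛ S) (x ∷ xs) × DirectedCycle T x xs)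

-- |S| ≥ c · tr(T), where tr(T) is the maximum size of a transitive
-- subtournament: equivalently c·|S'| ≤ |S| for every transitive S'.
AtLeastTimesTr : (T : Tournament) → ℚ → VSet (size T) → Set
AtLeastTimesTr T c S = ∀ (S' : VSet (size T)) → Transitive T S' →
  c * ℕ→ℚ ∣ S' ∣ₛ ≤ ℕ→ℚ ∣ S ∣ₛ

AtLeastTimesSize : (T : Tournament) → ℚ → VSet (size T) → Set
AtLeastTimesSize T c S = c * ℕ→ℚ (size T) ≤ ℕ→ℚ ∣ S ∣ₛ

-- tournaments given only by their vertex count and adjacency (used for
-- the product family; its tournament axioms follow from ⟨F,G⟩ = 0)
record RawTournament : Set where
  constructor mkRaw
  field
    rsize : ℕ
    radj  : Fin rsize → Fin rsize → Bool
open RawTournament public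

raw : Tournament → RawTournament
raw H = mkRaw (size H) (adj H)

IsoOnto : (H : RawTournament) (T : Tournament) → (Fin (rsize H) → Fin (size T)) → Set
IsoOnto H T x = Injective _≡_ _≡_ x × (∀ a b → adj T (x a) (x b) ≡ radj H a b)

Contains : (T : Tournament) (H : RawTournament) → Set
Contains T H = Σ (Fin (rsize H) → Fin (size T)) λ x → IsoOnto H T x

-- The EH-property for a finite family (indexed by a finite index type I).
-- ε > 0 is taken rational, ε = p/q, and |S| ≥ |T|^ε is written |T|^p ≤ |S|^q.
EHProperty : {I : Set} → (I → RawTournament) → Set
EHProperty {I} H =
  Σ ℕ λ p → Σ ℕ λ q → (1 ℕ.≤ p) × (1 ℕ.≤ q) ×
    (∀ (T : Tournament) → (∀ i → ¬ Contains T (H i)) →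
      Σ (VSet (size T)) λ S → Transitive T S × (size T ^ p ℕ.≤ ∣ S ∣ₛ ^ q))

ζ : ∀ {m} → Vec Bool m → ℕ
ζ []          = 0
ζ (true ∷ v)  = suc (ζ v)
ζ (false ∷ v) = ζ v

partsOf : ∀ {m} → (v : Vec Bool m) → Vec ℕ (ζ v) → Vec ℕ m
partsOf []          η       = []
partsOf (true ∷ v)  (e ∷ η) = e ∷ partsOf v η
partsOf (false ∷ v) η       = 1 ∷ partsOf v η

sumV : ∀ {m} → Vec ℕ m → ℕ
sumV []       = 0
sumV (a ∷ as) = a + sumV as

kOf : ∀ {m} → (v : Vec Bool m) → Vec ℕ (ζ v) → ℕ
kOf v η = sumV (partsOf v η)

flatten : ∀ {A : Set} {m} (ls : Vec ℕ m) →
  ((i : Fin m) → Fin (lookup ls i) → A) → Fin (sumV ls) → A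
flatten []       f ()
flatten (l ∷ ls) f j with splitAt l j
... | inj₁ a  = f Fin.zero a
... | inj₂ j' = flatten ls (λ i → f (Fin.suc i)) j'

-- (v,η,c,λ)-m-sequences, given through their parts S_{i,a}
-- (a single part when v(i) = 0).

anyF : ∀ {l} → (Fin l → Bool) → Bool
anyF {zero}  p = false
anyF {suc l} p = if p Fin.zero then true else anyF (λ a → p (Fin.suc a))

⋃ₛ : ∀ {n l} → (Fin l → VSet n) → VSet n
⋃ₛ p x = anyF (λ a → p a x)

record MSeq (T : Tournament) {m : ℕ} (v : Vec Bool m) (η : Vec ℕ (ζ v))
            (c λ' : ℚ) : Set where
  field
    -- part i a = S_{i,a}  (S_{i,1} = S_i when v(i) = 0); S_i = ⋃ₐ S_{i,a}
    part : (i : Fin m) → Fin (lookup (partsOf v η) i) → VSet (size T)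
    disjS    : ∀ i j → i ≢ j → Disjoint (⋃ₛ (part i)) (⋃ₛ (part j))
    disjPart : ∀ i a b → a ≢ b → Disjoint (part i a) (part i b)
    transS   : ∀ i → lookup v i ≡ true → Transitive T (⋃ₛ (part i))
    complS   : ∀ i → lookup v i ≡ true → ∀ a b → a Fin.< b →
                 CompleteTo T (part i a) (part i b)
    bigPart  : ∀ i → lookup v i ≡ true → ∀ a → AtLeastTimesTr T c (part i a)
    bigS     : ∀ i → lookup v i ≡ false → AtLeastTimesSize T c (⋃ₛ (part i))
    dense    : ∀ i j → i Fin.< j →
                 DensityAtLeast1- T λ' (⋃ₛ (part i)) (⋃ₛ (part j))

module _ {T : Tournament} {m : ℕ} {v : Vec Bool m} {η : Vec ℕ (ζ v)} {c λ' : ℚ}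
         (χ : MSeq T v η c λ') where
  Sᵢ : Fin m → VSet (size T)
  Sᵢ i = ⋃ₛ (MSeq.part χ i)

  long : Fin (kOf v η) → VSet (size T)
  long = flatten (partsOf v η) (MSeq.part χ)

  Vχ : VSet (size T)
  Vχ = ⋃ₛ Sᵢ


StrongPair : ∀ {T : Tournament} {m} {v : Vec Bool m} {η : Vec ℕ (ζ v)} {c λ' : ℚ} →
  MSeq T v η c λ' → ℚ → Set
StrongPair {T} χ c' =
  Σ (VSet (size T)) λ A → Σ (VSet (size T)) λ B →
    Disjoint A B × A ⊆ₛ Vχ χ × B ⊆ₛ Vχ χ ×
    AtLeastTimesSize T c' A ×
    (AtLeastTimesSize T c' B ⊎ (Transitive T B × AtLeastTimesTr T c' B)) ×
    (DensityOne T A B ⊎ DensityOne T B A)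

StrongEH : ∀ {t m} (v : Vec Bool m) (η : Vec ℕ (ζ v)) →
  (H : Fin t → Tournament) →
  (F : (i : Fin t) → Fin (size (H i)) → Fin (kOf v η)) → Set
StrongEH {t} v η H F =
  ∀ (c₁ : ℚ) → 0ℚ < c₁ →
    Σ ℚ λ λ₀ → Σ ℚ λ c₂ → 0ℚ < λ₀ × 0ℚ < c₂ ×
      (∀ (T : Tournament) (λ' : ℚ) → 0ℚ ≤ λ' → λ' ≤ λ₀ → λ' < 1ℚ →
        ∀ (χ : MSeq T v η c₁ λ') →
          (Σ (Fin t) λ i → Σ (Fin (size (H i)) → Fin (size T)) λ x →
             (∀ j → x j ∈ₛ long χ (F i j)) × IsoOnto (raw (H i)) T x)
          ⊎ StrongPair χ c₂)

-- Product H₁^{f₁} ⊕ H₂^{f₂}, on vertex set V(H₁) ⊔ V(H₂) = Fin (n₁ + n₂)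
-- (so the vertex sets are disjoint by construction).  Edges inside H₁ or
-- inside H₂ are those of H₁, H₂ (their backward edges under θ₁, θ₂ are
-- exactly the backward edges of the product within each side); an edge
-- between x ∈ V(H₁) and y ∈ V(H₂) is forward under θ, i.e. goes from the
-- vertex with the smaller f-value to the one with the larger f-value.

Compatible : ∀ {n₁ n₂ k} → (Fin n₁ → Fin k) → (Fin n₂ → Fin k) → Set
Compatible f₁ f₂ = ∀ x y → f₁ x ≢ f₂ y

ltB : ∀ {k} → Fin k → Fin k → Bool
ltB a b = toℕ a ℕ.<ᵇ toℕ b

prod : ∀ {k} (H₁ H₂ : Tournament) →
  (Fin (size H₁) → Fin k) → (Fin (size H₂) → Fin k) → RawTournament
prod H₁ H₂ f₁ f₂ = mkRaw (size H₁ + size H₂) adjP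
  where
  adjP : Fin (size H₁ + size H₂) → Fin (size H₁ + size H₂) → Bool
  adjP x y with splitAt (size H₁) x | splitAt (size H₁) y
  ... | inj₁ a | inj₁ b = adj H₁ a b
  ... | inj₂ a | inj₂ b = adj H₂ a b
  ... | inj₁ a | inj₂ b = ltB (f₁ a) (f₂ b)
  ... | inj₂ a | inj₁ b = ltB (f₂ a) (f₁ b)

{-# OPTIONS --safe #-}
-- Let T contain no member of the product family, and suppose that tr(T)^q < |T| while all
-- proper subtournaments X satisfy tr(X)^q ≥ |X|.  Then T has no strong pair (A , B): joining
-- large transitive subsets of A and of B would beat tr(T).  Embedding one fixed member of the
-- family greedily must fail, and a failure yields two linear sets with almost all edges going
-- one way; iterating this gives a (v,η,c,λ)-m-sequence in T, where transitive sets of size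
-- c tr(T) exist in linear sets because tr(X)^q ≥ |X|.  Since λ₀ depends on c, the failure at
-- each stage of the embedding is measured by a density prescribed as a function Λ of the size
-- constant reached at that stage.  In the part of the m-sequence formed by the vertices with
-- few back edges there is a copy of some H₁ᵢ; deleting the vertices joined to it by a backward
-- edge leaves an m-sequence in which there is a copy of some H₂ⱼ, and the two copies together
-- are a copy of the product.
--
-- If one family is empty there is no member to embed.  In that case the hypothesis is false:
-- a transitive arrangement of copies of a random-like tournament, with a small and random-like
-- proportion of the edges between the copies reversed, contains an m-sequence but no strong
-- pair.
module Submission where

open import Defs
open import Data.Bool using (Bool; true; false; not; _∧_; _∨_; if_then_else_)
open import Data.Bool.Properties using (not-involutive; T-≡) renaming (_≟_ to _≟ᵇ_)
open import Data.Nat using (ℕ; zero; suc; _+_; _*_; _∸_; _^_; _≤_; _<_; _⊔_; _⊓_; z≤n; s≤s; _≤?_; _<?_; _/_; _%_; NonZero; >-nonZero; pred; ⌊_/2⌋; ⌈_/2⌉)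
open import Data.Nat.Properties
open import Data.Nat.DivMod using (m≡m%n+[m/n]*n; m%n<n; m/n*n≤m; m≥n⇒m/n>0)
open import Data.Nat.Tactic.RingSolver using (solve-∀)
open import Algebra.Properties.Semiring.Sum +-*-semiring using (sum; sum-cong-≗; ∑-distrib-+; ∑-comm; *-distribˡ-sum; *-distribʳ-sum)
open import Data.Fin as Fin using (Fin; toℕ; splitAt; _↑ˡ_; _↑ʳ_; finToFun; funToFin; combine; remQuot)
open import Data.Fin.Properties 
  using (any?; all?; finToFun-funToFin; ¬∀⟶∃¬; splitAt⁻¹-↑ˡ; splitAt⁻¹-↑ʳ; toℕ-↑ˡ; toℕ-↑ʳ; toℕ<n; injective⇒≤;
    remQuot-combine; combine-remQuot; combine-injectiveˡ; combine-injectiveʳ)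
  renaming (suc-injective to Fin-suc-injective; <-cmp to Fin-<-cmp)
import Data.Integer as ℤ
import Data.Integer.Properties as ℤ
open import Data.List using ([]; _∷_)
open import Data.List.Relation.Unary.All using ([]; _∷_) renaming (All to AllL)
open import Data.List.Relation.Unary.AllPairs using ([]; _∷_)
open import Data.List.Relation.Unary.Linked using (Linked; []; [-]; _∷_)
open import Data.Vec using (Vec; []; _∷_; lookup)
open import Data.Vec.Relation.Unary.All using (All; []; _∷_)
open import Data.Rational as ℚ using (ℚ; 0ℚ; 1ℚ; mkℚ; toℚᵘ)
import Data.Rational.Properties as ℚ
import Data.Rational.Unnormalised as ℚᵘ
import Data.Rational.Unnormalised.Properties as ℚᵘ
open import Data.Product using (Σ; ∃; _×_; _,_; proj₁; proj₂)
open import Data.Sum as Sum using (_⊎_; inj₁; inj₂; [_,_]′)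
open import Data.Empty using (⊥; ⊥-elim)
open import Relation.Nullary using (¬_; Dec; yes; no)
open import Relation.Nullary.Decidable using (⌊_⌋; _→-dec_; _×-dec_; map′)
open import Relation.Binary using (Tri; tri<; tri≈; tri>)
open import Relation.Binary.PropositionalEquality
open import Function using (_∘_; flip; Equivalence)
open import Function.Definitions using (Injective)

-- The exponent has to be fixed before T is known, although the constant C of the m-sequence found
-- in T depends on where the embeddings fail. `seqBound` bounds C in terms of the size of one
-- member, the shape of the sequence and Λ alone. So only finitely many constants of strong pairs
-- occur; their maximum `M` determines q, and q ≥ M² is what turns (1 - 1/(M+1))^q into at most
-- 1/(M+1). Taking 2^q ≥ 2^`bound` as well disposes of the tournaments too small to contain the
-- transitive sets that the construction consumes.
--
-- In the counterexample for an empty family, the transitive members of the m-sequence are only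
-- known to have logarithmic size, and random-likeness says nothing about densities between such
-- small sets. Hence the vertex pairs receive many colours, so that any two sets spanning
-- sufficiently (linearly) many pairs meet every colour. One colour determines the edges inside the
-- copies; the colour to be reversed between copies is chosen afterwards, by pigeonhole, to be rare
-- between the sets actually found.

private variable
  n k l m : ℕ

-- Booleans and finite sums

true≢false : ∀ {b : Bool} → b ≡ true → b ≡ false → ⊥
true≢false refl ()

∧-elim : ∀ {a b} → a ∧ b ≡ true → a ≡ true × b ≡ true
∧-elim {true} {true} refl = refl , refl

∧-intro : ∀ {a b} → a ≡ true → b ≡ true → a ∧ b ≡ true
∧-intro refl refl = refl

not-elim : ∀ {a} → not a ≡ true → a ≡ false
not-elim {false} refl = refl

not-intro : ∀ {a} → a ≡ false → not a ≡ true
not-intro refl = refl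

≢true⇒≡false : ∀ {a} → ¬ (a ≡ true) → a ≡ false
≢true⇒≡false {true} h = ⊥-elim (h refl)
≢true⇒≡false {false} h = refl

⌊⌋-sound : ∀ {P : Set} (d : Dec P) → ⌊ d ⌋ ≡ true → P
⌊⌋-sound (yes p) _ = p

⌊⌋-complete : ∀ {P : Set} (d : Dec P) → P → ⌊ d ⌋ ≡ true
⌊⌋-complete (yes p) _ = refl
⌊⌋-complete (no ¬p) p = ⊥-elim (¬p p)

⌊⌋-complete¬ : ∀ {P : Set} (d : Dec P) → ¬ P → ⌊ d ⌋ ≡ false
⌊⌋-complete¬ (yes p) ¬p = ⊥-elim (¬p p)
⌊⌋-complete¬ (no ¬p) _ = refl

ind : Bool → ℕ
ind b = if b then 1 else 0

sum-mono : {f g : Fin n → ℕ} → (∀ i → f i ≤ g i) → sum f ≤ sum g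
sum-mono {zero}  h = z≤n
sum-mono {suc n} h = +-mono-≤ (h Fin.zero) (sum-mono (h ∘ Fin.suc))

sum-const : ∀ n c → sum {n} (λ _ → c) ≡ n * c
sum-const zero    c = refl
sum-const (suc n) c = cong (c +_) (sum-const n c)

-- Sets of vertices

infixr 7 _∩_ _∖_
infixr 6 _∪_

_∩_ _∪_ _∖_ : VSet n → VSet n → VSet n
(X ∩ Y) x = X x ∧ Y x
(X ∪ Y) x = X x ∨ Y x
(X ∖ Y) x = X x ∧ not (Y x)

∅ full : VSet n
∅ _ = false
full _ = true

⁅_⁆ : Fin n → VSet n
⁅ x ⁆ y = ⌊ x Fin.≟ y ⌋

∩⊆ˡ : {X Y : VSet n} → (X ∩ Y) ⊆ₛ X
∩⊆ˡ x h = proj₁ (∧-elim h)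

∖⊆ : (X Y : VSet n) → (X ∖ Y) ⊆ₛ X
∖⊆ X Y x h = proj₁ (∧-elim h)

∪-elim : {X Y : VSet n} → ∀ x → x ∈ₛ (X ∪ Y) → x ∈ₛ X ⊎ x ∈ₛ Y
∪-elim {X = X} x h with X x
... | true  = inj₁ refl
... | false = inj₂ h

∪-introˡ : {X Y : VSet n} → X ⊆ₛ (X ∪ Y)
∪-introˡ x h rewrite h = refl

∪-introʳ : {X Y : VSet n} → Y ⊆ₛ (X ∪ Y)
∪-introʳ {X = X} x h with X x
... | true  = refl
... | false = h

Disjoint-sym : {X Y : VSet n} → Disjoint X Y → Disjoint Y X
Disjoint-sym d x y∈ = ≢true⇒≡false λ x∈ → true≢false y∈ (d x x∈)

Disjoint-⊆ : {X X' Y Y' : VSet n} → X' ⊆ₛ X → Y' ⊆ₛ Y → Disjoint X Y → Disjoint X' Y'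
Disjoint-⊆ p q d x x∈ = ≢true⇒≡false λ y∈ → true≢false (q x y∈) (d x (p x x∈))

∖-Disjoint : (X Y : VSet n) → Disjoint Y (X ∖ Y)
∖-Disjoint X Y x h rewrite h with X x
... | true  = refl
... | false = refl

count≡sum : (p : Fin n → Bool) → count p ≡ sum (ind ∘ p)
count≡sum {zero}  p = refl
count≡sum {suc n} p = cong (ind (p Fin.zero) +_) (count≡sum (p ∘ Fin.suc))

count-cong : {p q : Fin n → Bool} → (∀ x → p x ≡ q x) → count p ≡ count q
count-cong {zero}  h = refl
count-cong {suc n} h = cong₂ _+_ (cong ind (h Fin.zero)) (count-cong (h ∘ Fin.suc))

ind-mono : ∀ {a b} → (a ≡ true → b ≡ true) → ind a ≤ ind b
ind-mono {false} h = z≤n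
ind-mono {true}  h rewrite h refl = ≤-refl

count-mono : {X Y : VSet n} → X ⊆ₛ Y → count X ≤ count Y
count-mono {zero}  h = z≤n
count-mono {suc n} h = +-mono-≤ (ind-mono (h Fin.zero)) (count-mono (h ∘ Fin.suc))

count-full : ∀ n → count (full {n}) ≡ n
count-full zero    = refl
count-full (suc n) = cong suc (count-full n)

count-≤ : (X : VSet n) → count X ≤ n
count-≤ {n} X = ≤-trans (count-mono {n} {X} {full} λ _ _ → refl) (≤-reflexive (count-full n))

count-∅ : ∀ n → count (∅ {n}) ≡ 0
count-∅ zero    = refl
count-∅ (suc n) = count-∅ n

count-none : {X : VSet n} → (∀ x → X x ≡ false) → count X ≡ 0
count-none {n} h = trans (count-cong h) (count-∅ n)

count-split : (X Y : VSet n) → count X ≡ count (X ∩ Y) + count (X ∖ Y)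
count-split {zero}  X Y = refl
count-split {suc n} X Y with X Fin.zero | Y Fin.zero | count-split (X ∘ Fin.suc) (Y ∘ Fin.suc)
... | true  | true  | eq = cong suc eq
... | true  | false | eq = trans (cong suc eq) (sym (+-suc _ _))
... | false | _     | eq = eq

count-∖ : (X Y : VSet n) → Y ⊆ₛ X → count X ≡ count Y + count (X ∖ Y)
count-∖ X Y h = trans (count-split X Y) (cong (_+ count (X ∖ Y)) (count-cong agree))
  where
  agree : ∀ x → (X ∩ Y) x ≡ Y x
  agree x with Y x in eq
  ... | true  = ∧-intro (h x eq) refl
  ... | false = ≢true⇒≡false λ e → true≢false (proj₂ (∧-elim {X x} e)) refl

count-∪ : {X Y : VSet n} → Disjoint X Y → count (X ∪ Y) ≡ count X + count Y
count-∪ {X = X} {Y} d = trans (count-∖ (X ∪ Y) X (∪-introˡ {X = X} {Y})) (cong (count X +_) (count-cong agree))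
  where
  agree : ∀ x → ((X ∪ Y) ∖ X) x ≡ Y x
  agree x with X x in eq
  ... | true  = sym (d x eq)
  ... | false with Y x
  ...   | true  = refl
  ...   | false = refl

count-∪≤ : (X Y : VSet n) → count (X ∪ Y) ≤ count X + count Y
count-∪≤ X Y = ≤-trans (≤-reflexive (count-∖ (X ∪ Y) X (∪-introˡ {X = X} {Y})))
  (+-monoʳ-≤ (count X) (count-mono sub))
  where
  sub : ((X ∪ Y) ∖ X) ⊆ₛ Y
  sub x h with X x
  ... | true  = ⊥-elim (true≢false (proj₂ (∧-elim {true} h)) refl)
  ... | false = proj₁ (∧-elim h)

count>0⇒∃ : {X : VSet n} → 0 < count X → ∃ λ x → x ∈ₛ X
count>0⇒∃ {suc n} {X} h with X Fin.zero in eq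
... | true  = Fin.zero , eq
... | false with x , x∈ ← count>0⇒∃ {n} h = Fin.suc x , x∈

∃⇒count>0 : {X : VSet n} → ∀ x → x ∈ₛ X → 0 < count X
∃⇒count>0 {suc n} {X} Fin.zero    h rewrite h = s≤s z≤n
∃⇒count>0 {suc n} {X} (Fin.suc x) h = ≤-trans (∃⇒count>0 x h) (m≤n+m _ (ind (X Fin.zero)))

count-⁅⁆ : (x : Fin n) → count ⁅ x ⁆ ≡ 1
count-⁅⁆ {suc n} Fin.zero    = cong suc (count-none {n} λ _ → refl)
count-⁅⁆ {suc n} (Fin.suc x) = trans (count-cong agree) (count-⁅⁆ x)
  where
  agree : ∀ y → ⁅ Fin.suc x ⁆ (Fin.suc y) ≡ ⁅ x ⁆ y
  agree y with x Fin.≟ y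
  ... | yes _ = refl
  ... | no  _ = refl

∈⁅⁆ : (x : Fin n) → x ∈ₛ ⁅ x ⁆
∈⁅⁆ x = ⌊⌋-complete (x Fin.≟ x) refl

⁅⁆-elim : (x : Fin n) → ∀ y → y ∈ₛ ⁅ x ⁆ → x ≡ y
⁅⁆-elim x y h = ⌊⌋-sound (x Fin.≟ y) h

⁅⁆-⊆ : {X : VSet n} (x : Fin n) → x ∈ₛ X → ⁅ x ⁆ ⊆ₛ X
⁅⁆-⊆ {X = X} x x∈ y h = subst (_∈ₛ X) (⁅⁆-elim x y h) x∈

count-remove : {X : VSet n} (x : Fin n) → x ∈ₛ X → count X ≡ suc (count (X ∖ ⁅ x ⁆))
count-remove {X = X} x x∈ = trans (count-∖ X ⁅ x ⁆ (⁅⁆-⊆ {X = X} x x∈)) (cong (_+ count (X ∖ ⁅ x ⁆)) (count-⁅⁆ x))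

subset-of-size : ∀ (X : VSet n) a → a ≤ count X → ∃ λ Y → Y ⊆ₛ X × count Y ≡ a
subset-of-size {n} X zero h = ∅ , (λ _ ()) , count-∅ n
subset-of-size {n} X (suc a) h with count>0⇒∃ {X = X} (≤-trans (s≤s z≤n) h)
... | x , x∈ with subset-of-size (X ∖ ⁅ x ⁆) a (≤-pred (≤-trans h (≤-reflexive (count-remove {X = X} x x∈))))
... | Y , Y⊆ , cY = ⁅ x ⁆ ∪ Y
    , (λ y h → [ ⁅⁆-⊆ {X = X} x x∈ y , (λ y∈ → ∖⊆ X ⁅ x ⁆ y (Y⊆ y y∈)) ]′ (∪-elim {X = ⁅ x ⁆} {Y} y h))
    , trans (count-∪ (Disjoint-⊆ {X = ⁅ x ⁆} {⁅ x ⁆} {X ∖ ⁅ x ⁆} {Y} (λ _ h → h) Y⊆ (∖-Disjoint X ⁅ x ⁆))) (cong₂ _+_ (count-⁅⁆ x) cY)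

⋃-intro : (P : Fin l → VSet n) → ∀ a x → x ∈ₛ P a → x ∈ₛ ⋃ₛ P
⋃-intro {suc l} P Fin.zero x h rewrite h = refl
⋃-intro {suc l} P (Fin.suc a) x h with P Fin.zero x
... | true  = refl
... | false = ⋃-intro (P ∘ Fin.suc) a x h

⋃-elim : (P : Fin l → VSet n) → ∀ x → x ∈ₛ ⋃ₛ P → ∃ λ a → x ∈ₛ P a
⋃-elim {suc l} P x h with P Fin.zero x in eq
... | true  = Fin.zero , eq
... | false with a , h' ← ⋃-elim (P ∘ Fin.suc) x h = Fin.suc a , h'

⋃-suc : (P : Fin (suc l) → VSet n) → ∀ x → ⋃ₛ P x ≡ (P Fin.zero ∪ ⋃ₛ (P ∘ Fin.suc)) x
⋃-suc P x with P Fin.zero x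
... | true  = refl
... | false = refl

count-⋃≤ : (P : Fin l → VSet n) → count (⋃ₛ P) ≤ sum (count ∘ P)
count-⋃≤ {zero} {n}  P = ≤-reflexive (count-none {n} λ _ → refl)
count-⋃≤ {suc l} P = ≤-trans (≤-reflexive (count-cong (⋃-suc P)))
  (≤-trans (count-∪≤ (P Fin.zero) _) (+-monoʳ-≤ _ (count-⋃≤ (P ∘ Fin.suc))))

count-⋃ : (P : Fin l → VSet n) → (∀ a b → a ≢ b → Disjoint (P a) (P b)) → count (⋃ₛ P) ≡ sum (count ∘ P)
count-⋃ {zero} {n} P d = count-none {n} λ _ → refl
count-⋃ {suc l} P d = trans (count-cong (⋃-suc P)) (trans (count-∪ disj)
  (cong (count (P Fin.zero) +_) (count-⋃ (P ∘ Fin.suc) λ a b a≢b → d _ _ λ { refl → a≢b refl })))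
  where
  disj : Disjoint (P Fin.zero) (⋃ₛ (P ∘ Fin.suc))
  disj x h = ≢true⇒≡false λ x∈ → let a , h' = ⋃-elim (P ∘ Fin.suc) x x∈ in
    true≢false h' (d Fin.zero (Fin.suc a) (λ ()) x h)

-- The form in which deletions are accounted for: with `M = 2` and `N` the size of a set, half of
-- that set survives the removal of the union.
union-bound : ∀ {M N} (P : Fin l → VSet n) → (∀ a → M * l * count (P a) ≤ N) → M * count (⋃ₛ P) ≤ N
union-bound {zero} {n} {M} P h rewrite count-none {n} {X = ⋃ₛ P} (λ _ → refl) | *-zeroʳ M = z≤n
union-bound {suc l} {n} {M} {N} P h = *-cancelˡ-≤ (suc l) (≤-trans step1 step2)
  where
  step1 : suc l * (M * count (⋃ₛ P)) ≤ sum (λ a → M * suc l * count (P a))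
  step1 = ≤-trans (≤-reflexive (trans (sym (*-assoc (suc l) M _)) (cong (_* count (⋃ₛ P)) (*-comm (suc l) M))))
    (≤-trans (*-monoʳ-≤ (M * suc l) (count-⋃≤ P)) (≤-reflexive (*-distribˡ-sum (M * suc l) (count ∘ P))))
  step2 : sum (λ a → M * suc l * count (P a)) ≤ suc l * N
  step2 = ≤-trans (sum-mono h) (≤-reflexive (sum-const (suc l) N))

sum-pigeonhole : (f : Fin l → ℕ) → ∀ {N} → 0 < N → N ≤ sum f → ∃ λ a → N ≤ l * f a
sum-pigeonhole {zero} f 0<N h = ⊥-elim (<⇒≱ 0<N h)
sum-pigeonhole {suc l} f {N} 0<N h with N ≤? suc l * f Fin.zero
... | yes p = Fin.zero , p
... | no ¬p with sum-pigeonhole (f ∘ Fin.suc) 0<rest rest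
  where
  rest : N ∸ f Fin.zero ≤ sum (f ∘ Fin.suc)
  rest = ≤-trans (∸-monoˡ-≤ (f Fin.zero) h) (≤-reflexive (m+n∸m≡n (f Fin.zero) _))
  0<rest : 0 < N ∸ f Fin.zero
  0<rest = m<n⇒0<n∸m (≤-<-trans (m≤m+n _ (l * f Fin.zero)) (≰⇒> ¬p))
... | a , q = Fin.suc a , concl
  where
  open ≤-Reasoning
  f0<fa : f Fin.zero ≤ f (Fin.suc a)
  f0<fa = ≮⇒≥ λ lt → ¬p (begin
    N ≤⟨ m≤n+m∸n N (f Fin.zero) ⟩
    f Fin.zero + (N ∸ f Fin.zero) ≤⟨ +-monoʳ-≤ (f Fin.zero) (≤-trans q (*-monoʳ-≤ l (<⇒≤ lt))) ⟩
    f Fin.zero + l * f Fin.zero ∎)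
  concl : N ≤ suc l * f (Fin.suc a)
  concl = begin
    N ≤⟨ m≤n+m∸n N (f Fin.zero) ⟩
    f Fin.zero + (N ∸ f Fin.zero) ≤⟨ +-mono-≤ f0<fa q ⟩
    suc l * f (Fin.suc a) ∎

-- Double counting

-- The two sides may have different types, since besides adjacency in a tournament the incidence
-- between vertex pairs and colours is counted as well.
edges : (R : Fin n → Fin k → Bool) → VSet n → VSet k → ℕ
edges R X Y = sum (λ x → count (λ y → X x ∧ (Y y ∧ R x y)))

count-∧ : ∀ b (p : Fin n → Bool) → count (λ y → b ∧ p y) ≡ ind b * count p
count-∧ true  p = sym (+-identityʳ _)
count-∧ {n} false p = count-∅ n

edges-swap : (R : Fin n → Fin k → Bool) (X : VSet n) (Y : VSet k) → edges R X Y ≡ edges (flip R) Y X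
edges-swap R X Y = begin
  edges R X Y ≡⟨ sum-cong-≗ (λ x → count≡sum (λ y → X x ∧ (Y y ∧ R x y))) ⟩
  sum (λ x → sum (λ y → ind (X x ∧ (Y y ∧ R x y)))) ≡⟨ ∑-comm (λ x y → ind (X x ∧ (Y y ∧ R x y))) ⟩
  sum (λ y → sum (λ x → ind (X x ∧ (Y y ∧ R x y)))) ≡⟨ sum-cong-≗ (λ y → trans (sum-cong-≗ (λ x → cong ind (∧-swap (X x) (Y y) _))) (sym (count≡sum (λ x → Y y ∧ (X x ∧ R x y))))) ⟩
  edges (flip R) Y X ∎
  where
  open ≡-Reasoning
  ∧-swap : ∀ a b c → a ∧ (b ∧ c) ≡ b ∧ (a ∧ c)
  ∧-swap true  b c = refl
  ∧-swap false true  c = refl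
  ∧-swap false false c = refl

edges-cong : {R R' : Fin n → Fin k → Bool} {X : VSet n} {Y : VSet k} →
  (∀ x y → x ∈ₛ X → y ∈ₛ Y → R x y ≡ R' x y) → edges R X Y ≡ edges R' X Y
edges-cong {R = R} {R'} {X} {Y} h = sum-cong-≗ λ x → count-cong λ y → agree x y
  where
  agree : ∀ x y → X x ∧ (Y y ∧ R x y) ≡ X x ∧ (Y y ∧ R' x y)
  agree x y with X x in e₁ | Y y in e₂
  ... | true  | true  = h x y e₁ e₂
  ... | true  | false = refl
  ... | false | _     = refl

edges-mono : {R R' : Fin n → Fin k → Bool} {X X' : VSet n} {Y Y' : VSet k} →
  (∀ x y → x ∈ₛ X → y ∈ₛ Y → R x y ≡ true → x ∈ₛ X' × y ∈ₛ Y' × R' x y ≡ true) → edges R X Y ≤ edges R' X' Y'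
edges-mono h = sum-mono λ x → count-mono λ y p →
  let x∈ , q = ∧-elim p ; y∈ , r = ∧-elim q ; x∈' , y∈' , r' = h x y x∈ y∈ r in ∧-intro x∈' (∧-intro y∈' r')

count*≡sum : (X : VSet n) (c : ℕ) → count X * c ≡ sum (λ x → ind (X x) * c)
count*≡sum X c = trans (cong (_* c) (count≡sum X)) (*-distribʳ-sum c (ind ∘ X))

edges≤ : (R : Fin n → Fin k → Bool) (X : VSet n) (Y : VSet k) (M c : ℕ) →
  (∀ x → x ∈ₛ X → M * count (λ y → Y y ∧ R x y) ≤ c) → M * edges R X Y ≤ count X * c
edges≤ {k = k} R X Y M c h = begin
  M * edges R X Y ≡⟨ *-distribˡ-sum M (λ x → count (λ y → X x ∧ (Y y ∧ R x y))) ⟩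
  sum (λ x → M * count (λ y → X x ∧ (Y y ∧ R x y))) ≤⟨ sum-mono bound ⟩
  sum (λ x → ind (X x) * c) ≡⟨ count*≡sum X c ⟨
  count X * c ∎
  where
  open ≤-Reasoning
  bound : ∀ x → M * count (λ y → X x ∧ (Y y ∧ R x y)) ≤ ind (X x) * c
  bound x with X x in eq
  ... | true  = ≤-trans (h x eq) (≤-reflexive (sym (+-identityʳ c)))
  ... | false = ≤-reflexive (trans (cong (M *_) (count-∅ k)) (*-zeroʳ M))

edges≥ : (R : Fin n → Fin k → Bool) (X : VSet n) (Y : VSet k) (M c : ℕ) →
  (∀ x → x ∈ₛ X → c ≤ M * count (λ y → Y y ∧ R x y)) → count X * c ≤ M * edges R X Y
edges≥ R X Y M c h = begin
  count X * c ≡⟨ count*≡sum X c ⟩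
  sum (λ x → ind (X x) * c) ≤⟨ sum-mono bound ⟩
  sum (λ x → M * count (λ y → X x ∧ (Y y ∧ R x y))) ≡⟨ *-distribˡ-sum M (λ x → count (λ y → X x ∧ (Y y ∧ R x y))) ⟨
  M * edges R X Y ∎
  where
  open ≤-Reasoning
  bound : ∀ x → ind (X x) * c ≤ M * count (λ y → X x ∧ (Y y ∧ R x y))
  bound x with X x in eq
  ... | true  = ≤-trans (≤-reflexive (+-identityʳ c)) (h x eq)
  ... | false = z≤n

edges-total : (R : Fin n → Fin k → Bool) (X : VSet n) (Y : VSet k) →
  edges R X Y + edges (λ x y → not (R x y)) X Y ≡ count X * count Y
edges-total R X Y = begin
  edges R X Y + edges (λ x y → not (R x y)) X Y ≡⟨ ∑-distrib-+ (λ x → count (λ y → X x ∧ (Y y ∧ R x y))) _ ⟨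
  sum (λ x → count (λ y → X x ∧ (Y y ∧ R x y)) + count (λ y → X x ∧ (Y y ∧ not (R x y)))) ≡⟨ sum-cong-≗ row ⟩
  sum (λ x → ind (X x) * count Y) ≡⟨ count*≡sum X (count Y) ⟨
  count X * count Y ∎
  where
  open ≡-Reasoning
  row : ∀ x → count (λ y → X x ∧ (Y y ∧ R x y)) + count (λ y → X x ∧ (Y y ∧ not (R x y))) ≡ ind (X x) * count Y
  row x = trans (cong₂ _+_ (count-∧ (X x) (Y ∩ R x)) (count-∧ (X x) (Y ∖ R x)))
    (trans (sym (*-distribˡ-+ (ind (X x)) _ _)) (cong (ind (X x) *_) (sym (count-split Y (R x)))))

-- Markov's inequality: each popular `y` is related to at least |X|/L members of `X`, while `R`
-- holds for at most |X||Y|/M pairs altogether. Popularity is a negated decision, so that outside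
-- the popular set the bound can be read off by matching on it.
few-popular : (R : Fin n → Fin k → Bool) (X : VSet n) (Y : VSet k) (M L : ℕ) → 0 < count X →
  (∀ x → x ∈ₛ X → M * count (λ y → Y y ∧ R x y) ≤ count Y) →
  M * count (λ y → Y y ∧ not ⌊ L * count (λ x → X x ∧ R x y) ≤? count X ⌋) ≤ L * count Y
few-popular {k = k} R X Y M L 0<X h = *-cancelʳ-≤ _ _ (count X) ⦃ >-nonZero 0<X ⦄ (begin
  M * count Z * count X ≡⟨ *-assoc M _ _ ⟩
  M * (count Z * count X) ≤⟨ *-monoʳ-≤ M (edges≥ (flip R) Z X L (count X) heavy) ⟩
  M * (L * edges (flip R) Z X) ≤⟨ *-monoʳ-≤ M (*-monoʳ-≤ L (edges-mono {R = flip R} {flip R} {Z} {Y} {X} {X} λ y x y∈ x∈ r → proj₁ (∧-elim {Y y} y∈) , x∈ , r)) ⟩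
  M * (L * edges (flip R) Y X) ≡⟨ cong (λ e → M * (L * e)) (edges-swap R X Y) ⟨
  M * (L * edges R X Y) ≡⟨ comm₁ M L (edges R X Y) ⟩
  L * (M * edges R X Y) ≤⟨ *-monoʳ-≤ L (edges≤ R X Y M (count Y) h) ⟩
  L * (count X * count Y) ≡⟨ comm₂ L (count X) (count Y) ⟩
  L * count Y * count X ∎)
  where
  open ≤-Reasoning
  Z : VSet k
  Z = λ y → Y y ∧ not ⌊ L * count (λ x → X x ∧ R x y) ≤? count X ⌋
  heavy : ∀ y → y ∈ₛ Z → count X ≤ L * count (λ x → X x ∧ R x y)
  heavy y y∈ = <⇒≤ (≰⇒> λ le → true≢false (⌊⌋-complete (_ ≤? _) le) (not-elim (proj₂ (∧-elim {Y y} y∈))))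
  comm₁ : ∀ M L e → M * (L * e) ≡ L * (M * e)
  comm₁ = solve-∀
  comm₂ : ∀ L a b → L * (a * b) ≡ L * b * a
  comm₂ = solve-∀

few-popular-cancel : (R : Fin n → Fin k → Bool) (X : VSet n) (Y : VSet k) (M L : ℕ) → 0 < count X → 0 < L →
  (∀ x → x ∈ₛ X → L * M * count (λ y → Y y ∧ R x y) ≤ count Y) →
  M * count (λ y → Y y ∧ not ⌊ L * count (λ x → X x ∧ R x y) ≤? count X ⌋) ≤ count Y
few-popular-cancel R X Y M L 0<X 0<L h = *-cancelˡ-≤ L ⦃ >-nonZero 0<L ⦄
  (≤-trans (≤-reflexive (sym (*-assoc L M (count (λ y → Y y ∧ not ⌊ L * count (λ x → X x ∧ R x y) ≤? count X ⌋))))) (few-popular R X Y (L * M) L 0<X h))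

-- Transitive sets and their linear order

module _ (T : Tournament) where

  edge⇒≢ : ∀ {x y} → Edge T x y → x ≢ y
  edge⇒≢ {x} e refl = true≢false e (irrefl T x)

  edge-asym : ∀ {x y} → Edge T x y → Edge T y x → ⊥
  edge-asym {x} {y} e e' = true≢false e (trans (tourn T x y (edge⇒≢ e)) (cong not e'))

  edge-total : ∀ {x y} → x ≢ y → Edge T x y ⊎ Edge T y x
  edge-total {x} {y} x≢y with adj T x y in eq
  ... | true  = inj₁ refl
  ... | false = inj₂ (trans (tourn T y x (x≢y ∘ sym)) (cong not eq))

  -- In a tournament, having no directed cycle amounts to transitivity of the edge relation.
  EdgeTrans : VSet (size T) → Set
  EdgeTrans S = ∀ x y z → x ∈ₛ S → y ∈ₛ S → z ∈ₛ S → Edge T x y → Edge T y z → Edge T x z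

  -- If the edge between `x` and `z` pointed the wrong way, it would close a directed triangle.
  Transitive⇒EdgeTrans : ∀ {S} → Transitive T S → EdgeTrans S
  Transitive⇒EdgeTrans {S} t x y z x∈ y∈ z∈ xy yz with edge-total {x} {z} (λ { refl → edge-asym xy yz })
  ... | inj₁ xz = xz
  ... | inj₂ zx = ⊥-elim (t (x , y ∷ z ∷ [] , x∈ ∷ y∈ ∷ z∈ ∷ [] ,
          ((edge⇒≢ xy ∷ (edge⇒≢ zx ∘ sym) ∷ []) ∷ (edge⇒≢ yz ∷ []) ∷ [] ∷ []) ,
          xy ∷ yz ∷ [-] , zx))

  -- Along a path, transitivity gives an edge from the first vertex to the last unless they
  -- coincide; the edge that closes the cycle contradicts either case.
  EdgeTrans⇒Transitive : ∀ {S} → EdgeTrans S → Transitive T S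
  EdgeTrans⇒Transitive {S} t (x , xs , all , _ , linked , back) with walk x xs all linked
    where
    walk : ∀ x xs → AllL (_∈ₛ S) (x ∷ xs) → Linked (Edge T) (x ∷ xs) →
      last x xs ∈ₛ S × (last x xs ≡ x ⊎ Edge T x (last x xs))
    walk x [] (x∈ ∷ []) _ = x∈ , inj₁ refl
    walk x (y ∷ ys) (x∈ ∷ y∈ ∷ all) (xy ∷ linked) with walk y ys (y∈ ∷ all) linked
    ... | l∈ , inj₁ eq = l∈ , inj₂ (subst (Edge T x) (sym eq) xy)
    ... | l∈ , inj₂ e  = l∈ , inj₂ (t x y _ x∈ y∈ l∈ xy e)
  ... | _ , inj₁ eq = edge⇒≢ back eq
  ... | _ , inj₂ e  = edge-asym e back

  EdgeTrans? : ∀ S → Dec (EdgeTrans S)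
  EdgeTrans? S = all? λ x → all? λ y → all? λ z →
    (S x ≟ᵇ true) →-dec ((S y ≟ᵇ true) →-dec ((S z ≟ᵇ true) →-dec
      ((adj T x y ≟ᵇ true) →-dec ((adj T y z ≟ᵇ true) →-dec (adj T x z ≟ᵇ true)))))

  EdgeTrans-⊆ : ∀ {S S'} → S' ⊆ₛ S → EdgeTrans S → EdgeTrans S'
  EdgeTrans-⊆ s t x y z x∈ y∈ z∈ = t x y z (s x x∈) (s y y∈) (s z z∈)

  EdgeTrans-∪ : ∀ {A B} → CompleteTo T A B → EdgeTrans A → EdgeTrans B → EdgeTrans (A ∪ B)
  EdgeTrans-∪ {A} {B} c tA tB x y z x∈ y∈ z∈ xy yz
    with ∪-elim {X = A} {B} x x∈ | ∪-elim {X = A} {B} y y∈ | ∪-elim {X = A} {B} z z∈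
  ... | inj₁ xA | _       | inj₂ zB = c x z xA zB
  ... | inj₁ xA | inj₁ yA | inj₁ zA = tA x y z xA yA zA xy yz
  ... | inj₁ xA | inj₂ yB | inj₁ zA = ⊥-elim (edge-asym yz (c z y zA yB))
  ... | inj₂ xB | inj₁ yA | _       = ⊥-elim (edge-asym xy (c y x yA xB))
  ... | inj₂ xB | inj₂ yB | inj₁ zA = ⊥-elim (edge-asym yz (c z y zA yB))
  ... | inj₂ xB | inj₂ yB | inj₂ zB = tB x y z xB yB zB xy yz

  EdgeTrans-⁅⁆ : ∀ x → EdgeTrans ⁅ x ⁆
  EdgeTrans-⁅⁆ x y z w y∈ z∈ w∈ yz zw =
    ⊥-elim (edge⇒≢ yz (trans (sym (⁅⁆-elim x y y∈)) (⁅⁆-elim x z z∈)))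

  CompleteTo⇒Disjoint : ∀ {X Y} → CompleteTo T X Y → Disjoint X Y
  CompleteTo⇒Disjoint c x x∈ = ≢true⇒≡false λ y∈ → edge⇒≢ (c x x x∈ y∈) refl

  -- Set aside any vertex `x` and take the source `s` of the rest. If `x` beats `s`, transitivity
  -- makes `x` a source of everything; otherwise `s` beats `x` too.
  source : ∀ k (S : VSet (size T)) → EdgeTrans S → count S ≡ suc k →
    ∃ λ s → s ∈ₛ S × (∀ y → y ∈ₛ S → s ≢ y → Edge T s y)
  source k S t eq with count>0⇒∃ {X = S} (subst (0 <_) (sym eq) (s≤s z≤n))
  ... | x , x∈ = extend k (suc-injective (trans (sym (count-remove {X = S} x x∈)) eq))
    where
    rest : ∀ {y} → y ∈ₛ S → x ≢ y → y ∈ₛ (S ∖ ⁅ x ⁆)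
    rest {y} y∈ x≢y = ∧-intro y∈ (not-intro (⌊⌋-complete¬ (x Fin.≟ y) x≢y))
    extend : ∀ k → count (S ∖ ⁅ x ⁆) ≡ k → ∃ λ s → s ∈ₛ S × (∀ y → y ∈ₛ S → s ≢ y → Edge T s y)
    extend zero eq' = x , x∈ , λ y y∈ x≢y →
      ⊥-elim (<⇒≢ (∃⇒count>0 {X = S ∖ ⁅ x ⁆} y (rest y∈ x≢y)) (sym eq'))
    extend (suc k) eq' with source k (S ∖ ⁅ x ⁆) (EdgeTrans-⊆ (∖⊆ S ⁅ x ⁆) t) eq'
    ... | s , s∈ , dom with adj T x s in xs
    ...   | true = x , x∈ , fromX
      where
      fromX : ∀ y → y ∈ₛ S → x ≢ y → Edge T x y
      fromX y y∈ x≢y with s Fin.≟ y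
      ... | yes refl = xs
      ... | no s≢y = t x s y x∈ (∖⊆ S ⁅ x ⁆ s s∈) y∈ xs (dom y (rest y∈ x≢y) s≢y)
    ...   | false = s , ∖⊆ S ⁅ x ⁆ s s∈ , fromS
      where
      s≢x : s ≢ x
      s≢x refl = true≢false (∈⁅⁆ s) (not-elim (proj₂ (∧-elim {S s} s∈)))
      fromS : ∀ y → y ∈ₛ S → s ≢ y → Edge T s y
      fromS y y∈ s≢y with x Fin.≟ y
      ... | yes refl = trans (tourn T s x s≢x) (cong not xs)
      ... | no x≢y = dom y (rest y∈ x≢y) s≢y

  initial-segment : ∀ S → EdgeTrans S → ∀ a → a ≤ count S →
    ∃ λ P → P ⊆ₛ S × count P ≡ a × CompleteTo T P (S ∖ P)
  initial-segment S t zero a≤ = ∅ , (λ _ ()) , count-∅ (size T) , λ _ _ ()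
  initial-segment S t (suc a) a< with initial-segment S t a (<⇒≤ a<)
  ... | P , P⊆ , cP , PS = grow (count (S ∖ P)) refl
    where
    grow : ∀ r → count (S ∖ P) ≡ r → ∃ λ P → P ⊆ₛ S × count P ≡ suc a × CompleteTo T P (S ∖ P)
    grow zero eq = ⊥-elim (<⇒≢ a< (sym (trans (count-∖ S P P⊆) (trans (cong₂ _+_ cP eq) (+-identityʳ a)))))
    grow (suc r) eq with source r (S ∖ P) (EdgeTrans-⊆ (∖⊆ S P) t) eq
    ... | s , s∈ , dom = P ∪ ⁅ s ⁆
        , (λ y y∈ → [ P⊆ y , ⁅⁆-⊆ {X = S} s (∖⊆ S P s s∈) y ]′ (∪-elim {X = P} {⁅ s ⁆} y y∈))
        , trans (count-∪ {X = P} {⁅ s ⁆} (Disjoint-sym {X = ⁅ s ⁆} {P} λ y y∈ →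
            subst (λ z → P z ≡ false) (⁅⁆-elim s y y∈) (not-elim (proj₂ (∧-elim {S s} s∈)))))
            (trans (cong₂ _+_ cP (count-⁅⁆ s)) (+-comm a 1))
        , complete
      where
      complete : CompleteTo T (P ∪ ⁅ s ⁆) (S ∖ (P ∪ ⁅ s ⁆))
      complete x y x∈ y∈ with ∧-elim {S y} y∈
      ... | yS , q with P y in Py | s Fin.≟ y | not-elim q
      ...   | false | no s≢y | refl with ∪-elim {X = P} {⁅ s ⁆} x x∈
      ...     | inj₁ xP = PS x y xP (∧-intro yS (not-intro Py))
      ...     | inj₂ xs = subst (λ z → Edge T z y) (⁅⁆-elim s x xs) (dom y (∧-intro yS (not-intro Py)) s≢y)

  -- Consecutive intervals of the linear order of `S`; they become the parts S_{i,1}, S_{i,2}, ...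
  -- of a transitive member of the m-sequence.
  chunks : ∀ e p S → EdgeTrans S → e * p ≤ count S →
    ∃ λ (P : Fin e → VSet (size T)) → (∀ a → P a ⊆ₛ S) × (∀ a → count (P a) ≡ p) ×
      (∀ a b → a Fin.< b → CompleteTo T (P a) (P b))
  chunks zero p S t h = (λ ()) , (λ ()) , (λ ()) , λ ()
  chunks (suc e) p S t h with initial-segment S t p (≤-trans (m≤m+n p (e * p)) h)
  ... | P , P⊆ , cP , PS with chunks e p (S ∖ P) (EdgeTrans-⊆ (∖⊆ S P) t)
          (+-cancelˡ-≤ p _ _ (≤-trans h (≤-reflexive (trans (count-∖ S P P⊆) (cong (_+ count (S ∖ P)) cP)))))
  ... | Q , Q⊆ , cQ , QQ = R , R⊆ , cR , RR
    where
    R : Fin (suc e) → VSet (size T)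
    R Fin.zero    = P
    R (Fin.suc a) = Q a
    R⊆ : ∀ a → R a ⊆ₛ S
    R⊆ Fin.zero    = P⊆
    R⊆ (Fin.suc a) x x∈ = ∖⊆ S P x (Q⊆ a x x∈)
    cR : ∀ a → count (R a) ≡ p
    cR Fin.zero    = cP
    cR (Fin.suc a) = cQ a
    RR : ∀ a b → a Fin.< b → CompleteTo T (R a) (R b)
    RR Fin.zero (Fin.suc b) _ x y x∈ y∈ = PS x y x∈ (Q⊆ b y y∈)
    RR (Fin.suc a) (Fin.suc b) (s≤s a<b) = QQ a b a<b

  -- The usual Ramsey argument: among the other vertices of `A`, the out-neighbours or the
  -- in-neighbours of `x` number at least 2^K, and `x` can be added in front of or behind a
  -- transitive set of them.
  transitive-log : ∀ K A → 2 ^ K ≤ count A → ∃ λ S → S ⊆ₛ A × EdgeTrans S × suc K ≤ count S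
  transitive-log zero A h with count>0⇒∃ {X = A} h
  ... | x , x∈ = ⁅ x ⁆ , ⁅⁆-⊆ {X = A} x x∈ , EdgeTrans-⁅⁆ x , ≤-reflexive (sym (count-⁅⁆ x))
  transitive-log (suc K) A h with count>0⇒∃ {X = A} (≤-trans (m^n>0 2 (suc K)) h)
  ... | x , x∈ with 2 ^ K ≤? count ((A ∖ ⁅ x ⁆) ∩ adj T x)
  ... | yes big with transitive-log K ((A ∖ ⁅ x ⁆) ∩ adj T x) big
  ...   | S , S⊆ , tS , cS = ⁅ x ⁆ ∪ S
          , (λ y y∈ → [ ⁅⁆-⊆ {X = A} x x∈ y , (λ y∈ → ∖⊆ A ⁅ x ⁆ y (∩⊆ˡ {X = A ∖ ⁅ x ⁆} {adj T x} y (S⊆ y y∈))) ]′ (∪-elim {X = ⁅ x ⁆} {S} y y∈))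
          , EdgeTrans-∪ xS (EdgeTrans-⁅⁆ x) tS
          , ≤-trans (s≤s cS) (≤-reflexive (sym (trans (count-∪ {X = ⁅ x ⁆} {S} (CompleteTo⇒Disjoint xS)) (cong (_+ count S) (count-⁅⁆ x)))))
    where
    xS : CompleteTo T ⁅ x ⁆ S
    xS a y a∈ y∈ = subst (λ a → Edge T a y) (⁅⁆-elim x a a∈) (proj₂ (∧-elim {(A ∖ ⁅ x ⁆) y} (S⊆ y y∈)))
  transitive-log (suc K) A h | x , x∈ | no small with transitive-log K ((A ∖ ⁅ x ⁆) ∖ adj T x) big
    where
    open ≤-Reasoning
    big : 2 ^ K ≤ count ((A ∖ ⁅ x ⁆) ∖ adj T x)
    big = +-cancelˡ-≤ (2 ^ K) _ _ (begin
      2 ^ K + 2 ^ K ≡⟨ cong (2 ^ K +_) (sym (+-identityʳ (2 ^ K))) ⟩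
      2 ^ suc K ≤⟨ h ⟩
      count A ≡⟨ count-remove {X = A} x x∈ ⟩
      suc (count (A ∖ ⁅ x ⁆)) ≡⟨ cong suc (count-split (A ∖ ⁅ x ⁆) (adj T x)) ⟩
      -- The number of out-neighbours is strictly below 2^K, which leaves room for the vertex `x`
      -- itself.
      suc (count ((A ∖ ⁅ x ⁆) ∩ adj T x)) + count ((A ∖ ⁅ x ⁆) ∖ adj T x) ≤⟨ +-monoˡ-≤ _ (≰⇒> small) ⟩
      2 ^ K + count ((A ∖ ⁅ x ⁆) ∖ adj T x) ∎)
  ... | S , S⊆ , tS , cS = S ∪ ⁅ x ⁆
          , (λ y y∈ → [ (λ y∈ → ∖⊆ A ⁅ x ⁆ y (∖⊆ (A ∖ ⁅ x ⁆) (adj T x) y (S⊆ y y∈))) , ⁅⁆-⊆ {X = A} x x∈ y ]′ (∪-elim {X = S} {⁅ x ⁆} y y∈))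
          , EdgeTrans-∪ Sx tS (EdgeTrans-⁅⁆ x)
          , ≤-trans (≤-reflexive (+-comm 1 (suc K))) (≤-trans (+-monoˡ-≤ 1 cS) (≤-reflexive (sym (trans (count-∪ {X = S} {⁅ x ⁆} (CompleteTo⇒Disjoint Sx)) (cong (count S +_) (count-⁅⁆ x))))))
    where
    Sx : CompleteTo T S ⁅ x ⁆
    Sx y a y∈ a∈ with ∧-elim {(A ∖ ⁅ x ⁆) y} (S⊆ y y∈)
    ... | y∈' , nxy = subst (Edge T y) (⁅⁆-elim x a a∈)
      (trans (tourn T y x λ { refl → true≢false (∈⁅⁆ x) (not-elim (proj₂ (∧-elim {A x} y∈'))) }) nxy)

  -- The row sum inside the definition of eXY has no name in scope: the hole in rowSum is
  -- filled by unification when eXY-sum is checked.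
  mutual
    rowSum : (X Y : VSet (size T)) {m : ℕ} → (Fin m → ℕ) → ℕ
    rowSum X Y {m} f = _

    eXY≡edges : ∀ X Y → eXY T X Y ≡ edges (adj T) X Y
    eXY≡edges X Y with size T | (λ x → count (λ y → X x ∧ (Y y ∧ adj T x y)))
    ... | m | f = rowSum≡sum X Y f

    rowSum≡sum : ∀ X Y {m} (f : Fin m → ℕ) → rowSum X Y f ≡ sum f
    rowSum≡sum X Y {zero}  f = refl
    rowSum≡sum X Y {suc m} f = cong (f Fin.zero +_) (rowSum≡sum X Y (f ∘ Fin.suc))

  eXY-dual : ∀ {X Y} → Disjoint X Y → eXY T X Y + eXY T Y X ≡ count X * count Y
  eXY-dual {X} {Y} d = begin
    eXY T X Y + eXY T Y X ≡⟨ cong₂ _+_ (eXY≡edges X Y) (trans (eXY≡edges Y X) (edges-swap (adj T) Y X)) ⟩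
    edges (adj T) X Y + edges (flip (adj T)) X Y ≡⟨ cong (edges (adj T) X Y +_) (edges-cong λ x y x∈ y∈ → tourn T y x λ { refl → true≢false y∈ (d x x∈) }) ⟩
    edges (adj T) X Y + edges (λ x y → not (adj T x y)) X Y ≡⟨ edges-total (adj T) X Y ⟩
    count X * count Y ∎
    where open ≡-Reasoning

  -- Edges in both directions add up to |X||Y|, so density one leaves none from `Y` to `X`.
  DensityOne⇒CompleteTo : ∀ {X Y} → Disjoint X Y → DensityOne T X Y → CompleteTo T X Y
  DensityOne⇒CompleteTo {X} {Y} d eq x y x∈ y∈ with edge-total {x} {y} (λ { refl → true≢false y∈ (d x x∈) })
  ... | inj₁ xy = xy
  ... | inj₂ yx = ⊥-elim (<⇒≢ positive (sym none))
    where
    none : edges (adj T) Y X ≡ 0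
    none = trans (sym (eXY≡edges Y X)) (+-cancelˡ-≡ (eXY T X Y) _ _ (trans (eXY-dual d) (trans (sym eq) (sym (+-identityʳ _)))))
    row : ∀ (f : Fin n → ℕ) i → 0 < f i → 0 < sum f
    row f Fin.zero    h = ≤-trans h (m≤m+n _ _)
    row f (Fin.suc i) h = ≤-trans (row (f ∘ Fin.suc) i h) (m≤n+m _ _)
    positive : 0 < edges (adj T) Y X
    positive = row _ y (∃⇒count>0 {X = λ x → Y y ∧ (X x ∧ adj T y x)} x (∧-intro y∈ (∧-intro x∈ yx)))

-- Searching through all subsets

subset : Fin (2 ^ n) → VSet n
subset i x = ⌊ finToFun i x Fin.≟ Fin.suc Fin.zero ⌋

encode : VSet n → Fin (2 ^ n)
encode X = funToFin λ x → if X x then Fin.suc Fin.zero else Fin.zero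

subset-encode : (X : VSet n) → ∀ x → subset (encode X) x ≡ X x
subset-encode X x rewrite finToFun-funToFin (λ x → if X x then Fin.suc {1} Fin.zero else Fin.zero) x with X x
... | true  = refl
... | false = refl

-- `P` has to respect pointwise equality because a set is recovered from its code only pointwise.
∃-subset? : {P : VSet n → Set} → (∀ {X Y} → (∀ x → X x ≡ Y x) → P X → P Y) → (∀ X → Dec (P X)) → Dec (∃ P)
∃-subset? {n} {P} resp P? = map′ (λ (i , p) → subset i , p)
  (λ (X , p) → encode X , resp (λ x → sym (subset-encode X x)) p) (any? λ i → P? (subset i))

-- Induced subtournaments

image : (Fin k → Fin n) → VSet k → VSet n
image f S = ⋃ₛ λ i x → S i ∧ ⁅ f i ⁆ x

image-elim : (f : Fin k → Fin n) (S : VSet k) → ∀ {x} → x ∈ₛ image f S → ∃ λ i → i ∈ₛ S × f i ≡ x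
image-elim f S {x} h with ⋃-elim (λ i x → S i ∧ ⁅ f i ⁆ x) x h
... | i , h' = i , proj₁ (∧-elim {S i} h') , ⁅⁆-elim (f i) x (proj₂ (∧-elim {S i} h'))

image-intro : (f : Fin k → Fin n) (S : VSet k) → ∀ {i} → i ∈ₛ S → f i ∈ₛ image f S
image-intro f S {i} h = ⋃-intro (λ i x → S i ∧ ⁅ f i ⁆ x) i (f i) (∧-intro h (∈⁅⁆ (f i)))

count-image : (f : Fin k → Fin n) → Injective _≡_ _≡_ f → (S : VSet k) → count (image f S) ≡ count S
count-image f inj S = trans (count-⋃ (λ i x → S i ∧ ⁅ f i ⁆ x) disj)
  (trans (sum-cong-≗ λ i → trans (count-∧ (S i) ⁅ f i ⁆) (trans (cong (ind (S i) *_) (count-⁅⁆ (f i))) (*-identityʳ _)))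
    (sym (count≡sum S)))
  where
  disj : ∀ a b → a ≢ b → Disjoint (λ x → S a ∧ ⁅ f a ⁆ x) (λ x → S b ∧ ⁅ f b ⁆ x)
  disj a b a≢b x h = ≢true⇒≡false λ h' → a≢b (inj
    (trans (⁅⁆-elim (f a) x (proj₂ (∧-elim {S a} h))) (sym (⁅⁆-elim (f b) x (proj₂ (∧-elim {S b} h'))))))

enum : (A : VSet n) → Fin (count A) → Fin n
enum {suc n} A i with A Fin.zero
enum {suc n} A Fin.zero    | true  = Fin.zero
enum {suc n} A (Fin.suc i) | true  = Fin.suc (enum (A ∘ Fin.suc) i)
enum {suc n} A i           | false = Fin.suc (enum (A ∘ Fin.suc) i)

enum∈ : (A : VSet n) → ∀ i → enum A i ∈ₛ A
enum∈ {suc n} A i with A Fin.zero in eq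
enum∈ {suc n} A Fin.zero    | true  = eq
enum∈ {suc n} A (Fin.suc i) | true  = enum∈ (A ∘ Fin.suc) i
enum∈ {suc n} A i           | false = enum∈ (A ∘ Fin.suc) i

enum-injective : (A : VSet n) → Injective _≡_ _≡_ (enum A)
enum-injective {suc n} A {i} {j} eq with A Fin.zero
enum-injective {suc n} A {Fin.zero}  {Fin.zero}  eq | true  = refl
enum-injective {suc n} A {Fin.suc i} {Fin.suc j} eq | true  = cong Fin.suc (enum-injective (A ∘ Fin.suc) (Fin-suc-injective eq))
enum-injective {suc n} A {i} {j} eq | false = enum-injective (A ∘ Fin.suc) (Fin-suc-injective eq)

induced : (T : Tournament) → VSet (size T) → Tournament
induced T A .size = count A
induced T A .adj i j = adj T (enum A i) (enum A j)
induced T A .irrefl i = irrefl T (enum A i)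
induced T A .tourn i j i≢j = tourn T _ _ (i≢j ∘ enum-injective A)

EdgeTrans-image : (T U : Tournament) (f : Fin (size U) → Fin (size T)) →
  (∀ i j → adj T (f i) (f j) ≡ adj U i j) → ∀ {S} → EdgeTrans U S → EdgeTrans T (image f S)
EdgeTrans-image T U f h {S} t x y z x∈ y∈ z∈ xy yz
  with image-elim f S x∈ | image-elim f S y∈ | image-elim f S z∈
... | i , i∈ , refl | j , j∈ , refl | l , l∈ , refl =
  trans (h i l) (t i j l i∈ j∈ l∈ (trans (sym (h i j)) xy) (trans (sym (h j l)) yz))

Contains-induced : ∀ T A {H} → Contains (induced T A) H → Contains T H
Contains-induced T A (x , inj , iso) = enum A ∘ x , inj ∘ enum-injective A , iso

-- Sparse pairs from a failed greedy embedding

factor>0 : ∀ {a b c} → 0 < a → a ≤ b * c → 0 < c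
factor>0 {b = b} {zero}  0<a h = ⊥-elim (<⇒≱ 0<a (≤-trans h (≤-reflexive (*-zeroʳ b))))
factor>0 {c = suc c} _ _ = s≤s z≤n

n≤4⌊n/2⌋ : ∀ n → 2 ≤ n → n ≤ 4 * ⌊ n /2⌋
n≤4⌊n/2⌋ n 2≤n = begin
  n ≡⟨ ⌊n/2⌋+⌈n/2⌉≡n n ⟨
  ⌊ n /2⌋ + ⌈ n /2⌉ ≤⟨ +-monoʳ-≤ ⌊ n /2⌋ (⌊n/2⌋-mono (n≤1+n (suc n))) ⟩
  ⌊ n /2⌋ + suc ⌊ n /2⌋ ≤⟨ +-monoʳ-≤ ⌊ n /2⌋ (+-monoˡ-≤ ⌊ n /2⌋ {1} {⌊ n /2⌋} (⌊n/2⌋-mono 2≤n)) ⟩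
  ⌊ n /2⌋ + (⌊ n /2⌋ + ⌊ n /2⌋) ≤⟨ +-monoʳ-≤ ⌊ n /2⌋ (+-monoʳ-≤ ⌊ n /2⌋ (m≤m+n _ _)) ⟩
  4 * ⌊ n /2⌋ ∎
  where open ≤-Reasoning

half-left : ∀ {a} b c → a ≡ b + c → 2 * b ≤ a → a ≤ 2 * c
half-left {a} b c refl h = ≤-trans (+-monoˡ-≤ c b≤c) (≤-reflexive (cong (c +_) (sym (+-identityʳ c))))
  where
  b≤c : b ≤ c
  b≤c = +-cancelˡ-≤ b b c (≤-trans (≤-reflexive (cong (b +_) (sym (+-identityʳ b)))) h)

dirAdj : (T : Tournament) → Bool → Fin (size T) → Fin (size T) → Bool
dirAdj T d x y = if d then adj T x y else adj T y x

module _ (Λ : ℕ → ℕ) where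

  -- `K` expresses that the candidate sets still have at least N/K vertices. The left operand is the
  -- constant of a pair found at the present step; the right one continues with candidate sets that
  -- have shrunk by the factor `4 * suc (Λ (4 * h * K))`.
  pairBound : ℕ → ℕ → ℕ
  pairBound zero    K = 0
  pairBound (suc h) K = 4 * h * K ⊔ pairBound h (K * (4 * suc (Λ (4 * h * K))))

  -- The constant `D` is part of the data because the density demanded in `light` is a function of
  -- it: the sparser pairs are wanted, the smaller they may be, and `D` is known only when the
  -- embedding has stopped.
  record Pair (T : Tournament) (A : VSet (size T)) (N bound : ℕ) : Set where
    field
      D : ℕ
      D≤ : D ≤ bound
      X Y : VSet (size T)
      X⊆ : X ⊆ₛ A
      Y⊆ : Y ⊆ₛ A
      X#Y : Disjoint X Y
      bigX : N ≤ D * count X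
      bigY : N ≤ D * count Y
      light : ∀ x → x ∈ₛ X → suc (Λ D) * count (λ y → Y y ∧ adj T y x) ≤ count Y

  -- The direction of a sparse pair is irrelevant: if few edges go from X to Y, the
  -- vertices of Y which receive few of them form, together with X, a pair of the other kind.
  orient : (T : Tournament) (A : VSet (size T)) (d : Bool) (X Y : VSet (size T)) (N h K : ℕ) →
    X ⊆ₛ A → Y ⊆ₛ A → 0 < N → 2 ≤ count Y → 0 < h → N ≤ h * K * count X → N ≤ K * count Y →
    (∀ x → x ∈ₛ X → 4 * suc (Λ (4 * h * K)) * count (λ y → Y y ∧ dirAdj T d x y) ≤ count Y) →
    Pair T A N (4 * h * K)
  orient T A d X Y N h K X⊆ Y⊆ 0<N 2≤Y 0<h bigX bigY sparse
    -- `X` and `Y` may overlap, since all candidate sets start out equal. Cutting `X` down to at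
    -- most half the size of `Y` leaves half of `Y` outside it.
    with subset-of-size X (count X ⊓ ⌊ count Y /2⌋) (m⊓n≤m _ _)
  ... | X' , X'⊆ , cX' = result d refl
    where
    open ≤-Reasoning
    D = 4 * h * K
    L = suc (Λ D)
    Y' = Y ∖ X'
    K≤hK : K ≤ h * K
    K≤hK = ≤-trans (≤-reflexive (sym (+-identityʳ K))) (*-monoˡ-≤ K 0<h)
    bigX' : N ≤ D * count X'
    bigX' with ⊓-sel (count X) ⌊ count Y /2⌋
    ... | inj₁ eq = begin
      N ≤⟨ bigX ⟩
      h * K * count X ≤⟨ m≤m+n _ (3 * (h * K * count X)) ⟩
      4 * (h * K * count X) ≡⟨ regroup h K (count X) ⟩
      D * count X ≡⟨ cong (D *_) (trans cX' eq) ⟨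
      D * count X' ∎
      where
      regroup : ∀ h K x → 4 * (h * K * x) ≡ 4 * h * K * x
      regroup = solve-∀
    ... | inj₂ eq = begin
      N ≤⟨ bigY ⟩
      K * count Y ≤⟨ *-monoʳ-≤ K (n≤4⌊n/2⌋ (count Y) 2≤Y) ⟩
      K * (4 * ⌊ count Y /2⌋) ≤⟨ *-monoˡ-≤ (4 * ⌊ count Y /2⌋) K≤hK ⟩
      h * K * (4 * ⌊ count Y /2⌋) ≡⟨ regroup h K ⌊ count Y /2⌋ ⟩
      D * ⌊ count Y /2⌋ ≡⟨ cong (D *_) (trans cX' eq) ⟨
      D * count X' ∎
      where
      regroup : ∀ h K x → h * K * (4 * x) ≡ 4 * h * K * x
      regroup = solve-∀
    Y≤2Y' : count Y ≤ 2 * count Y'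
    Y≤2Y' = half-left (count (Y ∩ X')) (count Y') (count-split Y X') (begin
      2 * count (Y ∩ X') ≤⟨ *-monoʳ-≤ 2 (count-mono {X = Y ∩ X'} {X'} λ y y∈ → proj₂ (∧-elim {Y y} y∈)) ⟩
      2 * count X' ≡⟨ cong (2 *_) cX' ⟩
      2 * (count X ⊓ ⌊ count Y /2⌋) ≤⟨ *-monoʳ-≤ 2 (m⊓n≤n (count X) _) ⟩
      2 * ⌊ count Y /2⌋ ≡⟨ cong (⌊ count Y /2⌋ +_) (+-identityʳ _) ⟩
      ⌊ count Y /2⌋ + ⌊ count Y /2⌋ ≤⟨ +-monoʳ-≤ ⌊ count Y /2⌋ (⌊n/2⌋≤⌈n/2⌉ (count Y)) ⟩
      ⌊ count Y /2⌋ + ⌈ count Y /2⌉ ≡⟨ ⌊n/2⌋+⌈n/2⌉≡n (count Y) ⟩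
      count Y ∎)
    bigY' : N ≤ 2 * K * count Y'
    bigY' = begin
      N ≤⟨ bigY ⟩
      K * count Y ≤⟨ *-monoʳ-≤ K Y≤2Y' ⟩
      K * (2 * count Y') ≡⟨ regroup K (count Y') ⟩
      2 * K * count Y' ∎
      where
      regroup : ∀ K y → K * (2 * y) ≡ 2 * K * y
      regroup = solve-∀
    2K≤ : ∀ y → 2 * K * (2 * y) ≤ D * y
    2K≤ y = begin
      2 * K * (2 * y) ≡⟨ regroup K y ⟩
      K * (4 * y) ≤⟨ *-monoˡ-≤ (4 * y) K≤hK ⟩
      h * K * (4 * y) ≡⟨ regroup' h K y ⟩
      D * y ∎
      where
      regroup : ∀ K y → 2 * K * (2 * y) ≡ K * (4 * y)
      regroup = solve-∀
      regroup' : ∀ h K y → h * K * (4 * y) ≡ 4 * h * K * y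
      regroup' = solve-∀
    -- Of the factor 4 in the hypothesis, one 2 pays for halving `Y`; the other is kept for
    -- discarding the popular vertices `Z` when the direction is reversed.
    sparse' : ∀ x → x ∈ₛ X' → L * 2 * count (λ y → Y' y ∧ dirAdj T d x y) ≤ count Y'
    sparse' x x∈ = *-cancelˡ-≤ 2 (begin
      2 * (L * 2 * count (λ y → Y' y ∧ dirAdj T d x y)) ≡⟨ regroup L (count (λ y → Y' y ∧ dirAdj T d x y)) ⟩
      4 * L * count (λ y → Y' y ∧ dirAdj T d x y) ≤⟨ *-monoʳ-≤ (4 * L) (count-mono {X = λ y → Y' y ∧ dirAdj T d x y} {λ y → Y y ∧ dirAdj T d x y} λ y y∈ →
        let p , q = ∧-elim {Y' y} y∈ in ∧-intro (∖⊆ Y X' y p) q) ⟩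
      4 * L * count (λ y → Y y ∧ dirAdj T d x y) ≤⟨ sparse x (X'⊆ x x∈) ⟩
      count Y ≤⟨ Y≤2Y' ⟩
      2 * count Y' ∎)
      where
      regroup : ∀ L c → 2 * (L * 2 * c) ≡ 4 * L * c
      regroup = solve-∀
    Y'⊆ : Y' ⊆ₛ A
    Y'⊆ y y∈ = Y⊆ y (∖⊆ Y X' y y∈)
    result : ∀ d' → d ≡ d' → Pair T A N D
    result false refl = record
      { D = D ; D≤ = ≤-refl ; X = X' ; Y = Y' ; X⊆ = λ x x∈ → X⊆ x (X'⊆ x x∈) ; Y⊆ = Y'⊆
      ; X#Y = ∖-Disjoint Y X' ; bigX = bigX'
      ; bigY = ≤-trans bigY' (≤-trans (*-monoʳ-≤ (2 * K) (m≤m+n _ _)) (2K≤ (count Y')))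
      ; light = λ x x∈ → ≤-trans (*-monoˡ-≤ (count (λ y → Y' y ∧ adj T y x)) (m≤m*n L 2)) (sparse' x x∈) }
    result true refl = record
      { D = D ; D≤ = ≤-refl ; X = Y' ∖ Z ; Y = X' ; X⊆ = λ x x∈ → Y'⊆ x (∖⊆ Y' Z x x∈)
      ; Y⊆ = λ x x∈ → X⊆ x (X'⊆ x x∈)
      ; X#Y = Disjoint-sym {X = X'} {Y' ∖ Z} (Disjoint-⊆ {X = X'} {X'} {Y'} {Y' ∖ Z} (λ _ h → h) (∖⊆ Y' Z) (∖-Disjoint Y X'))
      ; bigX = ≤-trans bigY' (≤-trans (*-monoʳ-≤ (2 * K) Y'≤2Y°) (2K≤ (count (Y' ∖ Z)))) ; bigY = bigX'
      ; light = light }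
      where
      Z : VSet (size T)
      Z y = Y' y ∧ not ⌊ L * count (λ x → X' x ∧ adj T x y) ≤? count X' ⌋
      Y'≤2Y° : count Y' ≤ 2 * count (Y' ∖ Z)
      Y'≤2Y° = half-left (count Z) (count (Y' ∖ Z)) (count-∖ Y' Z λ y y∈ → proj₁ (∧-elim {Y' y} y∈))
        (few-popular-cancel (adj T) X' Y' 2 L (factor>0 {b = D} 0<N bigX') (s≤s z≤n) sparse')
      light : ∀ y → y ∈ₛ (Y' ∖ Z) → L * count (λ x → X' x ∧ adj T x y) ≤ count X'
      light y y∈ with ∧-elim {Y' y} y∈
      ... | yY' , nz with L * count (λ x → X' x ∧ adj T x y) ≤? count X'
      ... | yes p = p
      ... | no _ rewrite yY' = ⊥-elim (true≢false nz refl)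

  Pair-weaken : ∀ {T A N b b'} → b ≤ b' → Pair T A N b → Pair T A N b'
  Pair-weaken b≤b' P = record { Pair P ; D≤ = ≤-trans (Pair.D≤ P) b≤b' }

  -- `V j` holds the candidates for vertex `j` of the pattern `r`. A vertex of the first set is good
  -- if its neighbours of the right kind keep a fixed share of every other `V j`. If no vertex is
  -- good, each blames some `j`; the most blamed `j` is blamed by a share 1/h of the first set, and
  -- these vertices are sparse towards `V j`.
  embed : (T : Tournament) (A : VSet (size T)) (N : ℕ) → 0 < N →
    ∀ h (r : Fin h → Fin h → Bool) → (∀ a b → a ≢ b → r a b ≡ not (r b a)) →
    ∀ K → 0 < K → pairBound h K ≤ N → (V : Fin h → VSet (size T)) → (∀ j → V j ⊆ₛ A) → (∀ j → N ≤ K * count (V j)) →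
    Pair T A N (pairBound h K) ⊎
    (∃ λ (φ : Fin h → Fin (size T)) → (∀ j → φ j ∈ₛ V j) × (∀ a b → a ≢ b → adj T (φ a) (φ b) ≡ r a b))
  embed T A N 0<N zero r anti K 0<K b≤ V V⊆ big = inj₂ ((λ ()) , (λ ()) , λ ())
  embed T A N 0<N (suc h) r anti K 0<K b≤ V V⊆ big
    with any? (λ v → (V Fin.zero v ≟ᵇ true) ×-dec
      all? (λ j → count (V (Fin.suc j)) ≤? 4 * suc (Λ (4 * h * K)) * count (V (Fin.suc j) ∩ dirAdj T (r Fin.zero (Fin.suc j)) v)))
  ... | yes (v , v∈ , good) = [ inj₁ ∘ Pair-weaken (m≤n⊔m (4 * h * K) _) , inj₂ ∘ extend ]′
        (embed T A N 0<N h (λ a b → r (Fin.suc a) (Fin.suc b)) (λ a b a≢b → anti _ _ (a≢b ∘ Fin-suc-injective))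
          (K * L) (*-mono-≤ 0<K (s≤s z≤n)) (≤-trans (m≤n⊔m (4 * h * K) _) b≤) V'
          (λ j y y∈ → V⊆ (Fin.suc j) y (∩⊆ˡ {X = V (Fin.suc j)} {dirAdj T (r Fin.zero (Fin.suc j)) v} y y∈))
          λ j → ≤-trans (big (Fin.suc j)) (≤-trans (*-monoʳ-≤ K (good j)) (≤-reflexive (sym (*-assoc K L _)))))
    where
    L = 4 * suc (Λ (4 * h * K))
    V' : Fin h → VSet (size T)
    V' j = V (Fin.suc j) ∩ dirAdj T (r Fin.zero (Fin.suc j)) v
    extend : (∃ λ (φ : Fin h → Fin (size T)) → (∀ j → φ j ∈ₛ V' j) × (∀ a b → a ≢ b → adj T (φ a) (φ b) ≡ r (Fin.suc a) (Fin.suc b))) →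
      ∃ λ (φ : Fin (suc h) → Fin (size T)) → (∀ j → φ j ∈ₛ V j) × (∀ a b → a ≢ b → adj T (φ a) (φ b) ≡ r a b)
    extend (φ , φ∈ , φr) = ψ , ψ∈ , ψr
      where
      ψ : Fin (suc h) → Fin (size T)
      ψ Fin.zero    = v
      ψ (Fin.suc j) = φ j
      ψ∈ : ∀ j → ψ j ∈ₛ V j
      ψ∈ Fin.zero    = v∈
      ψ∈ (Fin.suc j) = proj₁ (∧-elim (φ∈ j))
      dir : ∀ d {x y} → dirAdj T d x y ≡ true → adj T x y ≡ d × adj T y x ≡ not d
      dir true  {x} {y} e = e , trans (tourn T y x (edge⇒≢ T e ∘ sym)) (cong not e)
      dir false {x} {y} e = trans (tourn T x y (edge⇒≢ T e ∘ sym)) (cong not e) , e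
      ψr : ∀ a b → a ≢ b → adj T (ψ a) (ψ b) ≡ r a b
      ψr Fin.zero Fin.zero a≢b = ⊥-elim (a≢b refl)
      ψr Fin.zero (Fin.suc b) a≢b = proj₁ (dir (r Fin.zero (Fin.suc b)) (proj₂ (∧-elim (φ∈ b))))
      ψr (Fin.suc a) Fin.zero a≢b = trans (proj₂ (dir (r Fin.zero (Fin.suc a)) (proj₂ (∧-elim (φ∈ a))))) (sym (anti _ _ a≢b))
      ψr (Fin.suc a) (Fin.suc b) a≢b = φr a b (a≢b ∘ cong Fin.suc)
  ... | no none = inj₁ (Pair-weaken (m≤m⊔n (4 * h * K) _) fromBad)
    where
    open ≤-Reasoning
    L = 4 * suc (Λ (4 * h * K))
    good? : ∀ v j → Dec (count (V (Fin.suc j)) ≤ L * count (V (Fin.suc j) ∩ dirAdj T (r Fin.zero (Fin.suc j)) v))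
    good? v j = count (V (Fin.suc j)) ≤? L * count (V (Fin.suc j) ∩ dirAdj T (r Fin.zero (Fin.suc j)) v)
    bad : Fin h → VSet (size T)
    bad j v = V Fin.zero v ∧ not ⌊ good? v j ⌋
    covered : V Fin.zero ⊆ₛ ⋃ₛ bad
    covered v v∈ with ¬∀⟶∃¬ h _ (good? v) (λ good → none (v , v∈ , good))
    ... | j , ¬good = ⋃-intro bad j v (∧-intro v∈ (not-intro (⌊⌋-complete¬ (good? v j) ¬good)))
    pigeon : ∃ λ j → count (V Fin.zero) ≤ h * count (bad j)
    pigeon = sum-pigeonhole (count ∘ bad) (factor>0 {b = K} 0<N (big Fin.zero)) (≤-trans (count-mono covered) (count-⋃≤ bad))
    fromBad : Pair T A N (4 * h * K)
    fromBad with pigeon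
    ... | j , V≤ = orient T A (r Fin.zero (Fin.suc j)) (bad j) (V (Fin.suc j)) N h K
        (λ v v∈ → V⊆ Fin.zero v (proj₁ (∧-elim {V Fin.zero v} v∈))) (V⊆ (Fin.suc j)) 0<N
        (≤-trans (s≤s (s≤s z≤n)) 4≤V) 0<h
        (≤-trans (big Fin.zero) (≤-trans (*-monoʳ-≤ K V≤) (≤-reflexive (regroup K h _)))) (big (Fin.suc j))
        λ v v∈ → <⇒≤ (≰⇒> λ good → true≢false (⌊⌋-complete (good? v j) good) (not-elim (proj₂ (∧-elim {V Fin.zero v} v∈))))
      where
      regroup : ∀ K h x → K * (h * x) ≡ h * K * x
      regroup = solve-∀
      0<h : 0 < h
      0<h = ≤-trans (s≤s z≤n) (Data.Fin.Properties.toℕ<n j)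
      -- This is where `pairBound` being at most `N` matters: `orient` has to halve this set.
      4≤V : 4 ≤ count (V (Fin.suc j))
      4≤V = *-cancelˡ-≤ K ⦃ >-nonZero 0<K ⦄ (begin
        K * 4 ≡⟨ *-comm K 4 ⟩
        4 * K ≤⟨ *-monoˡ-≤ K (*-monoʳ-≤ 4 0<h) ⟩
        4 * h * K ≤⟨ m≤m⊔n (4 * h * K) _ ⟩
        pairBound (suc h) K ≤⟨ b≤ ⟩
        N ≤⟨ big (Fin.suc j) ⟩
        K * count (V (Fin.suc j)) ∎)

  abstract
    pair-or-copy : (T : Tournament) (A : VSet (size T)) → 0 < count A → (H : Tournament) →
      pairBound (size H) 1 ≤ count A → ¬ Contains T (raw H) → Pair T A (count A) (pairBound (size H) 1)
    pair-or-copy T A 0<A H b≤ free with embed T A (count A) 0<A (size H) (adj H) (tourn H) 1 (s≤s z≤n) b≤ (λ _ → A) (λ _ _ h → h) (λ _ → ≤-reflexive (sym (+-identityʳ _)))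
    ... | inj₁ P = P
    ... | inj₂ (φ , _ , φr) = ⊥-elim (free (φ , inj , iso))
      where
      iso : ∀ a b → adj T (φ a) (φ b) ≡ adj H a b
      iso a b with a Fin.≟ b
      ... | yes refl = trans (irrefl T (φ a)) (sym (irrefl H a))
      ... | no a≢b = φr a b a≢b
      -- The candidate sets all equal `A`, so distinctness is not built in. But two vertices with a
      -- common image would have no edge in either direction, whereas `H` has one.
      inj : ∀ {a b} → φ a ≡ φ b → a ≡ b
      inj {a} {b} eq with a Fin.≟ b
      ... | yes p = p
      ... | no a≢b = ⊥-elim (true≢false (trans (tourn H a b a≢b) (cong not (noEdge (sym eq) (a≢b ∘ sym)))) (noEdge eq a≢b))
        where
        noEdge : ∀ {a b} → φ a ≡ φ b → a ≢ b → adj H a b ≡ false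
        noEdge {a} {b} eq a≢b = trans (sym (φr a b a≢b)) (trans (cong (λ z → adj T z (φ b)) eq) (irrefl T (φ b)))

-- Building an m-sequence

maxUpTo : ℕ → (ℕ → ℕ) → ℕ
maxUpTo zero    f = f 0
maxUpTo (suc n) f = f (suc n) ⊔ maxUpTo n f

≤maxUpTo : (f : ℕ → ℕ) → ∀ {i n} → i ≤ n → f i ≤ maxUpTo n f
≤maxUpTo f {zero} {zero} _ = ≤-refl
≤maxUpTo f {i} {suc n} i≤ with m≤n⇒m<n∨m≡n i≤
... | inj₁ (s≤s i≤n) = ≤-trans (≤maxUpTo f i≤n) (m≤n⊔m (f (suc n)) _)
... | inj₂ refl = m≤m⊔n _ _

Monotone : (ℕ → ℕ) → Set
Monotone f = ∀ {i j} → i ≤ j → f i ≤ f j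

maxUpTo-monotone : (f : ℕ → ℕ) → Monotone (λ n → maxUpTo n f)
maxUpTo-monotone f {zero} {zero} _ = ≤-refl
maxUpTo-monotone f {i} {suc j} i≤ with m≤n⇒m<n∨m≡n i≤
... | inj₁ (s≤s i≤j) = ≤-trans (maxUpTo-monotone f i≤j) (m≤n⊔m (f (suc j)) _)
... | inj₂ refl = ≤-refl

n≤2e[n/e] : ∀ n e .⦃ _ : NonZero e ⦄ → e ≤ n → n ≤ 2 * e * (n / e)
n≤2e[n/e] n e e≤n = begin
  n ≡⟨ m≡m%n+[m/n]*n n e ⟩
  n % e + n / e * e ≤⟨ +-monoˡ-≤ (n / e * e) (<⇒≤ (m%n<n n e)) ⟩
  e + n / e * e ≡⟨ cong (_+ n / e * e) (*-identityˡ e) ⟨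
  1 * e + n / e * e ≤⟨ +-monoˡ-≤ (n / e * e) (*-monoˡ-≤ e (m≥n⇒m/n>0 {n} {e} e≤n)) ⟩
  n / e * e + n / e * e ≡⟨ regroup (n / e) e ⟩
  2 * e * (n / e) ∎
  where
  open ≤-Reasoning
  regroup : ∀ q e → q * e + q * e ≡ 2 * e * q
  regroup = solve-∀

-- An m-sequence with constants 1/C and 1/L.  The density condition bounds the back edges of
-- every single vertex y, so that it survives passing to subsets of S_j.
record PartSeq (T : Tournament) (v : Vec Bool m) (ps : Vec ℕ m) (C L : ℕ) (A : VSet (size T)) : Set where
  field
    part : (i : Fin m) → Fin (lookup ps i) → VSet (size T)
    part⊆ : ∀ i a → part i a ⊆ₛ A
    complete : ∀ i a b → a Fin.< b → CompleteTo T (part i a) (part i b)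
    transitive : ∀ i → lookup v i ≡ true → EdgeTrans T (⋃ₛ (part i))
    bigTr : ∀ i → lookup v i ≡ true → ∀ a S → EdgeTrans T S → count S ≤ C * count (part i a)
    bigSize : ∀ i → lookup v i ≡ false → ∀ a → size T ≤ C * count (part i a)
    disjoint : ∀ i j → i Fin.< j → ∀ a b → Disjoint (part i a) (part j b)
    light : ∀ i j → i Fin.< j → ∀ a b y → y ∈ₛ part j b →
      L * count (λ x → part i a x ∧ adj T y x) ≤ count (part i a)

-- What is needed of `partsOf v η`, stated for any vector so that an induction can drop its head.
Valid : Vec Bool m → Vec ℕ m → Set
Valid v ps = ∀ i → 1 ≤ lookup ps i × (lookup v i ≡ false → lookup ps i ≡ 1)

partsOf-valid : (v : Vec Bool m) (η : Vec ℕ (ζ v)) → All (1 ≤_) η → Valid v (partsOf v η)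
partsOf-valid (true ∷ v)  (e ∷ η) (h ∷ hs) Fin.zero    = h , λ ()
partsOf-valid (true ∷ v)  (e ∷ η) (h ∷ hs) (Fin.suc i) = partsOf-valid v η hs i
partsOf-valid (false ∷ v) η hs Fin.zero    = s≤s z≤n , λ _ → refl
partsOf-valid (false ∷ v) η hs (Fin.suc i) = partsOf-valid v η hs i

-- Replaces the inequality tr(X) ≥ |X|^ε > c^ε tr(T) valid in a critical tournament.
Shrinking : Tournament → Set
Shrinking T = ∀ X → count X < size T → ∀ C → 1 ≤ C → size T ≤ C * count X →
  ∃ λ S → S ⊆ₛ X × EdgeTrans T S × (∀ S' → EdgeTrans T S' → count S' ≤ C * count S)

record FirstSet (T : Tournament) (b : Bool) (e C : ℕ) (X : VSet (size T)) : Set where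
  field
    part : Fin e → VSet (size T)
    part⊆ : ∀ a → part a ⊆ₛ X
    complete : ∀ a b → a Fin.< b → CompleteTo T (part a) (part b)
    transitive : b ≡ true → EdgeTrans T (⋃ₛ part)
    bigTr : b ≡ true → ∀ a S → EdgeTrans T S → count S ≤ C * count (part a)
    bigSize : b ≡ false → ∀ a → size T ≤ C * count (part a)
    nonempty : ∀ a → 0 < count (part a)

abstract
  -- For `b = false` the set `X` itself serves. Otherwise `S` is cut into `e` intervals: this costs
  -- a factor `e`, and rounding |S|/e down costs at most a factor 2, since `e ≤ count S`.
  firstSet : (T : Tournament) → ∀ b e → 1 ≤ e → (b ≡ false → e ≡ 1) → (M : ℕ) → 0 < size T →
    (X S : VSet (size T)) → size T ≤ M * count X → S ⊆ₛ X → EdgeTrans T S →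
    (∀ S' → EdgeTrans T S' → count S' ≤ M * count S) → e ≤ count S → FirstSet T b e (2 * e * M) X
  firstSet T false e 1≤e e≡1 M 0<n X S bigX S⊆ tS max e≤S with e≡1 refl
  ... | refl = record
    { part = λ _ → X ; part⊆ = λ _ _ h → h ; complete = λ { Fin.zero Fin.zero () }
    ; transitive = λ () ; bigTr = λ () ; bigSize = λ _ _ → ≤-trans bigX (*-monoˡ-≤ (count X) (m≤n*m M 2))
    ; nonempty = λ _ → factor>0 {b = M} 0<n bigX }
  firstSet T true e@(suc _) 1≤e _ M 0<n X S bigX S⊆ tS max e≤S
    with chunks T e (count S / e) S tS (≤-trans (≤-reflexive (*-comm e _)) (m/n*n≤m (count S) e))
  ... | P , P⊆ , cP , PP = record
    { part = P ; part⊆ = λ a x x∈ → S⊆ x (P⊆ a x x∈) ; complete = PP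
    ; transitive = λ _ → EdgeTrans-⊆ T (λ x x∈ → let a , h = ⋃-elim P x x∈ in P⊆ a x h) tS
    ; bigTr = λ _ → bigTr ; bigSize = λ ()
    ; nonempty = λ a → ≤-trans (m≥n⇒m/n>0 {count S} {e} e≤S) (≤-reflexive (sym (cP a))) }
    where
    open ≤-Reasoning
    regroup : ∀ e M p → M * (2 * e * p) ≡ 2 * e * M * p
    regroup = solve-∀
    bigTr : ∀ a S' → EdgeTrans T S' → count S' ≤ 2 * e * M * count (P a)
    bigTr a S' t = begin
      count S' ≤⟨ max S' t ⟩
      M * count S ≤⟨ *-monoʳ-≤ M (n≤2e[n/e] (count S) e e≤S) ⟩
      M * (2 * e * (count S / e)) ≡⟨ regroup e M (count S / e) ⟩
      2 * e * M * (count S / e) ≡⟨ cong (2 * e * M *_) (cP a) ⟨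
      2 * e * M * count (P a) ∎

module _ (h : ℕ) where

  ownBound : ℕ → ℕ → ℕ → ℕ
  ownBound e K D = 2 * e * (K * D)

  mutual
    -- The density wanted for the first pair depends on the constant of the whole sequence, which
    -- depends on the size of that pair. The circle is broken by making the density a function of
    -- the constant `D` of the pair: given `D`, the rest of the sequence costs at most `restBound`.
    -- The rest uses `Λ (c ⊔ ownBound e K D)` because the final constant is the larger of its own
    -- and that of the first set.
    seqBound : Vec ℕ m → (ℕ → ℕ) → ℕ → ℕ
    seqBound []       Λ K = 0
    seqBound (e ∷ ps) Λ K = K * pairBound (pairDensity e ps Λ K) h 1 ⊔
      maxUpTo (pairBound (pairDensity e ps Λ K) h 1) (λ D → ownBound e K D ⊔ restBound e ps Λ K D)

    restBound : ℕ → Vec ℕ m → (ℕ → ℕ) → ℕ → ℕ → ℕ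
    restBound e ps Λ K D = seqBound ps (λ c → Λ (c ⊔ ownBound e K D)) (2 * (K * D))

    pairDensity : ℕ → Vec ℕ m → (ℕ → ℕ) → ℕ → ℕ → ℕ
    pairDensity e ps Λ K D = suc (Λ (restBound e ps Λ K D ⊔ ownBound e K D)) * (2 * e)

PartSeq-∷ : ∀ {T b e C L} {v : Vec Bool m} {ps X Y' A C₁ C₂ L'} → C₁ ≤ C → C₂ ≤ C → X ⊆ₛ A → Y' ⊆ₛ A → Disjoint X Y' →
  L ≤ L' → (S : FirstSet T b e C₁ X) →
  (∀ a y → y ∈ₛ Y' → L' * count (λ x → FirstSet.part S a x ∧ adj T y x) ≤ count (FirstSet.part S a)) →
  PartSeq T v ps C₂ L Y' → PartSeq T (b ∷ v) (e ∷ ps) C L A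
PartSeq-∷ {T = T} {b} {e} {C} {L} {v} {ps} {X} {Y'} {A} C₁≤ C₂≤ X⊆ Y'⊆ X#Y' L≤ S lightS χ = record
  { part = part'
  ; part⊆ = λ { Fin.zero a x x∈ → X⊆ x (S.part⊆ a x x∈) ; (Fin.suc i) a x x∈ → Y'⊆ x (χ.part⊆ i a x x∈) }
  ; complete = λ { Fin.zero → S.complete ; (Fin.suc i) → χ.complete i }
  ; transitive = λ { Fin.zero → S.transitive ; (Fin.suc i) → χ.transitive i }
  ; bigTr = λ { Fin.zero p a Q t → ≤-trans (S.bigTr p a Q t) (*-monoˡ-≤ _ C₁≤)
              ; (Fin.suc i) p a Q t → ≤-trans (χ.bigTr i p a Q t) (*-monoˡ-≤ _ C₂≤) }
  ; bigSize = λ { Fin.zero p a → ≤-trans (S.bigSize p a) (*-monoˡ-≤ _ C₁≤)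
                ; (Fin.suc i) p a → ≤-trans (χ.bigSize i p a) (*-monoˡ-≤ _ C₂≤) }
  ; disjoint = λ { Fin.zero (Fin.suc j) _ a b → Disjoint-⊆ {X = X} {S.part a} {Y'} {χ.part j b} (S.part⊆ a) (χ.part⊆ j b) X#Y'
                 ; (Fin.suc i) (Fin.suc j) (s≤s i<j) → χ.disjoint i j i<j }
  ; light = λ { Fin.zero (Fin.suc j) _ a b y y∈ → ≤-trans (*-monoˡ-≤ _ L≤) (lightS a y (χ.part⊆ j b y y∈))
              ; (Fin.suc i) (Fin.suc j) (s≤s i<j) → χ.light i j i<j } }
  where
  module S = FirstSet S
  module χ = PartSeq χ
  part' : (i : Fin _) → Fin (lookup (e ∷ ps) i) → VSet (size T)
  part' Fin.zero    = S.part
  part' (Fin.suc i) = χ.part i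

record Split (T : Tournament) (b : Bool) (e M L : ℕ) (A : VSet (size T)) : Set where
  field
    X Y : VSet (size T)
    X⊆ : X ⊆ₛ A
    Y⊆ : Y ⊆ₛ A
    X#Y : Disjoint X Y
    bigY : size T ≤ 2 * M * count Y
    first : FirstSet T b e (2 * e * M) X
    light : ∀ a y → y ∈ₛ Y →
      L * count (λ x → FirstSet.part first a x ∧ adj T y x) ≤ count (FirstSet.part first a)

-- A pair limits the back edges at each vertex of `X`, but an m-sequence must limit them at each
-- later vertex, separately for every part. Double counting each part against `Y` marks at most a
-- share 1/(2e) of `Y` as bad, so half of `Y` stays; this is the factor `2 * e` in `pairDensity`.
splitAfter : (T : Tournament) → 0 < size T → ∀ b e Λ L A N bound K → 0 < L → size T ≤ K * N →
  (P : Pair Λ T A N bound) → L * (2 * e) ≤ Λ (Pair.D P) → FirstSet T b e (2 * e * (K * Pair.D P)) (Pair.X P) →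
  Split T b e (K * Pair.D P) L A
splitAfter T 0<n b e Λ L A N bound K 0<L bigA P L≤ S = record
  { X = P.X ; Y = Y' ; X⊆ = P.X⊆ ; Y⊆ = λ y y∈ → P.Y⊆ y (∖⊆ P.Y (⋃ₛ Z) y y∈)
  ; X#Y = Disjoint-⊆ {X = P.X} {P.X} {P.Y} {Y'} (λ _ p → p) (∖⊆ P.Y (⋃ₛ Z)) P.X#Y
  ; bigY = ≤-trans bigY (≤-trans (*-monoʳ-≤ M Y≤2Y') (≤-reflexive (regroup M (count Y'))))
  ; first = S ; light = light }
  where
  module P = Pair P
  module S = FirstSet S
  M : ℕ
  M = K * P.D
  regroup : ∀ M y → M * (2 * y) ≡ 2 * M * y
  regroup = solve-∀
  bigY : size T ≤ M * count P.Y
  bigY = ≤-trans bigA (≤-trans (*-monoʳ-≤ K P.bigY) (≤-reflexive (sym (*-assoc K P.D _))))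
  Z : Fin e → VSet (size T)
  Z a y = P.Y y ∧ not ⌊ L * count (λ x → S.part a x ∧ adj T y x) ≤? count (S.part a) ⌋
  Y' : VSet (size T)
  Y' = P.Y ∖ ⋃ₛ Z
  light : ∀ a y → y ∈ₛ Y' → L * count (λ x → S.part a x ∧ adj T y x) ≤ count (S.part a)
  light a y y∈ with ∧-elim {P.Y y} y∈
  ... | yY , nz with L * count (λ x → S.part a x ∧ adj T y x) ≤? count (S.part a) in eq
  ... | yes p = p
  ... | no _ = ⊥-elim (true≢false (⋃-intro Z a y (∧-intro yY (cong (not ∘ ⌊_⌋) eq))) (not-elim nz))
  Y≤2Y' : count P.Y ≤ 2 * count Y'
  Y≤2Y' = half-left (count (⋃ₛ Z)) (count Y')
    (count-∖ P.Y (⋃ₛ Z) λ y y∈ → let a , p = ⋃-elim Z y y∈ in proj₁ (∧-elim {P.Y y} p))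
    (union-bound {M = 2} Z λ a → few-popular-cancel (flip (adj T)) (S.part a) P.Y (2 * e) L (S.nonempty a) 0<L
      λ x x∈ → ≤-trans (*-monoˡ-≤ _ (≤-trans L≤ (n≤1+n _))) (P.light x (S.part⊆ a x x∈)))

abstract
  split : (T : Tournament) → Shrinking T → 0 < size T → ∀ b e → 1 ≤ e → (b ≡ false → e ≡ 1) →
    (Smax : VSet (size T)) → EdgeTrans T Smax → ∀ Λ L A N bound K → 0 < L → size T ≤ K * N →
    (P : Pair Λ T A N bound) → L * (2 * e) ≤ Λ (Pair.D P) → 2 * e * (K * Pair.D P) ≤ count Smax →
    Split T b e (K * Pair.D P) L A
  split T shrink 0<n b e 1≤e e≡1 Smax tS Λ L A N bound K 0<L bigA P L≤ own≤ =
    cut (shrink P.X X<n M 0<M bigX)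
    where
    open ≤-Reasoning
    module P = Pair P
    M : ℕ
    M = K * P.D
    regroup : ∀ e M → M * e + M * e ≡ 2 * e * M
    regroup = solve-∀
    bigX : size T ≤ M * count P.X
    bigX = ≤-trans bigA (≤-trans (*-monoʳ-≤ K P.bigX) (≤-reflexive (sym (*-assoc K P.D _))))
    0<M : 0 < M
    0<M = factor>0 {b = count P.X} 0<n (≤-trans bigX (≤-reflexive (*-comm M _)))
    0<Y : 0 < count P.Y
    0<Y = factor>0 {b = K * P.D} 0<n (≤-trans bigA (≤-trans (*-monoʳ-≤ K P.bigY) (≤-reflexive (sym (*-assoc K P.D _)))))
    -- `Y` is nonempty and disjoint from `X`, so `X` is a proper subset and the criticality of `T`
    -- applies to it.
    X<n : count P.X < size T
    X<n = begin-strict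
      count P.X <⟨ m<m+n (count P.X) 0<Y ⟩
      count P.X + count P.Y ≡⟨ count-∪ {X = P.X} {P.Y} P.X#Y ⟨
      count (P.X ∪ P.Y) ≤⟨ count-≤ (P.X ∪ P.Y) ⟩
      size T ∎
    cut : (∃ λ S → S ⊆ₛ P.X × EdgeTrans T S × (∀ S' → EdgeTrans T S' → count S' ≤ M * count S)) → Split T b e M L A
    -- `Smax` has at least 2eM vertices and at most M|S|, so `S` is large enough to be cut into `e`
    -- nonempty intervals.
    cut (S , S⊆ , t , max) = splitAfter T 0<n b e Λ L A N bound K 0<L bigA P L≤
      (firstSet T b e 1≤e e≡1 M 0<n P.X S bigX S⊆ t max (*-cancelˡ-≤ M ⦃ >-nonZero 0<M ⦄ (begin
        M * e ≤⟨ m≤m+n (M * e) (M * e) ⟩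
        M * e + M * e ≡⟨ regroup e M ⟩
        2 * e * M ≤⟨ own≤ ⟩
        count Smax ≤⟨ max Smax tS ⟩
        M * count S ∎)))

-- `K` is the loss accumulated so far: the remaining sets are sought inside `A`, which still
-- contains a share 1/K of all vertices.
partSeq : (T H : Tournament) → ¬ Contains T (raw H) → Shrinking T → 0 < size T →
  (Smax : VSet (size T)) → EdgeTrans T Smax →
  (v : Vec Bool m) (ps : Vec ℕ m) → Valid v ps → (Λ : ℕ → ℕ) → Monotone Λ → (K : ℕ) → 0 < K →
  seqBound (size H) ps Λ K ≤ count Smax → (A : VSet (size T)) → size T ≤ K * count A →
  ∃ λ C → C ≤ seqBound (size H) ps Λ K × PartSeq T v ps C (Λ C) A
partSeq T H free shrink 0<n Smax tS [] [] valid Λ mono K 0<K b≤ A bigA = 0 , z≤n , record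
  { part = λ () ; part⊆ = λ () ; complete = λ () ; transitive = λ () ; bigTr = λ () ; bigSize = λ () ; disjoint = λ () ; light = λ () }
partSeq T H free shrink 0<n Smax tS (b ∷ v) (e ∷ ps) valid Λ mono K 0<K b≤ A bigA
  with pair-or-copy (pairDensity (size H) e ps Λ K) T A (factor>0 {b = K} 0<n bigA) H
    -- The left operand of `seqBound` is at most |Smax| ≤ |T| ≤ K|A|, so `A` has enough vertices for
    -- the embedding.
    (*-cancelˡ-≤ K ⦃ >-nonZero 0<K ⦄ (≤-trans (≤-trans (m≤m⊔n _ _) b≤) (≤-trans (count-≤ Smax) bigA))) free
... | P = finish (split T shrink 0<n b e (proj₁ (valid Fin.zero)) (proj₂ (valid Fin.zero)) Smax tS _ _ A _ _ K (s≤s z≤n) bigA P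
            ≤-refl (≤-trans (≤-trans (m≤m⊔n _ _) C≤) b≤))
  where
  h = size H
  D = Pair.D P
  own = ownBound h e K D
  rest = restBound h e ps Λ K D
  C≤ : own ⊔ rest ≤ seqBound h (e ∷ ps) Λ K
  C≤ = ≤-trans (≤maxUpTo (λ D → ownBound h e K D ⊔ restBound h e ps Λ K D) (Pair.D≤ P)) (m≤n⊔m _ _)
  finish : Split T b e (K * D) (suc (Λ (rest ⊔ own))) A →
    ∃ λ C → C ≤ seqBound h (e ∷ ps) Λ K × PartSeq T (b ∷ v) (e ∷ ps) C (Λ C) A
  finish Q with partSeq T H free shrink 0<n Smax tS v ps (valid ∘ Fin.suc) (λ c → Λ (c ⊔ own)) (λ i≤j → mono (⊔-monoˡ-≤ own i≤j))
      (2 * (K * D)) (factor>0 {b = count (Split.Y Q)} 0<n (≤-trans (Split.bigY Q) (≤-reflexive (*-comm (2 * (K * D)) _))))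
      (≤-trans (m≤n⊔m own rest) (≤-trans C≤ b≤)) (Split.Y Q) (Split.bigY Q)
  -- The pair was made sparse enough for the worst value `rest`; since `Cr ≤ rest` and Λ is
  -- monotone, it is sparse enough for the constant actually reached.
  ... | Cr , Cr≤ , χ = Cr ⊔ own , ≤-trans (≤-trans (⊔-monoˡ-≤ own Cr≤) (≤-reflexive (⊔-comm rest own))) C≤ ,
    PartSeq-∷ (m≤n⊔m Cr own) (m≤m⊔n Cr own) (Split.X⊆ Q) (Split.Y⊆ Q) (Split.X#Y Q)
      (≤-trans (mono (⊔-monoˡ-≤ own Cr≤)) (n≤1+n _)) (Split.first Q) (Split.light Q) χ

-- Unit fractions and inequalities between rationals

-- Kept abstract: normalising the quotient would run gcd on open terms.
abstract
  unit : ℕ → ℚ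
  unit C = ℤ.+ 1 ℚ./ suc C

  toℚᵘ-unit : ∀ C → toℚᵘ (unit C) ℚᵘ.≃ ℚᵘ.mkℚᵘ (ℤ.+ 1) C
  toℚᵘ-unit C = ℚ.toℚᵘ-fromℚᵘ (ℚᵘ.mkℚᵘ (ℤ.+ 1) C)

toℚᵘ-ℕ : ∀ n → toℚᵘ (ℕ→ℚ n) ℚᵘ.≃ ℚᵘ.mkℚᵘ (ℤ.+ n) 0
toℚᵘ-ℕ n = ℚ.toℚᵘ-fromℚᵘ (ℚᵘ.mkℚᵘ (ℤ.+ n) 0)

ℕ→ℚ-* : ∀ a b → ℕ→ℚ (a * b) ≡ ℕ→ℚ a ℚ.* ℕ→ℚ b
ℕ→ℚ-* a b = ℚ.toℚᵘ-injective (ℚᵘ.≃-trans (toℚᵘ-ℕ (a * b)) (ℚᵘ.≃-trans (ℚᵘ.*≡* (cong (ℤ._* ℤ.+ 1) (ℤ.pos-* a b)))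
  (ℚᵘ.≃-sym (ℚᵘ.≃-trans (ℚ.toℚᵘ-homo-* (ℕ→ℚ a) (ℕ→ℚ b)) (ℚᵘ.*-cong (toℚᵘ-ℕ a) (toℚᵘ-ℕ b))))))

ℕ→ℚ-+ : ∀ a b → ℕ→ℚ (a + b) ≡ ℕ→ℚ a ℚ.+ ℕ→ℚ b
ℕ→ℚ-+ a b = ℚ.toℚᵘ-injective (ℚᵘ.≃-trans (toℚᵘ-ℕ (a + b)) (ℚᵘ.≃-trans
  (ℚᵘ.*≡* (cong (ℤ._* ℤ.+ 1) (cong₂ ℤ._+_ (sym (ℤ.*-identityʳ (ℤ.+ a))) (sym (ℤ.*-identityʳ (ℤ.+ b))))))
  (ℚᵘ.≃-sym (ℚᵘ.≃-trans (ℚ.toℚᵘ-homo-+ (ℕ→ℚ a) (ℕ→ℚ b)) (ℚᵘ.+-cong (toℚᵘ-ℕ a) (toℚᵘ-ℕ b))))))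

ℕ→ℚ-mono : ∀ {a b} → a ≤ b → ℕ→ℚ a ℚ.≤ ℕ→ℚ b
ℕ→ℚ-mono {a} {b} h = ℚ.toℚᵘ-cancel-≤ (ℚᵘ.≤-respˡ-≃ (ℚᵘ.≃-sym (toℚᵘ-ℕ a)) (ℚᵘ.≤-respʳ-≃ (ℚᵘ.≃-sym (toℚᵘ-ℕ b))
  (ℚᵘ.*≤* (ℤ.*-monoʳ-≤-nonNeg (ℤ.+ 1) (ℤ.+≤+ h)))))

ℕ→ℚ-cancel : ∀ {a b} → ℕ→ℚ a ℚ.≤ ℕ→ℚ b → a ≤ b
ℕ→ℚ-cancel {a} {b} h with ℚᵘ.≤-respˡ-≃ (toℚᵘ-ℕ a) (ℚᵘ.≤-respʳ-≃ (toℚᵘ-ℕ b) (ℚ.toℚᵘ-mono-≤ h))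
... | ℚᵘ.*≤* q = ℤ.drop‿+≤+ (ℤ.*-cancelʳ-≤-pos (ℤ.+ a) (ℤ.+ b) (ℤ.+ 1) q)

unit-suc : ∀ C → unit C ℚ.* ℕ→ℚ (suc C) ≡ 1ℚ
unit-suc C = ℚ.toℚᵘ-injective (ℚᵘ.≃-trans (ℚ.toℚᵘ-homo-* (unit C) (ℕ→ℚ (suc C))) (ℚᵘ.≃-trans (ℚᵘ.*-cong (toℚᵘ-unit C) (toℚᵘ-ℕ (suc C)))
  (ℚᵘ.*≡* (cong ℤ.+_ (arith C)))))
  where
  arith : ∀ C → suc ((C + 0 * suc C) * 1) ≡ suc (C * 1 + 0 * suc (C * 1))
  arith = solve-∀

0≤unit : ∀ C → 0ℚ ℚ.≤ unit C
0≤unit C = ℚ.toℚᵘ-cancel-≤ (ℚᵘ.≤-respʳ-≃ (ℚᵘ.≃-sym (toℚᵘ-unit C)) (ℚᵘ.*≤* (ℤ.+≤+ z≤n)))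

0<unit : ∀ C → 0ℚ ℚ.< unit C
0<unit C = ℚ.toℚᵘ-cancel-< (ℚᵘ.<-respʳ-≃ (ℚᵘ.≃-sym (toℚᵘ-unit C)) (ℚᵘ.*<* (ℤ.+<+ (s≤s z≤n))))

unit<1 : ∀ C → unit (suc C) ℚ.< 1ℚ
unit<1 C = ℚ.toℚᵘ-cancel-< (ℚᵘ.<-respˡ-≃ (ℚᵘ.≃-sym (toℚᵘ-unit (suc C)))
  (ℚᵘ.*<* (ℤ.+<+ (s≤s (s≤s z≤n)))))

-- A positive rational is at least the reciprocal of its denominator.
archimedean : ∀ c → 0ℚ ℚ.< c → ∃ λ C → ∀ {D} → C ≤ D → unit D ℚ.≤ c
archimedean c@(mkℚ (ℤ.+ 0) d _) 0<c with ℤ.+<+ () ← ℚ.drop-*<* 0<c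
archimedean c@(mkℚ ℤ.-[1+ k ] d _) 0<c with () ← ℚ.drop-*<* 0<c
archimedean c@(mkℚ (ℤ.+ suc k) d _) 0<c = d , λ {D} d≤D → ℚ.toℚᵘ-cancel-≤ (ℚᵘ.≤-respˡ-≃ (ℚᵘ.≃-sym (toℚᵘ-unit D))
  (ℚᵘ.*≤* (ℤ.+≤+ (≤-trans (≤-reflexive (+-identityʳ (suc d))) (≤-trans (s≤s d≤D) (m≤m+n (suc D) (k * suc D)))))))

unit-≤ : ∀ C {a b} → a ≤ suc C * b → unit C ℚ.* ℕ→ℚ a ℚ.≤ ℕ→ℚ b
unit-≤ C {a} {b} h = begin
  unit C ℚ.* ℕ→ℚ a ≤⟨ ℚ.*-monoˡ-≤-nonNeg (unit C) ⦃ ℚ.nonNegative (0≤unit C) ⦄ (ℕ→ℚ-mono h) ⟩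
  unit C ℚ.* ℕ→ℚ (suc C * b) ≡⟨ cong (unit C ℚ.*_) (ℕ→ℚ-* (suc C) b) ⟩
  unit C ℚ.* (ℕ→ℚ (suc C) ℚ.* ℕ→ℚ b) ≡⟨ ℚ.*-assoc (unit C) (ℕ→ℚ (suc C)) (ℕ→ℚ b) ⟨
  (unit C ℚ.* ℕ→ℚ (suc C)) ℚ.* ℕ→ℚ b ≡⟨ cong (ℚ._* ℕ→ℚ b) (unit-suc C) ⟩
  1ℚ ℚ.* ℕ→ℚ b ≡⟨ ℚ.*-identityˡ (ℕ→ℚ b) ⟩
  ℕ→ℚ b ∎
  where open ℚ.≤-Reasoning

≤-unit : ∀ C {a b} → suc C * a ≤ b → ℕ→ℚ a ℚ.≤ unit C ℚ.* ℕ→ℚ b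
≤-unit C {a} {b} h = begin
  ℕ→ℚ a ≡⟨ ℚ.*-identityˡ (ℕ→ℚ a) ⟨
  1ℚ ℚ.* ℕ→ℚ a ≡⟨ cong (ℚ._* ℕ→ℚ a) (unit-suc C) ⟨
  (unit C ℚ.* ℕ→ℚ (suc C)) ℚ.* ℕ→ℚ a ≡⟨ ℚ.*-assoc (unit C) (ℕ→ℚ (suc C)) (ℕ→ℚ a) ⟩
  unit C ℚ.* (ℕ→ℚ (suc C) ℚ.* ℕ→ℚ a) ≡⟨ cong (unit C ℚ.*_) (ℕ→ℚ-* (suc C) a) ⟨
  unit C ℚ.* ℕ→ℚ (suc C * a) ≤⟨ ℚ.*-monoˡ-≤-nonNeg (unit C) ⦃ ℚ.nonNegative (0≤unit C) ⦄ (ℕ→ℚ-mono h) ⟩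
  unit C ℚ.* ℕ→ℚ b ∎
  where open ℚ.≤-Reasoning

unscale : ∀ c → 0ℚ ℚ.< c → ∃ λ C → ∀ {a b} → c ℚ.* ℕ→ℚ a ℚ.≤ ℕ→ℚ b → a ≤ suc C * b
unscale c 0<c with archimedean c 0<c
... | C , unit≤c = C , λ {a} {b} h → ℕ→ℚ-cancel (begin
    ℕ→ℚ a ≡⟨ ℚ.*-identityˡ (ℕ→ℚ a) ⟨
    1ℚ ℚ.* ℕ→ℚ a ≡⟨ cong (ℚ._* ℕ→ℚ a) (trans (ℚ.*-comm (ℕ→ℚ (suc C)) (unit C)) (unit-suc C)) ⟨
    (ℕ→ℚ (suc C) ℚ.* unit C) ℚ.* ℕ→ℚ a ≡⟨ ℚ.*-assoc (ℕ→ℚ (suc C)) (unit C) (ℕ→ℚ a) ⟩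
    ℕ→ℚ (suc C) ℚ.* (unit C ℚ.* ℕ→ℚ a) ≤⟨ ℚ.*-monoˡ-≤-nonNeg (ℕ→ℚ (suc C)) ⦃ nonNegℕ (suc C) ⦄
        (ℚ.≤-trans (ℚ.*-monoʳ-≤-nonNeg (ℕ→ℚ a) ⦃ nonNegℕ a ⦄ (unit≤c ≤-refl)) h) ⟩
    ℕ→ℚ (suc C) ℚ.* ℕ→ℚ b ≡⟨ ℕ→ℚ-* (suc C) b ⟨
    ℕ→ℚ (suc C * b) ∎)
  where
  open ℚ.≤-Reasoning
  nonNegℕ : ∀ n → ℚ.NonNegative (ℕ→ℚ n)
  nonNegℕ n = ℚ.nonNegative (ℕ→ℚ-mono {0} {n} z≤n)

density-unit : ∀ L {e e' N} → e + e' ≡ N → suc L * e' ≤ N → (1ℚ ℚ.- unit L) ℚ.* ℕ→ℚ N ℚ.≤ ℕ→ℚ e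
density-unit L {e} {e'} {N} eq h = begin
  (1ℚ ℚ.- unit L) ℚ.* ℕ→ℚ N ≡⟨ ℚ.*-distribʳ-+ (ℕ→ℚ N) 1ℚ (ℚ.- unit L) ⟩
  1ℚ ℚ.* ℕ→ℚ N ℚ.+ (ℚ.- unit L) ℚ.* ℕ→ℚ N ≡⟨ cong₂ ℚ._+_ (trans (ℚ.*-identityˡ (ℕ→ℚ N)) (trans (cong ℕ→ℚ (sym eq)) (ℕ→ℚ-+ e e'))) (sym (ℚ.neg-distribˡ-* (unit L) (ℕ→ℚ N))) ⟩
  (ℕ→ℚ e ℚ.+ ℕ→ℚ e') ℚ.+ ℚ.- (unit L ℚ.* ℕ→ℚ N) ≤⟨ ℚ.+-monoʳ-≤ (ℕ→ℚ e ℚ.+ ℕ→ℚ e') (ℚ.neg-antimono-≤ (≤-unit L h)) ⟩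
  (ℕ→ℚ e ℚ.+ ℕ→ℚ e') ℚ.+ ℚ.- ℕ→ℚ e' ≡⟨ ℚ.+-assoc (ℕ→ℚ e) (ℕ→ℚ e') (ℚ.- ℕ→ℚ e') ⟩
  ℕ→ℚ e ℚ.+ (ℕ→ℚ e' ℚ.+ ℚ.- ℕ→ℚ e') ≡⟨ cong (ℕ→ℚ e ℚ.+_) (ℚ.+-inverseʳ (ℕ→ℚ e')) ⟩
  ℕ→ℚ e ℚ.+ 0ℚ ≡⟨ ℚ.+-identityʳ (ℕ→ℚ e) ⟩
  ℕ→ℚ e ∎
  where open ℚ.≤-Reasoning

-- m-sequences from large subsets of the parts

part-nonempty : ∀ {T} {v : Vec Bool m} {ps C L A} (χ : PartSeq T v ps C L A) → 0 < size T → ∀ i a → 0 < count (PartSeq.part χ i a)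
part-nonempty {T = T} {v} {C = C} χ 0<n i a with lookup v i in eq
... | false = factor>0 {b = C} 0<n (PartSeq.bigSize χ i eq a)
... | true  = factor>0 {b = C} (s≤s z≤n) (≤-trans (≤-reflexive (sym (count-⁅⁆ x))) (PartSeq.bigTr χ i eq a ⁅ x ⁆ (EdgeTrans-⁅⁆ T x)))
  where x = Fin.fromℕ< 0<n

-- Shrinking every part to half costs a factor 2 in the size constant and a factor 2 in the share of
-- back edges at a vertex. The same conversion serves before and after the deletion around the first
-- copy.
toMSeq : ∀ {T} {v : Vec Bool m} {η : Vec ℕ (ζ v)} {C L A} → Valid v (partsOf v η) → (χ : PartSeq T v (partsOf v η) C L A) →
  (P : ∀ i → Fin (lookup (partsOf v η) i) → VSet (size T)) →
  (∀ i a → P i a ⊆ₛ PartSeq.part χ i a) → (∀ i a → count (PartSeq.part χ i a) ≤ 2 * count (P i a)) →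
  ∀ C' L' → 2 * C ≤ suc C' → 2 * suc L' ≤ L → MSeq T v η (unit C') (unit L')
toMSeq {m = m} {T} {v} {η} {C} {L} {A} valid χ P P⊆ half C' L' C≤ L≤ = record
  { part = P
  ; disjS = λ i j i≢j → disjS i j i≢j
  ; disjPart = disjPart
  ; transS = λ i vi → EdgeTrans⇒Transitive T (EdgeTrans-⊆ T (⋃⊆ i) (χ.transitive i vi))
  ; complS = λ i _ a b a<b x y x∈ y∈ → χ.complete i a b a<b x y (P⊆ i a x x∈) (P⊆ i b y y∈)
  ; bigPart = λ i vi a S t → unit-≤ C' (scale i a (χ.bigTr i vi a S (Transitive⇒EdgeTrans T t)))
  ; bigS = λ i vi → let a = Fin.fromℕ< (proj₁ (valid i)) in
      unit-≤ C' (≤-trans (scale i a (χ.bigSize i vi a)) (*-monoʳ-≤ (suc C') (count-mono {X = P i a} {⋃ₛ (P i)} (⋃-intro (P i) a))))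
  ; dense = λ i j i<j → density-unit L' (eXY-dual T {⋃ₛ (P i)} {⋃ₛ (P j)} (disjS i j (λ { refl → <-irrefl refl i<j }))) (dense i j i<j) }
  where
  open ≤-Reasoning
  module χ = PartSeq χ
  ⋃⊆ : ∀ i → ⋃ₛ (P i) ⊆ₛ ⋃ₛ (χ.part i)
  ⋃⊆ i x x∈ = let a , h = ⋃-elim (P i) x x∈ in ⋃-intro (χ.part i) a x (P⊆ i a x h)
  apart : ∀ i j → i Fin.< j → ∀ x → x ∈ₛ ⋃ₛ (P i) → x ∈ₛ ⋃ₛ (P j) → ⊥
  apart i j i<j x x∈ x∈' = let a , h = ⋃-elim (P i) x x∈ ; b , h' = ⋃-elim (P j) x x∈' in
    true≢false (P⊆ j b x h') (χ.disjoint i j i<j a b x (P⊆ i a x h))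
  disjS : ∀ i j → i ≢ j → Disjoint (⋃ₛ (P i)) (⋃ₛ (P j))
  disjS i j i≢j x x∈ = ≢true⇒≡false λ x∈' → cmp x∈ x∈'
    where
    cmp : x ∈ₛ ⋃ₛ (P i) → x ∈ₛ ⋃ₛ (P j) → ⊥
    cmp p q with Fin-<-cmp i j
    ... | tri< i<j _ _ = apart i j i<j x p q
    ... | tri≈ _ i≡j _ = i≢j i≡j
    ... | tri> _ _ j<i = apart j i j<i x q p
  disjPart : ∀ i a b → a ≢ b → Disjoint (P i a) (P i b)
  disjPart i a b a≢b x x∈ = ≢true⇒≡false cmp
    where
    cmp : x ∈ₛ P i b → ⊥
    cmp x∈' with Fin-<-cmp a b
    ... | tri< a<b _ _ = edge⇒≢ T (χ.complete i a b a<b x x (P⊆ i a x x∈) (P⊆ i b x x∈')) refl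
    ... | tri≈ _ a≡b _ = a≢b a≡b
    ... | tri> _ _ b<a = edge⇒≢ T (χ.complete i b a b<a x x (P⊆ i b x x∈') (P⊆ i a x x∈)) refl
  scale : ∀ {N} i a → N ≤ C * count (χ.part i a) → N ≤ suc C' * count (P i a)
  scale {N} i a h = begin
    N ≤⟨ h ⟩
    C * count (χ.part i a) ≤⟨ *-monoʳ-≤ C (half i a) ⟩
    C * (2 * count (P i a)) ≡⟨ regroup C (count (P i a)) ⟩
    2 * C * count (P i a) ≤⟨ *-monoˡ-≤ (count (P i a)) C≤ ⟩
    suc C' * count (P i a) ∎
    where
    regroup : ∀ C p → C * (2 * p) ≡ 2 * C * p
    regroup = solve-∀
  dense : ∀ i j → i Fin.< j → suc L' * eXY T (⋃ₛ (P j)) (⋃ₛ (P i)) ≤ count (⋃ₛ (P i)) * count (⋃ₛ (P j))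
  dense i j i<j = begin
    suc L' * eXY T (⋃ₛ (P j)) (⋃ₛ (P i)) ≡⟨ cong (suc L' *_) (eXY≡edges T (⋃ₛ (P j)) (⋃ₛ (P i))) ⟩
    suc L' * edges (adj T) (⋃ₛ (P j)) (⋃ₛ (P i)) ≤⟨ edges≤ (adj T) (⋃ₛ (P j)) (⋃ₛ (P i)) (suc L') (count (⋃ₛ (P i))) row ⟩
    count (⋃ₛ (P j)) * count (⋃ₛ (P i)) ≡⟨ *-comm (count (⋃ₛ (P j))) _ ⟩
    count (⋃ₛ (P i)) * count (⋃ₛ (P j)) ∎
    where
    row : ∀ y → y ∈ₛ ⋃ₛ (P j) → suc L' * count (λ x → ⋃ₛ (P i) x ∧ adj T y x) ≤ count (⋃ₛ (P i))
    row y y∈ with ⋃-elim (P j) y y∈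
    ... | b , y∈b = begin
      suc L' * count (λ x → ⋃ₛ (P i) x ∧ adj T y x) ≤⟨ *-monoʳ-≤ (suc L') (count-mono {X = λ x → ⋃ₛ (P i) x ∧ adj T y x} {⋃ₛ Q} distribute) ⟩
      suc L' * count (⋃ₛ Q) ≤⟨ *-monoʳ-≤ (suc L') (count-⋃≤ Q) ⟩
      suc L' * sum (count ∘ Q) ≡⟨ *-distribˡ-sum (suc L') (count ∘ Q) ⟩
      sum (λ a → suc L' * count (Q a)) ≤⟨ sum-mono each ⟩
      sum (count ∘ P i) ≡⟨ count-⋃ (P i) (disjPart i) ⟨
      count (⋃ₛ (P i)) ∎
      where
      Q : Fin (lookup (partsOf v η) i) → VSet (size T)
      Q a x = P i a x ∧ adj T y x
      distribute : (λ x → ⋃ₛ (P i) x ∧ adj T y x) ⊆ₛ ⋃ₛ Q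
      distribute x x∈ with ∧-elim {⋃ₛ (P i) x} x∈
      ... | p , yx = let a , h = ⋃-elim (P i) x p in ⋃-intro Q a x (∧-intro h yx)
      regroup : ∀ L c → 2 * (L * c) ≡ 2 * L * c
      regroup = solve-∀
      each : ∀ a → suc L' * count (Q a) ≤ count (P i a)
      each a = *-cancelˡ-≤ 2 (begin
        2 * (suc L' * count (Q a)) ≡⟨ regroup (suc L') (count (Q a)) ⟩
        2 * suc L' * count (Q a) ≤⟨ *-monoˡ-≤ (count (Q a)) L≤ ⟩
        L * count (Q a) ≤⟨ *-monoʳ-≤ L (count-mono {X = Q a} {λ x → χ.part i a x ∧ adj T y x} λ x x∈ →
            let p , q = ∧-elim {P i a x} x∈ in ∧-intro (P⊆ i a x p) q) ⟩
        L * count (λ x → χ.part i a x ∧ adj T y x) ≤⟨ χ.light i j i<j a b y (P⊆ j b y y∈b) ⟩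
        count (χ.part i a) ≤⟨ half i a ⟩
        2 * count (P i a) ∎)

-- Positions in the long representation

Position : Vec ℕ m → Set
Position {m} ls = Σ (Fin m) λ i → Fin (lookup ls i)

locate : (ls : Vec ℕ m) → Fin (sumV ls) → Position ls
locate (l ∷ ls) j with splitAt l j
... | inj₁ a  = Fin.zero , a
... | inj₂ j' = Fin.suc (proj₁ (locate ls j')) , proj₂ (locate ls j')

flatten-locate : ∀ {A : Set} (ls : Vec ℕ m) (f : (i : Fin m) → Fin (lookup ls i) → A) → ∀ j →
  flatten ls f j ≡ f (proj₁ (locate ls j)) (proj₂ (locate ls j))
flatten-locate (l ∷ ls) f j with splitAt l j
... | inj₁ a  = refl
... | inj₂ j' = flatten-locate ls (f ∘ Fin.suc) j'

-- Lexicographic order, kept as two cases because forward edges have different causes: `within` one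
-- set they come from completeness, `between` sets from the deletion of backward edges.
data _≺_ {m} {ls : Vec ℕ m} : Position ls → Position ls → Set where
  between : ∀ {i j a b} → i Fin.< j → _≺_ {ls = ls} (i , a) (j , b)
  within  : ∀ {i a b} → a Fin.< b → _≺_ {ls = ls} (i , a) (i , b)

≺-suc : ∀ {l} {ls : Vec ℕ m} {p q : Position ls} → _≺_ {ls = ls} p q →
  _≺_ {ls = l ∷ ls} (Fin.suc (proj₁ p) , proj₂ p) (Fin.suc (proj₁ q) , proj₂ q)
≺-suc (between i<j) = between (s≤s i<j)
≺-suc (within a<b)  = within a<b

splitAt-inj₁-toℕ : ∀ l {k} (j : Fin (l + k)) {a} → splitAt l j ≡ inj₁ a → toℕ j ≡ toℕ a
splitAt-inj₁-toℕ l {k} j {a} eq = trans (sym (cong toℕ (splitAt⁻¹-↑ˡ {i = j} eq))) (toℕ-↑ˡ a k)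

splitAt-inj₂-toℕ : ∀ l {k} (j : Fin (l + k)) {a} → splitAt l j ≡ inj₂ a → toℕ j ≡ l + toℕ a
splitAt-inj₂-toℕ l {k} j {a} eq = trans (sym (cong toℕ (splitAt⁻¹-↑ʳ {i = j} eq))) (toℕ-↑ʳ l a)

locate-mono : (ls : Vec ℕ m) → ∀ j j' → j Fin.< j' → _≺_ {ls = ls} (locate ls j) (locate ls j')
locate-mono (l ∷ ls) j j' j<j' with splitAt l j in e | splitAt l j' in e'
... | inj₁ a | inj₂ b = between (s≤s z≤n)
... | inj₁ a | inj₁ b = within (subst₂ _<_ (splitAt-inj₁-toℕ l j e) (splitAt-inj₁-toℕ l j' e') j<j')
... | inj₂ a | inj₁ b = ⊥-elim (<⇒≱ j<j' (≤-trans (<⇒≤ (subst (_< l) (sym (splitAt-inj₁-toℕ l j' e')) (toℕ<n b)))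
      (≤-trans (m≤m+n l (toℕ a)) (≤-reflexive (sym (splitAt-inj₂-toℕ l j e))))))
... | inj₂ a | inj₂ b = ≺-suc (locate-mono ls a b (+-cancelˡ-< l _ _ (subst₂ _<_ (splitAt-inj₂-toℕ l j e) (splitAt-inj₂-toℕ l j' e') j<j')))

lookup≤sumV : (ls : Vec ℕ m) → ∀ i → lookup ls i ≤ sumV ls
lookup≤sumV (l ∷ ls) Fin.zero    = m≤m+n l _
lookup≤sumV (l ∷ ls) (Fin.suc i) = ≤-trans (lookup≤sumV ls i) (m≤n+m _ l)

-- Deleting vertices with backward edges

module _ {T : Tournament} {v : Vec Bool m} {ps : Vec ℕ m} {C L : ℕ} {A : VSet (size T)} (0<n : 0 < size T)
         (χ : PartSeq T v ps C L A) (L₁ : ℕ) (0<L₁ : 0 < L₁) (L₁≤ : L₁ * (2 * m * sumV ps) ≤ L) (L₁≤L : L₁ ≤ L) where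
  private
    module χ = PartSeq χ

    blamed : ∀ i → Fin (lookup ps i) → ∀ j → Fin (lookup ps j) → VSet (size T)
    blamed i a j b x = ⌊ i Fin.<? j ⌋ ∧ (χ.part i a x ∧ not ⌊ L₁ * count (λ y → χ.part j b y ∧ adj T y x) ≤? count (χ.part j b) ⌋)

    allBlamed : ∀ i → Fin (lookup ps i) → VSet (size T)
    allBlamed i a = ⋃ₛ λ j → ⋃ₛ (blamed i a j)

  -- In a `PartSeq` back edges are limited only at their later endpoint `y`. Discarding the vertices
  -- that receive too many of them from some later part limits them at the earlier endpoint too.
  smooth : ∀ i → Fin (lookup ps i) → VSet (size T)
  smooth i a = χ.part i a ∖ allBlamed i a

  smooth⊆ : ∀ i a → smooth i a ⊆ₛ χ.part i a
  smooth⊆ i a = ∖⊆ (χ.part i a) (allBlamed i a)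

  smooth-light : ∀ i a x → x ∈ₛ smooth i a → ∀ j → i Fin.< j → ∀ b →
    L₁ * count (λ y → χ.part j b y ∧ adj T y x) ≤ count (χ.part j b)
  smooth-light i a x x∈ j i<j b with ∧-elim {χ.part i a x} x∈
  ... | x∈' , nb with L₁ * count (λ y → χ.part j b y ∧ adj T y x) ≤? count (χ.part j b) in eq
  ... | yes p = p
  ... | no _ = ⊥-elim (true≢false
        (⋃-intro (λ j → ⋃ₛ (blamed i a j)) j x (⋃-intro (blamed i a j) b x
          (∧-intro (⌊⌋-complete (i Fin.<? j) i<j) (∧-intro x∈' (cong (not ∘ ⌊_⌋) eq)))))
        (not-elim nb))

  smooth-half : ∀ i a → count (χ.part i a) ≤ 2 * count (smooth i a)
  smooth-half i a = half-left (count (allBlamed i a)) (count (smooth i a)) (count-∖ (χ.part i a) (allBlamed i a) sub)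
    -- A vertex may be blamed through any of `m` sets and at most `sumV ps` parts of each; together
    -- these may take half of the part, whence the factor `2 * m * sumV ps` in `L₁≤`.
    (union-bound {M = 2} (λ j → ⋃ₛ (blamed i a j)) λ j → union-bound {M = 2 * m} (blamed i a j) λ b →
      ≤-trans (*-monoˡ-≤ _ (*-monoʳ-≤ (2 * m) (lookup≤sumV ps j))) (few j b))
    where
    sub : allBlamed i a ⊆ₛ χ.part i a
    sub x x∈ = let j , p = ⋃-elim (λ j → ⋃ₛ (blamed i a j)) x x∈ ; b , q = ⋃-elim (blamed i a j) x p in
      proj₁ (∧-elim {χ.part i a x} (proj₂ (∧-elim {⌊ i Fin.<? j ⌋} q)))
    few : ∀ j b → 2 * m * sumV ps * count (blamed i a j b) ≤ count (χ.part i a)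
    few j b with i Fin.<? j
    ... | yes i<j = few-popular-cancel (adj T) (χ.part j b) (χ.part i a) (2 * m * sumV ps) L₁ (part-nonempty χ 0<n j b) 0<L₁
          λ y y∈ → ≤-trans (*-monoˡ-≤ _ L₁≤) (χ.light i j i<j a b y y∈)
    ... | no _ = ≤-trans (≤-reflexive (trans (cong (2 * m * sumV ps *_) (count-∅ (size T))) (*-zeroʳ (2 * m * sumV ps)))) z≤n

  module _ {h : ℕ} (2h≤ : 2 * h ≤ L₁) (pos : Fin h → Position ps) (x : Fin h → Fin (size T))
           (x∈ : ∀ j → x j ∈ₛ smooth (proj₁ (pos j)) (proj₂ (pos j))) where
    private
      backward : ∀ i → Fin (lookup ps i) → Fin h → VSet (size T)
      backward i a j y = χ.part i a y ∧
        ((⌊ proj₁ (pos j) Fin.<? i ⌋ ∧ adj T y (x j)) ∨ (⌊ i Fin.<? proj₁ (pos j) ⌋ ∧ adj T (x j) y))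

    -- Each of the `h` vertices of the first copy removes at most a share 1/(2h) of a part. Vertices
    -- of the copy lying in the same S_i remove nothing.
    forward : ∀ i → Fin (lookup ps i) → VSet (size T)
    forward i a = χ.part i a ∖ ⋃ₛ (backward i a)

    forward⊆ : ∀ i a → forward i a ⊆ₛ χ.part i a
    forward⊆ i a = ∖⊆ (χ.part i a) (⋃ₛ (backward i a))

    forward-half : ∀ i a → count (χ.part i a) ≤ 2 * count (forward i a)
    forward-half i a = half-left (count (⋃ₛ (backward i a))) (count (forward i a))
      (count-∖ (χ.part i a) (⋃ₛ (backward i a)) λ y y∈ → let j , p = ⋃-elim (backward i a) y y∈ in proj₁ (∧-elim {χ.part i a y} p))
      (union-bound {M = 2} (backward i a) λ j → ≤-trans (*-monoˡ-≤ _ 2h≤) (few j))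
      where
      few : ∀ j → L₁ * count (backward i a j) ≤ count (χ.part i a)
      few j with pos j in pj | proj₁ (pos j) Fin.<? i | i Fin.<? proj₁ (pos j) | x∈ j
      ... | i' , a' | yes lt | yes gt | _ = ⊥-elim (<-asym lt gt)
      -- `x j` lies before this part: its smoothness applies.
      ... | i' , a' | yes lt | no _ | xj∈ = ≤-trans (*-monoʳ-≤ L₁ (count-mono
            {X = λ y → χ.part i a y ∧ (adj T y (x j) ∨ false)} {λ y → χ.part i a y ∧ adj T y (x j)} drop))
            (smooth-light i' a' (x j) xj∈ i lt a)
        where
        drop : (λ y → χ.part i a y ∧ (adj T y (x j) ∨ false)) ⊆ₛ (λ y → χ.part i a y ∧ adj T y (x j))
        drop y h with χ.part i a y | adj T y (x j)
        ... | true | true = refl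
      -- `x j` lies after this part: the `light` condition of the sequence applies.
      ... | i' , a' | no _ | yes gt | xj∈ = ≤-trans (*-monoˡ-≤ _ L₁≤L) (χ.light i i' gt a a' (x j) (smooth⊆ i' a' (x j) xj∈))
      ... | i' , a' | no _ | no _ | _ = ≤-trans (≤-reflexive (trans (cong (L₁ *_) (count-none λ y → none (χ.part i a y))) (*-zeroʳ L₁))) z≤n
        where
        none : ∀ b → b ∧ false ≡ false
        none true  = refl
        none false = refl

    forward-after : ∀ j {q} y → y ∈ₛ forward (proj₁ q) (proj₂ q) → _≺_ {ls = ps} (pos j) q → Edge T (x j) y
    forward-after j {i , a} y y∈ p≺ = go (pos j) refl p≺
      where
      y∈' : y ∈ₛ χ.part i a
      y∈' = forward⊆ i a y y∈
      go : ∀ p → pos j ≡ p → _≺_ {ls = ps} p (i , a) → Edge T (x j) y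
      go (i' , a') eq (between lt) with edge-total T {x j} {y} x≢y | x∈ j
        where
        x≢y : x j ≢ y
        x≢y e = true≢false y∈' (χ.disjoint i' i lt a' a y
          (subst (_∈ₛ χ.part i' a') e (smooth⊆ i' a' (x j) (subst (λ p → x j ∈ₛ smooth (proj₁ p) (proj₂ p)) eq (x∈ j)))))
      ... | inj₁ e | _ = e
      ... | inj₂ e | _ = ⊥-elim (true≢false (⋃-intro (backward i a) j y (∧-intro y∈' (∪-introˡ
            {X = λ y → ⌊ proj₁ (pos j) Fin.<? i ⌋ ∧ adj T y (x j)} {λ y → ⌊ i Fin.<? proj₁ (pos j) ⌋ ∧ adj T (x j) y} y
              (∧-intro (⌊⌋-complete (_ Fin.<? i) (subst (λ p → proj₁ p Fin.< i) (sym eq) lt)) e))))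
            (not-elim (proj₂ (∧-elim {χ.part i a y} y∈))))
      go (i , a') eq (within lt) = χ.complete i a' a lt (x j) y
        (smooth⊆ i a' (x j) (subst (λ p → x j ∈ₛ smooth (proj₁ p) (proj₂ p)) eq (x∈ j))) y∈'

    forward-before : ∀ j {q} y → y ∈ₛ forward (proj₁ q) (proj₂ q) → _≺_ {ls = ps} q (pos j) → Edge T y (x j)
    forward-before j {i , a} y y∈ ≺p = go (pos j) refl ≺p
      where
      y∈' : y ∈ₛ χ.part i a
      y∈' = forward⊆ i a y y∈
      go : ∀ p → pos j ≡ p → _≺_ {ls = ps} (i , a) p → Edge T y (x j)
      go (i' , a') eq (between lt) with edge-total T {y} {x j} y≢x
        where
        y≢x : y ≢ x j
        y≢x e = true≢false (smooth⊆ i' a' (x j) (subst (λ p → x j ∈ₛ smooth (proj₁ p) (proj₂ p)) eq (x∈ j)))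
          (χ.disjoint i i' lt a a' (x j) (subst (_∈ₛ χ.part i a) e y∈'))
      ... | inj₁ e = e
      ... | inj₂ e = ⊥-elim (true≢false (⋃-intro (backward i a) j y (∧-intro y∈' (∪-introʳ
            {X = λ y → ⌊ proj₁ (pos j) Fin.<? i ⌋ ∧ adj T y (x j)} {λ y → ⌊ i Fin.<? proj₁ (pos j) ⌋ ∧ adj T (x j) y} y
              (∧-intro (⌊⌋-complete (i Fin.<? _) (subst (λ p → i Fin.< proj₁ p) (sym eq) lt)) e))))
            (not-elim (proj₂ (∧-elim {χ.part i a y} y∈))))
      go (i , a') eq (within lt) = χ.complete i a a' lt y (x j) y∈'
        (smooth⊆ i a' (x j) (subst (λ p → x j ∈ₛ smooth (proj₁ p) (proj₂ p)) eq (x∈ j)))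

-- The strong EH-property with integer constants

BigPair : Tournament → ℕ → Set
BigPair T N = Σ (VSet (size T)) λ A → Σ (VSet (size T)) λ B →
  Disjoint A B × size T ≤ N * count A ×
  (size T ≤ N * count B ⊎ (EdgeTrans T B × (∀ S → EdgeTrans T S → count S ≤ N * count B))) ×
  (CompleteTo T A B ⊎ CompleteTo T B A)

-- A `BigPair` forgets that the pair lies in V(χ): the contradiction in a critical tournament
-- depends only on sizes and completeness. The bound is uniform in the tournament and the sequence.
StrongPair⇒BigPair : ∀ c → 0ℚ ℚ.< c → ∃ λ N → ∀ {T m} {v : Vec Bool m} {η : Vec ℕ (ζ v)} {c₁ λ'} (χ : MSeq T v η c₁ λ') →
  StrongPair χ c → BigPair T (suc N)
StrongPair⇒BigPair c 0<c = N , convert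
  where
  N = proj₁ (unscale c 0<c)
  un : ∀ a b → c ℚ.* ℕ→ℚ a ℚ.≤ ℕ→ℚ b → a ≤ suc N * b
  un a b = proj₂ (unscale c 0<c) {a} {b}
  convert : ∀ {T m} {v : Vec Bool m} {η : Vec ℕ (ζ v)} {c₁ λ'} (χ : MSeq T v η c₁ λ') → StrongPair χ c → BigPair T (suc N)
  convert {T} χ (A , B , A#B , _ , _ , bigA , bigB , dense) = A , B , A#B , un (size T) (count A) bigA , bigB' bigB , dense' dense
    where
    bigB' : AtLeastTimesSize T c B ⊎ (Transitive T B × AtLeastTimesTr T c B) →
      size T ≤ suc N * count B ⊎ (EdgeTrans T B × (∀ S → EdgeTrans T S → count S ≤ suc N * count B))
    bigB' (inj₁ h) = inj₁ (un (size T) (count B) h)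
    bigB' (inj₂ (t , h)) = inj₂ (Transitive⇒EdgeTrans T t , λ S tS → un (count S) (count B) (h S (EdgeTrans⇒Transitive T tS)))
    dense' : DensityOne T A B ⊎ DensityOne T B A → CompleteTo T A B ⊎ CompleteTo T B A
    dense' (inj₁ h) = inj₁ (DensityOne⇒CompleteTo T A#B h)
    dense' (inj₂ h) = inj₂ (DensityOne⇒CompleteTo T (Disjoint-sym {X = A} {B} A#B) h)

-- Here C and L stand for c₁ = 1/(C + 1) and λ = 1/(L + 1), and N for c₂ = 1/N.
IntegralEH : ∀ {t m} (v : Vec Bool m) (η : Vec ℕ (ζ v)) (H : Fin t → Tournament)
  (F : (i : Fin t) → Fin (size (H i)) → Fin (kOf v η)) → ℕ → ℕ → ℕ → Set
IntegralEH {t} v η H F C L N = ∀ T (χ : MSeq T v η (unit C) (unit L)) →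
  (Σ (Fin t) λ i → Σ (Fin (size (H i)) → Fin (size T)) λ x →
             (∀ j → x j ∈ₛ long χ (F i j)) × IsoOnto (raw (H i)) T x)
  ⊎ BigPair T N

StrongEH⇒IntegralEH : ∀ {t m} (v : Vec Bool m) (η : Vec ℕ (ζ v)) (H : Fin t → Tournament)
  (F : (i : Fin t) → Fin (size (H i)) → Fin (kOf v η)) → StrongEH v η H F →
  ∀ C → ∃ λ L → ∃ λ N → IntegralEH v η H F C L (suc N)
StrongEH⇒IntegralEH {t} v η H F strong C = L , N , λ T χ →
  Sum.map₂ (toBig χ) (property T (unit L) (0≤unit L) (unit≤λ₀ (n≤1+n _)) (unit<1 _) χ)
  where
  constants = strong (unit C) (0<unit C)
  λ₀ c₂ : ℚ
  λ₀ = proj₁ constants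
  c₂ = proj₁ (proj₂ constants)
  0<λ₀ : 0ℚ ℚ.< λ₀
  0<λ₀ = proj₁ (proj₂ (proj₂ constants))
  0<c₂ : 0ℚ ℚ.< c₂
  0<c₂ = proj₁ (proj₂ (proj₂ (proj₂ constants)))
  property = proj₂ (proj₂ (proj₂ (proj₂ constants)))
  L N : ℕ
  -- The `suc` makes the density parameter 1/(L+1) strictly smaller than 1.
  L = suc (proj₁ (archimedean λ₀ 0<λ₀))
  N = proj₁ (StrongPair⇒BigPair c₂ 0<c₂)
  unit≤λ₀ = proj₂ (archimedean λ₀ 0<λ₀)
  toBig : ∀ {T} (χ : MSeq T v η (unit C) (unit L)) → StrongPair χ c₂ → BigPair T (suc N)
  toBig χ = proj₂ (StrongPair⇒BigPair c₂ 0<c₂) χ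

-- Copies of the product

ltB-true : ∀ {k} {a b : Fin k} → a Fin.< b → ltB a b ≡ true
ltB-true {a = a} {b} a<b = Equivalence.to T-≡ (<⇒<ᵇ a<b)

ltB-false : ∀ {k} {a b : Fin k} → b Fin.< a → ltB a b ≡ false
ltB-false {a = a} {b} b<a = ≢true⇒≡false λ e → <-asym b<a (<ᵇ⇒< (toℕ a) (toℕ b) (Equivalence.from T-≡ e))

prod-contained : ∀ {k} (T H₁ H₂ : Tournament) (f : Fin (size H₁) → Fin k) (g : Fin (size H₂) → Fin k) →
  (x : Fin (size H₁) → Fin (size T)) → IsoOnto (raw H₁) T x → (y : Fin (size H₂) → Fin (size T)) → IsoOnto (raw H₂) T y →
  (∀ a b → adj T (x a) (y b) ≡ ltB (f a) (g b)) → (∀ a b → adj T (y b) (x a) ≡ ltB (g b) (f a)) → Compatible f g →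
  Contains T (prod H₁ H₂ f g)
prod-contained T H₁ H₂ f g x (injx , isox) y (injy , isoy) xy yx compat = z , inj , iso
  where
  z : Fin (size H₁ + size H₂) → Fin (size T)
  z = [ x , y ]′ ∘ splitAt (size H₁)
  -- Compatibility makes the two values differ, so an edge joins the two images and they are
  -- distinct.
  x≢y : ∀ a b → x a ≢ y b
  x≢y a b eq with Fin-<-cmp (f a) (g b)
  ... | tri< lt _ _ = edge⇒≢ T (trans (xy a b) (ltB-true lt)) eq
  ... | tri≈ _ e _ = compat a b e
  ... | tri> _ _ gt = edge⇒≢ T (trans (yx a b) (ltB-true gt)) (sym eq)
  inj : Injective _≡_ _≡_ z
  inj {a} {b} eq with splitAt (size H₁) a in ea | splitAt (size H₁) b in eb
  ... | inj₁ a' | inj₁ b' = trans (sym (splitAt⁻¹-↑ˡ {i = a} ea)) (trans (cong (_↑ˡ size H₂) (injx eq)) (splitAt⁻¹-↑ˡ {i = b} eb))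
  ... | inj₁ a' | inj₂ b' = ⊥-elim (x≢y a' b' eq)
  ... | inj₂ a' | inj₁ b' = ⊥-elim (x≢y b' a' (sym eq))
  ... | inj₂ a' | inj₂ b' = trans (sym (splitAt⁻¹-↑ʳ {i = a} ea)) (trans (cong (size H₁ ↑ʳ_) (injy eq)) (splitAt⁻¹-↑ʳ {i = b} eb))
  iso : ∀ a b → adj T (z a) (z b) ≡ radj (prod H₁ H₂ f g) a b
  iso a b with splitAt (size H₁) a | splitAt (size H₁) b
  ... | inj₁ a' | inj₁ b' = isox a' b'
  ... | inj₁ a' | inj₂ b' = xy a' b'
  ... | inj₂ a' | inj₁ b' = yx b' a'
  ... | inj₂ a' | inj₂ b' = isoy a' b'

-- First a copy of some H₁ᵢ among the smooth vertices, then a copy of some H₂ⱼ among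
-- the vertices joined to it by forward edges only.
product-or-pair′ : ∀ {r s m} {v : Vec Bool m} {η : Vec ℕ (ζ v)} → Valid v (partsOf v η) →
  (H₁ : Fin r → Tournament) (F : (i : Fin r) → Fin (size (H₁ i)) → Fin (kOf v η))
  (H₂ : Fin s → Tournament) (G : (j : Fin s) → Fin (size (H₂ j)) → Fin (kOf v η)) →
  (∀ i → Injective _≡_ _≡_ (F i)) → (∀ i j → Compatible (F i) (G j)) →
  ∀ {C C' L₁ L₂ N₁ N₂} → 2 * C ≤ suc C' → IntegralEH v η H₁ F C' L₁ N₁ → IntegralEH v η H₂ G C' L₂ N₂ →
  ∀ {T A L} → 0 < size T → ∀ M → 0 < M → M * (2 * m * kOf v η) ≤ L → M ≤ L → 2 * kOf v η ≤ M → 2 * suc L₁ ≤ L → 2 * suc L₂ ≤ L → PartSeq T v (partsOf v η) C L A →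
  (∃ λ i → ∃ λ j → Contains T (prod (H₁ i) (H₂ j) (F i) (G j))) ⊎ BigPair T N₁ ⊎ BigPair T N₂
product-or-pair′ {m = m} {v} {η} valid H₁ F H₂ G injF compat {C} {C'} {L₁} {L₂} {N₁} {N₂} C≤ EH₁ EH₂ {T} {A} {L} 0<n M 0<M M≤ M≤L 2k≤M L₁≤ L₂≤ χ
  with EH₁ T (toMSeq valid χ (smooth 0<n χ M 0<M M≤ M≤L) (smooth⊆ 0<n χ M 0<M M≤ M≤L) (smooth-half 0<n χ M 0<M M≤ M≤L)
    C' L₁ C≤ L₁≤)
... | inj₂ pair = inj₂ (inj₁ pair)
... | inj₁ (i , x , x∈ , isox) = second (EH₂ T χ₂)
  where
  ps = partsOf v η
  pos : Fin (size (H₁ i)) → Position ps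
  pos a = locate ps (F i a)
  -- Injectivity of `F i` bounds the size of every member by k, so one `M` serves whichever member
  -- is found.
  2h≤ : 2 * size (H₁ i) ≤ M
  2h≤ = ≤-trans (*-monoʳ-≤ 2 (injective⇒≤ (injF i))) 2k≤M
  x∈' : ∀ a → x a ∈ₛ smooth 0<n χ M 0<M M≤ M≤L (proj₁ (pos a)) (proj₂ (pos a))
  x∈' a = subst (x a ∈ₛ_) (flatten-locate ps (smooth 0<n χ M 0<M M≤ M≤L) (F i a)) (x∈ a)
  fwd : ∀ i → Fin (lookup ps i) → VSet (size T)
  fwd = forward 0<n χ M 0<M M≤ M≤L 2h≤ pos x x∈'
  χ₂ : MSeq T v η (unit C') (unit L₂)
  χ₂ = toMSeq valid χ fwd (forward⊆ 0<n χ M 0<M M≤ M≤L 2h≤ pos x x∈') (forward-half 0<n χ M 0<M M≤ M≤L 2h≤ pos x x∈')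
    C' L₂ C≤ L₂≤
  second : (Σ _ λ j → Σ (Fin (size (H₂ j)) → Fin (size T)) λ y → (∀ b → y b ∈ₛ long χ₂ (G j b)) × IsoOnto (raw (H₂ j)) T y) ⊎ BigPair T N₂ →
    (∃ λ i → ∃ λ j → Contains T (prod (H₁ i) (H₂ j) (F i) (G j))) ⊎ BigPair T N₁ ⊎ BigPair T N₂
  second (inj₂ pair) = inj₂ (inj₂ pair)
  second (inj₁ (j , y , y∈ , isoy)) = inj₁ (i , j , prod-contained T (H₁ i) (H₂ j) (F i) (G j) x isox y isoy
        (λ a b → proj₁ (cross a b)) (λ a b → proj₂ (cross a b)) (compat i j))
    where
    y∈' : ∀ b → y b ∈ₛ fwd (proj₁ (locate ps (G j b))) (proj₂ (locate ps (G j b)))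
    y∈' b = subst (y b ∈ₛ_) (flatten-locate ps fwd (G j b)) (y∈ b)
    one-way : ∀ {u w} → Edge T u w → adj T w u ≡ false
    one-way e = ≢true⇒≡false (edge-asym T e)
    cross : ∀ a b → adj T (x a) (y b) ≡ ltB (F i a) (G j b) × adj T (y b) (x a) ≡ ltB (G j b) (F i a)
    cross a b with Fin-<-cmp (F i a) (G j b)
    ... | tri≈ _ e _ = ⊥-elim (compat i j a b e)
    ... | tri< lt _ _ = trans e (sym (ltB-true lt)) , trans (one-way e) (sym (ltB-false lt))
      where e = forward-after 0<n χ M 0<M M≤ M≤L 2h≤ pos x x∈' a (y b) (y∈' b) (locate-mono ps (F i a) (G j b) lt)
    ... | tri> _ _ gt = trans (one-way e) (sym (ltB-false gt)) , trans e (sym (ltB-true gt))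
      where e = forward-before 0<n χ M 0<M M≤ M≤L 2h≤ pos x x∈' a (y b) (y∈' b) (locate-mono ps (G j b) (F i a) gt)

-- A sum with one summand per demand: the densities required by the two families, doubled because
-- parts are halved, and the product that lets `smooth` work with parameter `2 * k + 1`.
seqDensity : ℕ → ℕ → ℕ → ℕ → ℕ
seqDensity m k L₁ L₂ = 2 * suc L₁ + 2 * suc L₂ + (2 * k + 1) * (2 * m * k + 1)

product-or-pair : ∀ {r s m} {v : Vec Bool m} {η : Vec ℕ (ζ v)} → Valid v (partsOf v η) →
  (H₁ : Fin r → Tournament) (F : (i : Fin r) → Fin (size (H₁ i)) → Fin (kOf v η))
  (H₂ : Fin s → Tournament) (G : (j : Fin s) → Fin (size (H₂ j)) → Fin (kOf v η)) →
  (∀ i → Injective _≡_ _≡_ (F i)) → (∀ i j → Compatible (F i) (G j)) →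
  ∀ {C C' L₁ L₂ N₁ N₂} → 2 * C ≤ suc C' → IntegralEH v η H₁ F C' L₁ N₁ → IntegralEH v η H₂ G C' L₂ N₂ →
  ∀ {T A L} → 0 < size T → seqDensity m (kOf v η) L₁ L₂ ≤ L → PartSeq T v (partsOf v η) C L A →
  (∃ λ i → ∃ λ j → Contains T (prod (H₁ i) (H₂ j) (F i) (G j))) ⊎ BigPair T N₁ ⊎ BigPair T N₂
product-or-pair {m = m} {v} {η} valid H₁ F H₂ G injF compat {C} {C'} {L₁} {L₂} {N₁} {N₂} C≤ EH₁ EH₂ {L = L} 0<n L≥ χ =
  product-or-pair′ valid H₁ F H₂ G injF compat {C} {C'} {L₁} {L₂} {N₁} {N₂} C≤ EH₁ EH₂ 0<n M (m≤n+m 1 (2 * K))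
    (≤-trans (*-monoʳ-≤ M (m≤m+n (2 * m * K) 1)) last≤)
    (≤-trans (≤-reflexive (sym (*-identityʳ M))) (≤-trans (*-monoʳ-≤ M (m≤n+m 1 (2 * m * K))) last≤))
    (m≤m+n (2 * K) 1)
    (≤-trans (m≤m+n (2 * suc L₁) (2 * suc L₂)) base≤) (≤-trans (m≤n+m (2 * suc L₂) (2 * suc L₁)) base≤) χ
  where
  K M : ℕ
  K = kOf v η
  M = 2 * K + 1
  last≤ : M * (2 * m * K + 1) ≤ L
  last≤ = ≤-trans (m≤n+m _ (2 * suc L₁ + 2 * suc L₂)) L≥
  base≤ : 2 * suc L₁ + 2 * suc L₂ ≤ L
  base≤ = ≤-trans (m≤m+n _ (M * (2 * m * K + 1))) L≥

-- Strong pairs contradict criticality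

bernoulli : ∀ M q → M ^ q * (M + q) ≤ suc M ^ q * M
bernoulli M zero    = ≤-reflexive (cong (_+ 0) (+-identityʳ M))
bernoulli M (suc q) = begin
  M * M ^ q * (M + suc q) ≤⟨ m≤m+n _ (M ^ q * q) ⟩
  M * M ^ q * (M + suc q) + M ^ q * q ≡⟨ regroup₁ M (M ^ q) q ⟩
  suc M * (M ^ q * (M + q)) ≤⟨ *-monoʳ-≤ (suc M) (bernoulli M q) ⟩
  suc M * (suc M ^ q * M) ≡⟨ *-assoc (suc M) (suc M ^ q) M ⟨
  suc M * suc M ^ q * M ∎
  where
  open ≤-Reasoning
  regroup₁ : ∀ M p q → M * p * (M + (1 + q)) + p * q ≡ (1 + M) * (p * (M + q))
  regroup₁ = solve-∀

-- That is, (1 - 1/(M+1))^q ≤ 1/a. It serves twice: for enlarging a transitive set in a critical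
-- tournament, and for the probability that a colour is missed.
power-gap : ∀ M q a → 0 < M → a * M ≤ M + q → a * M ^ q ≤ suc M ^ q
power-gap M q a 0<M h = *-cancelʳ-≤ _ _ M ⦃ >-nonZero 0<M ⦄ (begin
  a * M ^ q * M ≡⟨ regroup a (M ^ q) M ⟩
  M ^ q * (a * M) ≤⟨ *-monoʳ-≤ (M ^ q) h ⟩
  M ^ q * (M + q) ≤⟨ bernoulli M q ⟩
  suc M ^ q * M ∎)
  where
  open ≤-Reasoning
  regroup : ∀ a p M → a * p * M ≡ p * (a * M)
  regroup = solve-∀

n≤2^n : ∀ n → n ≤ 2 ^ n
n≤2^n zero    = z≤n
n≤2^n (suc n) = ≤-trans (+-mono-≤ (m^n>0 2 n) (n≤2^n n)) (≤-reflexive (cong (2 ^ n +_) (sym (+-identityʳ _))))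

^-cancel-< : ∀ q {a b} → a ^ q < b ^ q → a < b
^-cancel-< q h = ≰⇒> λ b≤a → <⇒≱ h (^-monoˡ-≤ q b≤a)

m≤m^1+n : ∀ m n → m ≤ m ^ suc n
m≤m^1+n zero    n = z≤n
m≤m^1+n (suc m) n = m≤m*n (suc m) (suc m ^ n) ⦃ >-nonZero (m^n>0 (suc m) n) ⦄

^-*-distrib : ∀ a b q → (a * b) ^ q ≡ a ^ q * b ^ q
^-*-distrib a b zero    = refl
^-*-distrib a b (suc q) = trans (cong (a * b *_) (^-*-distrib a b q)) (regroup a b (a ^ q) (b ^ q))
  where
  regroup : ∀ a b p r → a * b * (p * r) ≡ a * p * (b * r)
  regroup = solve-∀

BigPair-weaken : ∀ T {N N'} → N ≤ N' → BigPair T N → BigPair T N'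
BigPair-weaken T N≤ (A , B , d , bigA , bigB , c) = A , B , d , ≤-trans bigA (*-monoˡ-≤ _ N≤) ,
  Sum.map (λ h → ≤-trans h (*-monoˡ-≤ _ N≤)) (λ (t , h) → t , λ S tS → ≤-trans (h S tS) (*-monoˡ-≤ _ N≤)) bigB , c

-- If both A and B are large, the union of transitive subsets of A and B is too large because
-- 2^q ≥ N; if B is transitive, adding a transitive subset of A to it contradicts the bound on
-- transitive sets because (1 - 1/N)^q ≤ 1/N.
no-BigPair : ∀ T M q → 0 < M → M * M ≤ q → suc M ≤ 2 ^ q → 0 < size T →
  (∀ S → EdgeTrans T S → count S ^ q < size T) →
  (∀ X → count X < size T → ∃ λ S → S ⊆ₛ X × EdgeTrans T S × count X ≤ count S ^ q) →
  BigPair T (suc M) → ⊥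
no-BigPair T M q 0<M MM≤q N≤2^q 0<n small sub (A , B , A#B , bigA , bigB , complete) = contradict bigB
  where
  open ≤-Reasoning
  N = suc M
  0<A : 0 < count A
  0<A = factor>0 {b = N} 0<n bigA
  x₀ = Fin.fromℕ< 0<n
  0<B : 0 < count B
  0<B = [ factor>0 {b = N} 0<n , (λ (_ , h) → factor>0 {b = N} (s≤s z≤n) (≤-trans (≤-reflexive (sym (count-⁅⁆ x₀))) (h ⁅ x₀ ⁆ (EdgeTrans-⁅⁆ T x₀)))) ]′ bigB
  A+B≤n : count A + count B ≤ size T
  A+B≤n = ≤-trans (≤-reflexive (sym (count-∪ {X = A} {B} A#B))) (count-≤ (A ∪ B))
  A<n : count A < size T
  A<n = ≤-trans (m<m+n (count A) 0<B) A+B≤n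
  B<n : count B < size T
  B<n = ≤-trans (m<n+m (count B) 0<A) A+B≤n
  join : ∀ S S' → S ⊆ₛ A → S' ⊆ₛ B → EdgeTrans T S → EdgeTrans T S' → ∃ λ U → EdgeTrans T U × count U ≡ count S + count S'
  join S S' S⊆ S'⊆ tS tS' = joined complete
    where
    joined : CompleteTo T A B ⊎ CompleteTo T B A → ∃ λ U → EdgeTrans T U × count U ≡ count S + count S'
    joined (inj₁ c) = S ∪ S' , EdgeTrans-∪ T (λ x y x∈ y∈ → c x y (S⊆ x x∈) (S'⊆ y y∈)) tS tS' , count-∪ {X = S} {S'} (Disjoint-⊆ {X = A} {S} {B} {S'} S⊆ S'⊆ A#B)
    joined (inj₂ c) = S' ∪ S , EdgeTrans-∪ T (λ x y x∈ y∈ → c x y (S'⊆ x x∈) (S⊆ y y∈)) tS' tS ,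
        trans (count-∪ {X = S'} {S} (Disjoint-sym {X = S} {S'} (Disjoint-⊆ {X = A} {S} {B} {S'} S⊆ S'⊆ A#B))) (+-comm (count S') (count S))
  S = proj₁ (sub A A<n)
  S⊆ = proj₁ (proj₂ (sub A A<n))
  tS = proj₁ (proj₂ (proj₂ (sub A A<n)))
  n≤NS : size T ≤ N * count S ^ q
  n≤NS = ≤-trans bigA (*-monoʳ-≤ N (proj₂ (proj₂ (proj₂ (sub A A<n)))))
  doubled : ∀ s s' U → EdgeTrans T U → count U ≡ s + s' → s ≤ s' → size T ≤ N * s ^ q → ⊥
  doubled s s' U tU cU s≤s' n≤ = <-irrefl refl (begin-strict
    count U ^ q <⟨ small U tU ⟩
    size T ≤⟨ n≤ ⟩
    N * s ^ q ≤⟨ *-monoˡ-≤ (s ^ q) N≤2^q ⟩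
    2 ^ q * s ^ q ≡⟨ ^-*-distrib 2 s q ⟨
    (2 * s) ^ q ≤⟨ ^-monoˡ-≤ q (≤-trans (+-monoʳ-≤ s (≤-trans (≤-reflexive (+-identityʳ s)) s≤s')) (≤-reflexive (sym cU))) ⟩
    count U ^ q ∎)
  contradict : size T ≤ N * count B ⊎ (EdgeTrans T B × (∀ S → EdgeTrans T S → count S ≤ N * count B)) → ⊥
  contradict (inj₁ bigB) with sub B B<n
  ... | S' , S'⊆ , tS' , B≤ with join S S' S⊆ S'⊆ tS tS' | ≤-total (count S) (count S')
  ...   | U , tU , cU | inj₁ s≤s' = doubled (count S) (count S') U tU cU s≤s' n≤NS
  ...   | U , tU , cU | inj₂ s'≤s = doubled (count S') (count S) U tU (trans cU (+-comm (count S) _)) s'≤s (≤-trans bigB (*-monoʳ-≤ N B≤))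
  contradict (inj₂ (tB , maxB)) with join S B S⊆ (λ _ h → h) tS tB
  ... | U , tU , cU = <-irrefl refl (begin-strict
    t ^ q <⟨ small U tU ⟩
    size T ≤⟨ n≤NS ⟩
    N * s ^ q ≤⟨ *-cancelˡ-≤ (N ^ q) ⦃ >-nonZero (m^n>0 N q) ⦄ (begin
      N ^ q * (N * s ^ q) ≡⟨ regroup (N ^ q) N (s ^ q) ⟩
      N * (N ^ q * s ^ q) ≡⟨ cong (N *_) (^-*-distrib N s q) ⟨
      N * (N * s) ^ q ≤⟨ *-monoʳ-≤ N (^-monoˡ-≤ q Ns≤Mt) ⟩
      N * (M * t) ^ q ≡⟨ cong (N *_) (^-*-distrib M t q) ⟩
      N * (M ^ q * t ^ q) ≡⟨ *-assoc N (M ^ q) (t ^ q) ⟨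
      -- `N * M` is `M + M * M`, so q ≥ M² is exactly what `power-gap` asks for.
      N * M ^ q * t ^ q ≤⟨ *-monoˡ-≤ (t ^ q) (power-gap M q N 0<M (+-monoʳ-≤ M MM≤q)) ⟩
      N ^ q * t ^ q ∎) ⟩
    t ^ q ∎)
    where
    s t : ℕ
    s = count S
    t = count U
    regroup : ∀ a b c → a * (b * c) ≡ b * (a * c)
    regroup = solve-∀
    -- The union is itself transitive, so `B` is at least a share 1/N of it, and at most a share M/N
    -- is left for `S`.
    Ns≤Mt : N * s ≤ M * t
    Ns≤Mt = +-cancelʳ-≤ t (N * s) (M * t) (begin
      N * s + t ≤⟨ +-monoʳ-≤ (N * s) (maxB U tU) ⟩
      N * s + N * count B ≡⟨ *-distribˡ-+ N s (count B) ⟨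
      N * (s + count B) ≡⟨ cong (N *_) cU ⟨
      t + M * t ≡⟨ +-comm t (M * t) ⟩
      M * t + t ∎)

-- From critical tournaments to the EH-property

ltB-anti : ∀ {k} (a b : Fin k) → a ≢ b → ltB a b ≡ not (ltB b a)
ltB-anti a b a≢b with Fin-<-cmp a b
... | tri< lt _ _ = trans (ltB-true lt) (cong not (sym (ltB-false lt)))
... | tri≈ _ e _ = ⊥-elim (a≢b e)
... | tri> _ _ gt = trans (ltB-false gt) (cong not (sym (ltB-true gt)))

-- The greedy embedding needs a genuine tournament as its pattern; the adjacency is literally that
-- of `prod`, so avoiding one is avoiding the other.
product : ∀ {k} (H₁ H₂ : Tournament) (f : Fin (size H₁) → Fin k) (g : Fin (size H₂) → Fin k) → Compatible f g → Tournament
product H₁ H₂ f g compat .size = size H₁ + size H₂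
product H₁ H₂ f g compat .adj = radj (prod H₁ H₂ f g)
product H₁ H₂ f g compat .irrefl x with splitAt (size H₁) x
... | inj₁ a = irrefl H₁ a
... | inj₂ b = irrefl H₂ b
product H₁ H₂ f g compat .tourn x y x≢y with splitAt (size H₁) x in ex | splitAt (size H₁) y in ey
... | inj₁ a | inj₁ b = tourn H₁ a b λ { refl → x≢y (trans (sym (splitAt⁻¹-↑ˡ {i = x} ex)) (splitAt⁻¹-↑ˡ {i = y} ey)) }
... | inj₁ a | inj₂ b = ltB-anti (f a) (g b) (compat a b)
... | inj₂ a | inj₁ b = ltB-anti (g a) (f b) (compat b a ∘ sym)
... | inj₂ a | inj₂ b = tourn H₂ a b λ { refl → x≢y (trans (sym (splitAt⁻¹-↑ʳ {i = x} ex)) (splitAt⁻¹-↑ʳ {i = y} ey)) }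

module _ {I : Set} (H : I → RawTournament) (q bound : ℕ) (2^bound≤ : 2 ^ bound ≤ 2 ^ q) (0<q : 0 < q)
  (critical : ∀ T → (∀ i → ¬ Contains T (H i)) → 0 < size T →
    (∀ S → EdgeTrans T S → count S ^ q < size T) →
    (∀ X → count X < size T → ∃ λ S → S ⊆ₛ X × EdgeTrans T S × count X ≤ count S ^ q) →
    (Smax : VSet (size T)) → EdgeTrans T Smax → bound ≤ count Smax → ⊥) where

  -- A smallest counterexample is critical: the search through all subsets finds no transitive set
  -- of the desired size, while the induction hypothesis supplies one in every proper induced
  -- subtournament.
  large-transitive : ∀ n T → size T ≤ n → (∀ i → ¬ Contains T (H i)) → ∃ λ S → EdgeTrans T S × size T ≤ count S ^ q
  large-transitive zero T h free = ∅ , (λ _ _ _ ()) , ≤-trans h z≤n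
  large-transitive (suc n) T h free
    with ∃-subset? {P = λ S → EdgeTrans T S × size T ≤ count S ^ q}
      (λ {X} {Y} eq (t , c) → EdgeTrans-⊆ T (λ x y∈ → trans (eq x) y∈) t , ≤-trans c (≤-reflexive (cong (_^ q) (count-cong eq))))
      (λ S → EdgeTrans? T S ×-dec (size T ≤? count S ^ q))
  ... | yes found = found
  ... | no none = ⊥-elim (2^bound-split (2 ^ bound ≤? size T))
    where
    small : ∀ S → EdgeTrans T S → count S ^ q < size T
    small S t = ≰⇒> λ le → none (S , t , le)
    0<n : 0 < size T
    0<n = ≤-trans (s≤s z≤n) (small ∅ λ _ _ _ ())
    sub : ∀ X → count X < size T → ∃ λ S → S ⊆ₛ X × EdgeTrans T S × count X ≤ count S ^ q
    sub X X< with large-transitive n (induced T X) (≤-pred (≤-trans X< h)) (λ i → free i ∘ Contains-induced T X)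
    ... | S , t , c = image (enum X) S
        , (λ x x∈ → let i , _ , e = image-elim (enum X) S x∈ in subst (_∈ₛ X) e (enum∈ X i))
        , EdgeTrans-image T (induced T X) (enum X) (λ _ _ → refl) t
        , ≤-trans c (≤-reflexive (cong (_^ q) (sym (count-image (enum X) (enum-injective X) S))))
    few : ∀ K → 2 ^ K ≤ size T → ∃ λ S → EdgeTrans T S × suc K ≤ count S
    few K h with transitive-log T K full (≤-trans h (≤-reflexive (sym (count-full (size T)))))
    ... | S , _ , t , c = S , t , c
    2^bound-split : Dec (2 ^ bound ≤ size T) → ⊥
    2^bound-split (yes big) with few bound big
    ... | S , t , c = critical T free 0<n small sub S t (<⇒≤ c)
    2^bound-split (no ¬big) with 2 ≤? size T
    ... | yes 2≤n with few 1 2≤n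
    -- Fewer than 2^bound vertices: a transitive pair already suffices, since 2^bound ≤ 2^q.
    ...   | S , t , 2≤S = <-asym (<-≤-trans (≰⇒> ¬big) (≤-trans 2^bound≤ (^-monoˡ-≤ q 2≤S))) (small S t)
    2^bound-split (no ¬big) | no n<2 with few 0 0<n
    ...   | S , t , 1≤S = <⇒≱ (small S t) (≤-trans (≤-pred (≰⇒> n<2)) (≤-trans (≤-reflexive (sym (^-zeroˡ q))) (^-monoˡ-≤ q 1≤S)))

  EH-from-critical : EHProperty H
  EH-from-critical = 1 , q , ≤-refl , 0<q , λ T free → let S , t , c = large-transitive (size T) T ≤-refl free in
    S , EdgeTrans⇒Transitive T t , ≤-trans (≤-reflexive (*-identityʳ (size T))) c

-- The two properties are invoked at `2 * C` because the parts of a sequence with constant `C` will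
-- be halved; `N₁` and `N₂` need a common bound only for the constants `C` that `partSeq` can
-- produce.
no-critical : ∀ {r s m : ℕ} {v : Vec Bool m} {η : Vec ℕ (ζ v)} → Valid v (partsOf v η) →
  (H₁ : Fin r → Tournament) (F : (i : Fin r) → Fin (size (H₁ i)) → Fin (kOf v η))
  (H₂ : Fin s → Tournament) (G : (j : Fin s) → Fin (size (H₂ j)) → Fin (kOf v η)) →
  (∀ i → Injective _≡_ _≡_ (F i)) → (∀ i j → Compatible (F i) (G j)) →
  (L₁ L₂ N₁ N₂ : ℕ → ℕ) → (∀ C → IntegralEH v η H₁ F (2 * C) (L₁ C) (N₁ C)) → (∀ C → IntegralEH v η H₂ G (2 * C) (L₂ C) (N₂ C)) →
  (Λ : ℕ → ℕ) → Monotone Λ → (∀ C → seqDensity m (kOf v η) (L₁ C) (L₂ C) ≤ Λ C) →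
  ∀ M q → 0 < M → M * M ≤ q → suc M ≤ 2 ^ q → 0 < q →
  ∀ T (H : Tournament) → ¬ Contains T (raw H) → (∀ i j → ¬ Contains T (prod (H₁ i) (H₂ j) (F i) (G j))) → 0 < size T →
  (∀ C → C ≤ seqBound (size H) (partsOf v η) Λ 1 → N₁ C ≤ suc M × N₂ C ≤ suc M) →
  (∀ S → EdgeTrans T S → count S ^ q < size T) →
  (∀ X → count X < size T → ∃ λ S → S ⊆ₛ X × EdgeTrans T S × count X ≤ count S ^ q) →
  (Smax : VSet (size T)) → EdgeTrans T Smax → seqBound (size H) (partsOf v η) Λ 1 ≤ count Smax → ⊥
no-critical {v = v} {η} valid H₁ F H₂ G injF compat L₁ L₂ N₁ N₂ EH₁ EH₂ Λ mono Λ≥ M q 0<M MM≤q M≤q 0<q T H freeH free 0<n N≤ small sub Smax tS bound≤ =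
  finish (partSeq T H freeH shrink 0<n Smax tS v (partsOf v η) valid Λ mono 1 (s≤s z≤n) bound≤ full
    (≤-reflexive (sym (trans (+-identityʳ _) (count-full (size T))))))
  where
  open ≤-Reasoning
  m≤m^q : ∀ a → a ≤ a ^ q
  m≤m^q a = subst (λ q → a ≤ a ^ q) (suc-pred q ⦃ >-nonZero 0<q ⦄) (m≤m^1+n a (pred q))
  shrink : Shrinking T
  shrink X X< C 1≤C n≤ with sub X X<
  ... | S , S⊆ , t , X≤ = S , S⊆ , t , λ S' t' → <⇒≤ (^-cancel-< q (begin-strict
    count S' ^ q <⟨ small S' t' ⟩
    size T ≤⟨ n≤ ⟩
    C * count X ≤⟨ *-mono-≤ (m≤m^q C) X≤ ⟩
    C ^ q * count S ^ q ≡⟨ ^-*-distrib C (count S) q ⟨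
    (C * count S) ^ q ∎))
  finish : (∃ λ C → C ≤ seqBound (size H) (partsOf v η) Λ 1 × PartSeq T v (partsOf v η) C (Λ C) full) → ⊥
  finish (C , C≤ , χ) with product-or-pair valid H₁ F H₂ G injF compat {C} {2 * C} {L₁ C} {L₂ C} {N₁ C} {N₂ C} (n≤1+n (2 * C))
    (EH₁ C) (EH₂ C) 0<n (Λ≥ C) χ
  ... | inj₁ (i , j , copy) = free i j copy
  ... | inj₂ (inj₁ pair) = no-BigPair T M q 0<M MM≤q M≤q 0<n small sub (BigPair-weaken T (proj₁ (N≤ C C≤)) pair)
  ... | inj₂ (inj₂ pair) = no-BigPair T M q 0<M MM≤q M≤q 0<n small sub (BigPair-weaken T (proj₂ (N≤ C C≤)) pair)

-- One summand per demand: `M * M` for enlarging a transitive set, `M` to push 2^q above M, and `b`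
-- for small tournaments.
exponent : ∀ M b → 0 < M → ∃ λ q → M * M ≤ q × suc M ≤ 2 ^ q × 2 ^ b ≤ 2 ^ q × 0 < q
exponent M b 0<M = M * M + M + b , ≤-trans (m≤m+n (M * M) M) (m≤m+n _ b) ,
  ≤-trans (s≤s (n≤2^n M)) (^-monoʳ-< 2 (s≤s (s≤s z≤n)) (≤-trans (+-monoˡ-≤ M (*-mono-≤ 0<M 0<M)) (m≤m+n (M * M + M) b))) ,
  ^-monoʳ-≤ 2 (m≤n+m b (M * M + M)) , ≤-trans 0<M (≤-trans (m≤n+m M (M * M)) (m≤m+n _ b))

nonempty-case : ∀ {m : ℕ} (v : Vec Bool m) (η : Vec ℕ (ζ v)) → All (1 ≤_) η →
    ∀ {r s : ℕ}
      (H₁ : Fin (suc r) → Tournament) (F : (i : Fin (suc r)) → Fin (size (H₁ i)) → Fin (kOf v η))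
      (H₂ : Fin (suc s) → Tournament) (G : (j : Fin (suc s)) → Fin (size (H₂ j)) → Fin (kOf v η)) →
    (∀ i → Injective _≡_ _≡_ (F i)) →
    StrongEH v η H₁ F → StrongEH v η H₂ G →
    (∀ i j → Compatible (F i) (G j)) →
    EHProperty (λ (p : Fin (suc r) × Fin (suc s)) → let (i , j) = p in prod (H₁ i) (H₂ j) (F i) (G j))
nonempty-case {m} v η η≥1 H₁ F H₂ G injF EH₁ EH₂ compat =
  let q , MM≤q , M≤q , b≤q , 0<q = exponent M bound 0<M in
  EH-from-critical _ q bound b≤q 0<q λ T free 0<n small sub Smax tS bound≤ →
    no-critical (partsOf-valid v η η≥1) H₁ F H₂ G injF compat L₁ L₂ N₁ N₂
      (λ C → proj₂ (proj₂ (integral₁ C))) (λ C → proj₂ (proj₂ (integral₂ C)))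
      Λ (maxUpTo-monotone Λ₀) (λ C → ≤maxUpTo Λ₀ {C} ≤-refl) M q 0<M MM≤q M≤q 0<q
      T H (free (Fin.zero , Fin.zero)) (λ i j → free (i , j)) 0<n
      (λ C C≤ → ≤-trans (≤-trans (m≤m+n (N₁ C) (N₂ C)) (≤maxUpTo N C≤)) (n≤1+n M) , ≤-trans (≤-trans (m≤n+m (N₂ C) (N₁ C)) (≤maxUpTo N C≤)) (n≤1+n M))
      small sub Smax tS bound≤
  where
  H = product (H₁ Fin.zero) (H₂ Fin.zero) (F Fin.zero) (G Fin.zero) (compat Fin.zero Fin.zero)
  integral₁ : ∀ C → ∃ λ L → ∃ λ N → IntegralEH v η H₁ F (2 * C) L (suc N)
  integral₁ C = StrongEH⇒IntegralEH v η H₁ F EH₁ (2 * C)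
  integral₂ : ∀ C → ∃ λ L → ∃ λ N → IntegralEH v η H₂ G (2 * C) L (suc N)
  integral₂ C = StrongEH⇒IntegralEH v η H₂ G EH₂ (2 * C)
  -- The order of choice avoids a circle: the families give densities and pair constants for every
  -- `C`, the densities give Λ and hence `bound`, and only then are the pair constants maximised
  -- over `C ≤ bound`. The running maximum makes Λ monotone.
  L₁ L₂ N₁ N₂ Λ₀ Λ N : ℕ → ℕ
  L₁ C = proj₁ (integral₁ C)
  L₂ C = proj₁ (integral₂ C)
  N₁ C = suc (proj₁ (proj₂ (integral₁ C)))
  N₂ C = suc (proj₁ (proj₂ (integral₂ C)))
  Λ₀ C = seqDensity m (kOf v η) (L₁ C) (L₂ C)
  Λ n = maxUpTo n Λ₀
  N C = N₁ C + N₂ C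
  bound M : ℕ
  bound = seqBound (size H) (partsOf v η) Λ 1
  M = maxUpTo bound N
  0<M : 0 < M
  0<M = ≤-trans (s≤s z≤n) (≤maxUpTo N (z≤n {bound}))

-- Polychromatic colourings

-- The number of colourings of `k` entries with `suc c` colours that avoid one given colour on all
-- of `R`; divided by `suc c ^ k`, the probability that `R` misses the colour.
weight : ℕ → VSet k → ℕ
weight {zero}  c R = 1
weight {suc k} c R = (if R Fin.zero then c else suc c) * weight c (R ∘ Fin.suc)

weight-count : ∀ c (R : VSet k) → weight c R * suc c ^ count R ≡ c ^ count R * suc c ^ k
weight-count {zero} c R = refl
weight-count {suc k} c R with R Fin.zero
... | true  = trans (regroup c (weight c (R ∘ Fin.suc)) (suc c) (suc c ^ count (R ∘ Fin.suc)))
        (trans (cong (c * suc c *_) (weight-count c (R ∘ Fin.suc))) (regroup' c (suc c) (c ^ count (R ∘ Fin.suc)) (suc c ^ k)))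
  where
  regroup : ∀ c w s p → c * w * (s * p) ≡ c * s * (w * p)
  regroup = solve-∀
  regroup' : ∀ c s p r → c * s * (p * r) ≡ c * p * (s * r)
  regroup' = solve-∀
... | false = trans (*-assoc (suc c) (weight c (R ∘ Fin.suc)) _)
        (trans (cong (suc c *_) (weight-count c (R ∘ Fin.suc))) (regroup (suc c) (c ^ count (R ∘ Fin.suc)) (suc c ^ k)))
  where
  regroup : ∀ s p r → s * (p * r) ≡ p * (s * r)
  regroup = solve-∀

weight-≤ : ∀ c (R : VSet k) ρ → ρ ≤ count R → weight c R * suc c ^ ρ ≤ c ^ ρ * suc c ^ k
weight-≤ {k} c R ρ ρ≤ = *-cancelʳ-≤ _ _ (suc c ^ d) ⦃ >-nonZero (m^n>0 (suc c) d) ⦄ (begin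
  weight c R * suc c ^ ρ * suc c ^ d ≡⟨ *-assoc (weight c R) _ _ ⟩
  weight c R * (suc c ^ ρ * suc c ^ d) ≡⟨ cong (weight c R *_) (trans (sym (^-distribˡ-+-* (suc c) ρ d)) (cong (suc c ^_) (m+[n∸m]≡n ρ≤))) ⟩
  weight c R * suc c ^ count R ≡⟨ weight-count c R ⟩
  c ^ count R * suc c ^ k ≡⟨ cong (_* suc c ^ k) (trans (cong (c ^_) (sym (m+[n∸m]≡n ρ≤))) (^-distribˡ-+-* c ρ d)) ⟩
  c ^ ρ * c ^ d * suc c ^ k ≤⟨ *-monoˡ-≤ (suc c ^ k) (*-monoʳ-≤ (c ^ ρ) (^-monoˡ-≤ d (n≤1+n c))) ⟩
  c ^ ρ * suc c ^ d * suc c ^ k ≡⟨ regroup (c ^ ρ) (suc c ^ d) (suc c ^ k) ⟩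
  c ^ ρ * suc c ^ k * suc c ^ d ∎)
  where
  open ≤-Reasoning
  d : ℕ
  d = count R ∸ ρ
  regroup : ∀ a b e → a * b * e ≡ a * e * b
  regroup = solve-∀

below-average : (f : Fin k → ℕ) → ∀ {N} → sum f < k * N → ∃ λ a → f a < N
below-average {k} f {N} h with any? (λ a → f a <? N)
... | yes found = found
... | no none = ⊥-elim (<⇒≱ h (≤-trans (≤-reflexive (sym (sum-const k N))) (sum-mono λ a → ≮⇒≥ λ lt → none (a , lt))))

-- Method of conditional expectations: the entries are coloured one after the other so
-- that the expected number of pairs (R j , colour j) left unmet stays below one.
colouring : ∀ k c (R : Fin l → VSet k) (colour : Fin l → Fin (suc c)) (alive : VSet l) →
  sum (λ j → ind (alive j) * weight c (R j)) < suc c ^ k →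
  ∃ λ (f : Fin k → Fin (suc c)) → ∀ j → j ∈ₛ alive → ∃ λ e → e ∈ₛ R j × f e ≡ colour j
-- With no entries left, the sum is the number of pairs still unmet, and it is below one.
colouring zero c R colour alive h = (λ ()) , λ j alive-j → ⊥-elim (<⇒≱ h (≤-trans (∃⇒count>0 {X = alive} j alive-j)
  (≤-reflexive (trans (count≡sum alive) (sum-cong-≗ λ j → sym (*-identityʳ (ind (alive j))))))))
colouring {l} (suc k) c R colour alive h with below-average φ (≤-<-trans total h)
  where
  open ≤-Reasoning
  still : Fin (suc c) → VSet l
  still a j = alive j ∧ not (R j Fin.zero ∧ ⌊ colour j Fin.≟ a ⌋)
  tailWeight : Fin l → ℕ
  tailWeight j = weight c (R j ∘ Fin.suc)
  φ : Fin (suc c) → ℕ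
  φ a = sum λ j → ind (still a j) * tailWeight j
  -- Summed over the colours of the first entry, the unmet cases give exactly the first factor of
  -- `weight`, so some colour does not raise the expectation.
  survivors : ∀ j → sum (λ a → ind (still a j)) ≡ ind (alive j) * (if R j Fin.zero then c else suc c)
  survivors j with alive j | R j Fin.zero
  ... | false | _ = trans (sum-const (suc c) 0) (*-zeroʳ c)
  ... | true | false = trans (sum-const (suc c) 1) (trans (*-identityʳ (suc c)) (sym (+-identityʳ (suc c))))
  ... | true | true = trans (sym (count≡sum (λ a → not ⌊ colour j Fin.≟ a ⌋)))
        (trans (suc-injective (trans (sym (count-remove {X = full} (colour j) refl)) (count-full (suc c)))) (sym (+-identityʳ c)))
  total : sum φ ≤ sum (λ j → ind (alive j) * weight c (R j))
  total = begin
    sum φ ≡⟨ ∑-comm (λ a j → ind (still a j) * tailWeight j) ⟩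
    sum (λ j → sum (λ a → ind (still a j) * tailWeight j)) ≡⟨ sum-cong-≗ (λ j → sym (*-distribʳ-sum (tailWeight j) (λ a → ind (still a j)))) ⟩
    sum (λ j → sum (λ a → ind (still a j)) * tailWeight j) ≡⟨ sum-cong-≗ (λ j → trans (cong (_* tailWeight j) (survivors j)) (*-assoc (ind (alive j)) _ (tailWeight j))) ⟩
    sum (λ j → ind (alive j) * weight c (R j)) ∎
... | a , φa< with colouring k c (λ j → R j ∘ Fin.suc) colour (λ j → alive j ∧ not (R j Fin.zero ∧ ⌊ colour j Fin.≟ a ⌋)) φa<
... | f , hits = g , met
  where
  g : Fin (suc k) → Fin (suc c)
  g Fin.zero    = a
  g (Fin.suc e) = f e
  met : ∀ j → j ∈ₛ alive → ∃ λ e → e ∈ₛ R j × g e ≡ colour j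
  met j alive-j with R j Fin.zero in Rj | colour j Fin.≟ a in eq
  ... | true  | yes p = Fin.zero , Rj , sym p
  ... | true  | no _ with e , e∈ , p ← hits j (∧-intro alive-j (cong₂ (λ b d → not (b ∧ ⌊ d ⌋)) Rj eq)) = Fin.suc e , e∈ , p
  ... | false | _    with e , e∈ , p ← hits j (∧-intro alive-j (cong (λ b → not (b ∧ _)) Rj)) = Fin.suc e , e∈ , p

polychromatic : ∀ k c (R : Fin l → VSet k) (colour : Fin l → Fin (suc c)) ρ → l * c ^ ρ < suc c ^ ρ →
  ∃ λ (f : Fin k → Fin (suc c)) → ∀ j → ρ ≤ count (R j) → ∃ λ e → e ∈ₛ R j × f e ≡ colour j
polychromatic {l} k c R colour ρ h with colouring k c R colour alive bound
  where
  open ≤-Reasoning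
  alive : VSet l
  alive j = ⌊ ρ ≤? count (R j) ⌋
  term : ∀ j → ind (alive j) * weight c (R j) * suc c ^ ρ ≤ c ^ ρ * suc c ^ k
  term j with ρ ≤? count (R j)
  ... | yes p = ≤-trans (≤-reflexive (cong (_* suc c ^ ρ) (+-identityʳ (weight c (R j))))) (weight-≤ c (R j) ρ p)
  ... | no _  = z≤n
  bound : sum (λ j → ind (alive j) * weight c (R j)) < suc c ^ k
  bound = *-cancelʳ-< (suc c ^ ρ) _ _ (begin-strict
    sum (λ j → ind (alive j) * weight c (R j)) * suc c ^ ρ ≡⟨ *-distribʳ-sum (suc c ^ ρ) (λ j → ind (alive j) * weight c (R j)) ⟩
    sum (λ j → ind (alive j) * weight c (R j) * suc c ^ ρ) ≤⟨ sum-mono term ⟩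
    sum {l} (λ _ → c ^ ρ * suc c ^ k) ≡⟨ sum-const l (c ^ ρ * suc c ^ k) ⟩
    l * (c ^ ρ * suc c ^ k) ≡⟨ *-assoc l (c ^ ρ) (suc c ^ k) ⟨
    l * c ^ ρ * suc c ^ k <⟨ *-monoˡ-< (suc c ^ k) ⦃ >-nonZero (m^n>0 (suc c) k) ⦄ h ⟩
    suc c ^ ρ * suc c ^ k ≡⟨ *-comm (suc c ^ ρ) (suc c ^ k) ⟩
    suc c ^ k * suc c ^ ρ ∎)
... | f , hits = f , λ j ρ≤ → hits j (⌊⌋-complete (ρ ≤? count (R j)) ρ≤)

count-++ : ∀ k (p : Fin (k + l) → Bool) → count p ≡ count (p ∘ (_↑ˡ l)) + count (p ∘ (k ↑ʳ_))
count-++ zero    p = refl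
count-++ (suc k) p = trans (cong (ind (p Fin.zero) +_) (count-++ k (p ∘ Fin.suc))) (sym (+-assoc (ind (p Fin.zero)) _ _))

count-combine : ∀ n {k} (p : Fin (n * k) → Bool) → count p ≡ sum (λ i → count (λ x → p (combine {n} {k} i x)))
count-combine zero    p = refl
count-combine (suc n) {k} p = trans (count-++ k p) (cong (count (λ x → p (x ↑ˡ (n * k))) +_) (count-combine n (λ e → p (k ↑ʳ e))))

pairs : (Fin n → Fin n → Bool) → VSet n → VSet n → VSet (n * n)
pairs {n} K A B e = let x , y = remQuot {n} n e in A x ∧ (B y ∧ K x y)

count-pairs : (K : Fin n → Fin n → Bool) (A B : VSet n) → count (pairs K A B) ≡ edges K A B
count-pairs {n} K A B = trans (count-combine n (pairs K A B)) (sum-cong-≗ row)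
  where
  row : ∀ x → count (λ y → pairs K A B (combine x y)) ≡ count (λ y → A x ∧ (B y ∧ K x y))
  row x = count-cong λ y → cong (λ p → A (proj₁ p) ∧ (B (proj₂ p) ∧ K (proj₁ p) (proj₂ p))) (remQuot-combine {n} x y)

anyPair : Fin n → Fin n → Bool
anyPair _ _ = true

increasing : Fin n → Fin n → Bool
increasing x y = ⌊ x Fin.<? y ⌋

edges-any : (A : VSet n) (B : VSet k) → edges (λ _ _ → true) A B ≡ count A * count B
edges-any A B = trans (sym (+-identityʳ _)) (trans (cong (edges (λ _ _ → true) A B +_) (sym none)) (edges-total (λ _ _ → true) A B))
  where
  none : edges (λ x y → not true) A B ≡ 0
  none = n≤0⇒n≡0 (≤-trans (≤-reflexive (sym (+-identityʳ _))) (≤-trans (edges≤ (λ _ _ → false) A B 1 0 (λ x _ →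
    ≤-reflexive (trans (+-identityʳ _) (count-none λ y → ∧-false (B y))))) (≤-reflexive (*-zeroʳ (count A)))))
    where
    ∧-false : ∀ b → b ∧ false ≡ false
    ∧-false true  = refl
    ∧-false false = refl

increasing-half : (A B : VSet n) → Disjoint A B → count A * count B ≤ edges increasing A B + edges increasing B A
increasing-half A B d = ≤-trans (≤-reflexive (sym (edges-total increasing A B))) (+-monoʳ-≤ (edges increasing A B)
  (≤-trans (edges-mono {R = λ x y → not (increasing x y)} {flip increasing} {A} {A} {B} {B} reverse) (≤-reflexive (sym (edges-swap increasing B A)))))
  where
  reverse : ∀ x y → x ∈ₛ A → y ∈ₛ B → not (increasing x y) ≡ true → x ∈ₛ A × y ∈ₛ B × increasing y x ≡ true
  reverse x y x∈ y∈ h with Fin-<-cmp x y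
  ... | tri< lt _ _ = ⊥-elim (true≢false (⌊⌋-complete (x Fin.<? y) lt) (not-elim h))
  ... | tri≈ _ refl _ = ⊥-elim (true≢false y∈ (d x x∈))
  ... | tri> _ _ gt = x∈ , y∈ , ⌊⌋-complete (y Fin.<? x) gt

-- Between different copies all ordered pairs of vertices matter, inside a copy only those with
-- `x Fin.< y`, whose colour decides the edge; hence two kinds of sets of pairs.
record Polychromatic (n c ρ : ℕ) : Set where
  field
    f : Fin n → Fin n → Fin (suc c)
    hits-any : ∀ A B → ρ ≤ edges anyPair A B → ∀ a → ∃ λ x → ∃ λ y → x ∈ₛ A × y ∈ₛ B × f x y ≡ a
    hits-increasing : ∀ A B → ρ ≤ edges increasing A B → ∀ a → ∃ λ x → ∃ λ y → x ∈ₛ A × y ∈ₛ B × x Fin.< y × f x y ≡ a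

-- The multiplier counts the demands: a colour, one of two kinds of pairs, and two subsets, each
-- coded in `Fin (2 ^ n)`.
polychromatic-pairs : ∀ n c ρ → (suc c * (2 * (2 ^ n * 2 ^ n))) * c ^ ρ < suc c ^ ρ → Polychromatic n c ρ
polychromatic-pairs n c ρ h = record
  { f = λ x y → f (combine x y)
  ; hits-any = λ A B big a → let x , y , x∈ , y∈ , _ , eq = hit Fin.zero A B big a in x , y , x∈ , y∈ , eq
  ; hits-increasing = λ A B big a → let x , y , x∈ , y∈ , lt , eq = hit (Fin.suc Fin.zero) A B big a in
      x , y , x∈ , y∈ , ⌊⌋-sound (x Fin.<? y) lt , eq }
  where
  L : ℕ
  L = suc c * (2 * (2 ^ n * 2 ^ n))
  kind : Fin 2 → Fin n → Fin n → Bool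
  kind Fin.zero    = anyPair
  kind (Fin.suc _) = increasing
  colourOf : Fin L → Fin (suc c)
  colourOf j = proj₁ (remQuot {suc c} (2 * (2 ^ n * 2 ^ n)) j)
  rest : Fin L → Fin 2 × Fin (2 ^ n * 2 ^ n)
  rest j = remQuot {2} (2 ^ n * 2 ^ n) (proj₂ (remQuot {suc c} (2 * (2 ^ n * 2 ^ n)) j))
  sets : Fin L → Fin (2 ^ n) × Fin (2 ^ n)
  sets j = remQuot {2 ^ n} (2 ^ n) (proj₂ (rest j))
  R : Fin L → VSet (n * n)
  R j = pairs (kind (proj₁ (rest j))) (subset (proj₁ (sets j))) (subset (proj₂ (sets j)))
  poly = polychromatic (n * n) c R colourOf ρ h
  f = proj₁ poly
  hit : ∀ κ A B → ρ ≤ edges (kind κ) A B → ∀ a → ∃ λ x → ∃ λ y → x ∈ₛ A × y ∈ₛ B × kind κ x y ≡ true × f (combine x y) ≡ a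
  hit κ A B big a = proj₁ (remQuot {n} n e) , proj₂ (remQuot {n} n e) , proj₁ split₁ , proj₁ split₂ , proj₂ split₂ ,
      trans (cong f (combine-remQuot {n} n e)) (trans (proj₂ (proj₂ found)) colour≡)
    where
    j : Fin L
    j = combine a (combine κ (combine (encode A) (encode B)))
    colour≡ : colourOf j ≡ a
    colour≡ = cong proj₁ (remQuot-combine {suc c} a (combine κ (combine (encode A) (encode B))))
    rest≡ : rest j ≡ (κ , combine (encode A) (encode B))
    rest≡ = trans (cong (λ p → remQuot {2} (2 ^ n * 2 ^ n) (proj₂ p)) (remQuot-combine {suc c} a (combine κ (combine (encode A) (encode B)))))
      (remQuot-combine {2} κ (combine (encode A) (encode B)))
    sets≡ : sets j ≡ (encode A , encode B)
    sets≡ = trans (cong (λ p → remQuot {2 ^ n} (2 ^ n) (proj₂ p)) rest≡) (remQuot-combine {2 ^ n} (encode A) (encode B))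
    R≡ : ∀ e → R j e ≡ pairs (kind κ) A B e
    R≡ e = trans (cong₂ (λ κ s → pairs (kind κ) (subset (proj₁ s)) (subset (proj₂ s)) e) (cong proj₁ rest≡) sets≡)
      (cong₂ (λ b d → b ∧ (d ∧ kind κ (proj₁ (remQuot {n} n e)) (proj₂ (remQuot {n} n e)))) (subset-encode A _) (subset-encode B _))
    found : ∃ λ e → e ∈ₛ R j × f e ≡ colourOf j
    found = proj₂ poly j (≤-trans big (≤-reflexive (trans (sym (count-pairs (kind κ) A B)) (sym (count-cong R≡)))))
    e : Fin (n * n)
    e = proj₁ found
    split₁ = ∧-elim {A (proj₁ (remQuot {n} n e))} (trans (sym (R≡ e)) (proj₁ (proj₂ found)))
    split₂ = ∧-elim {B (proj₂ (remQuot {n} n e))} (proj₂ split₁)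

-- With ρ = 16cn a demand fails with probability at most 16^(-n), and there are fewer than 8^n
-- demands because 2(c+1) < 2^n.
enough-colours : ∀ n c → 0 < c → c + 2 < n → (suc c * (2 * (2 ^ n * 2 ^ n))) * c ^ (16 * c * n) < suc c ^ (16 * c * n)
enough-colours n c 0<c c+2<n = begin-strict
  suc c * (2 * (p * p)) * c ^ ρ <⟨ *-monoˡ-< (c ^ ρ) ⦃ >-nonZero (m^n>0 c ⦃ >-nonZero 0<c ⦄ ρ) ⦄ few ⟩
  16 ^ n * c ^ ρ ≡⟨ cong (16 ^ n *_) (^-*-assoc c (16 * c) n) ⟨
  16 ^ n * (c ^ (16 * c)) ^ n ≡⟨ ^-*-distrib 16 (c ^ (16 * c)) n ⟨
  (16 * c ^ (16 * c)) ^ n ≤⟨ ^-monoˡ-≤ n (power-gap c (16 * c) 16 0<c (m≤n+m (16 * c) c)) ⟩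
  (suc c ^ (16 * c)) ^ n ≡⟨ ^-*-assoc (suc c) (16 * c) n ⟩
  suc c ^ ρ ∎
  where
  open ≤-Reasoning
  p ρ : ℕ
  p = 2 ^ n
  ρ = 16 * c * n
  instance
    p≢0 : NonZero p
    p≢0 = >-nonZero (m^n>0 2 n)
  regroup : ∀ c p → suc c * (2 * (p * p)) ≡ suc c * 2 * (p * p)
  regroup = solve-∀
  regroup' : ∀ p → p * (p * p) * p ≡ p * (p * (p * (p * 1)))
  regroup' = solve-∀
  2c<p : suc c * 2 < p
  2c<p = begin-strict
    suc c * 2 ≡⟨ *-comm (suc c) 2 ⟩
    2 * suc c ≤⟨ *-monoʳ-≤ 2 (n≤2^n (suc c)) ⟩
    2 ^ (2 + c) ≡⟨ cong (2 ^_) (+-comm 2 c) ⟩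
    2 ^ (c + 2) <⟨ ^-monoʳ-< 2 (s≤s (s≤s z≤n)) c+2<n ⟩
    p ∎
    where open ≤-Reasoning
  few : suc c * (2 * (p * p)) < 16 ^ n
  few = begin-strict
    suc c * (2 * (p * p)) ≡⟨ regroup c p ⟩
    suc c * 2 * (p * p) <⟨ *-monoˡ-< (p * p) ⦃ >-nonZero (*-mono-≤ (m^n>0 2 n) (m^n>0 2 n)) ⦄ 2c<p ⟩
    p * (p * p) ≤⟨ m≤m*n (p * (p * p)) p ⟩
    p * (p * p) * p ≡⟨ regroup' p ⟩
    p ^ 4 ≡⟨ trans (^-*-assoc 2 n 4) (trans (cong (2 ^_) (*-comm n 4)) (sym (^-*-assoc 2 4 n))) ⟩
    16 ^ n ∎
    where open ≤-Reasoning

-- Blow-ups without strong pairs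

orderT : (n c : ℕ) → (Fin n → Fin n → Fin (suc c)) → Tournament
orderT n c f .size = n
orderT n c f .adj x y with Fin-<-cmp x y
-- Colour zero marks the edges that go forward in the natural order.
... | tri< _ _ _ = ⌊ f x y Fin.≟ Fin.zero ⌋
... | tri≈ _ _ _ = false
... | tri> _ _ _ = not ⌊ f y x Fin.≟ Fin.zero ⌋
orderT n c f .irrefl x with Fin-<-cmp x x
... | tri< lt _ _ = ⊥-elim (<-irrefl refl lt)
... | tri≈ _ _ _ = refl
... | tri> _ _ gt = ⊥-elim (<-irrefl refl gt)
orderT n c f .tourn x y x≢y with Fin-<-cmp x y | Fin-<-cmp y x
... | tri< lt _ _ | tri< gt _ _ = ⊥-elim (<-asym lt gt)
... | tri< _ _ _  | tri≈ _ eq _ = ⊥-elim (x≢y (sym eq))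
... | tri< _ _ _  | tri> _ _ _  = sym (not-involutive _)
... | tri≈ _ eq _ | _           = ⊥-elim (x≢y eq)
... | tri> _ _ _  | tri< _ _ _  = refl
... | tri> _ _ _  | tri≈ _ eq _ = ⊥-elim (x≢y (sym eq))
... | tri> _ _ gt | tri> _ _ lt = ⊥-elim (<-asym lt gt)

orderT-< : ∀ n c f {x y} → x Fin.< y → adj (orderT n c f) x y ≡ ⌊ f x y Fin.≟ Fin.zero ⌋
orderT-< n c f {x} {y} lt with Fin-<-cmp x y
... | tri< _ _ _  = refl
... | tri≈ ¬lt _ _ = ⊥-elim (¬lt lt)
... | tri> ¬lt _ _ = ⊥-elim (¬lt lt)

module _ (m : ℕ) (Q : Tournament) (β : Fin (size Q) → Fin (size Q) → Bool) where

  -- Edges go from earlier copies to later ones except on the pairs in β, the same for any two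
  -- copies.
  blockAdj : Fin m × Fin (size Q) → Fin m × Fin (size Q) → Bool
  blockAdj (i , x) (j , y) with Fin-<-cmp i j
  ... | tri< _ _ _ = not (β x y)
  ... | tri≈ _ _ _ = adj Q x y
  ... | tri> _ _ _ = β y x

  blockAdj-irrefl : ∀ p → blockAdj p p ≡ false
  blockAdj-irrefl (i , x) with Fin-<-cmp i i
  ... | tri< lt _ _ = ⊥-elim (<-irrefl refl lt)
  ... | tri≈ _ _ _ = irrefl Q x
  ... | tri> _ _ gt = ⊥-elim (<-irrefl refl gt)

  blockAdj-tourn : ∀ p q → p ≢ q → blockAdj p q ≡ not (blockAdj q p)
  blockAdj-tourn (i , x) (j , y) p≢q with Fin-<-cmp i j | Fin-<-cmp j i
  ... | tri< lt _ _ | tri< gt _ _ = ⊥-elim (<-asym lt gt)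
  ... | tri< _ ne _ | tri≈ _ eq _ = ⊥-elim (ne (sym eq))
  ... | tri< _ _ _  | tri> _ _ _  = refl
  ... | tri≈ _ eq _ | tri< _ ne _ = ⊥-elim (ne (sym eq))
  ... | tri≈ _ refl _ | tri≈ _ _ _ = tourn Q x y (p≢q ∘ cong (i ,_))
  ... | tri≈ _ eq _ | tri> _ ne _ = ⊥-elim (ne (sym eq))
  ... | tri> _ _ _  | tri< _ _ _  = sym (not-involutive _)
  ... | tri> _ ne _ | tri≈ _ eq _ = ⊥-elim (ne (sym eq))
  ... | tri> _ _ gt | tri> _ _ lt = ⊥-elim (<-asym lt gt)

  blowup : Tournament
  blowup .size = m * size Q
  blowup .adj z w = blockAdj (remQuot {m} (size Q) z) (remQuot {m} (size Q) w)
  blowup .irrefl z = blockAdj-irrefl (remQuot {m} (size Q) z)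
  blowup .tourn z w z≢w = blockAdj-tourn _ _ λ eq → z≢w (trans (sym (combine-remQuot {m} (size Q) z))
    (trans (cong (λ p → combine (proj₁ p) (proj₂ p)) eq) (combine-remQuot {m} (size Q) w)))

  blowup-adj : ∀ i x j y → adj blowup (combine i x) (combine j y) ≡ blockAdj (i , x) (j , y)
  blowup-adj i x j y = cong₂ blockAdj (remQuot-combine {m} i x) (remQuot-combine {m} j y)

  blowup-< : ∀ {i j} x y → i Fin.< j → adj blowup (combine i x) (combine j y) ≡ not (β x y)
  blowup-< {i} {j} x y lt = trans (blowup-adj i x j y) lemma
    where
    lemma : blockAdj (i , x) (j , y) ≡ not (β x y)
    lemma with Fin-<-cmp i j
    ... | tri< _ _ _  = refl
    ... | tri≈ ¬lt _ _ = ⊥-elim (¬lt lt)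
    ... | tri> ¬lt _ _ = ⊥-elim (¬lt lt)

  blowup-> : ∀ {i j} x y → j Fin.< i → adj blowup (combine i x) (combine j y) ≡ β y x
  blowup-> {i} {j} x y gt = trans (blowup-adj i x j y) lemma
    where
    lemma : blockAdj (i , x) (j , y) ≡ β y x
    lemma with Fin-<-cmp i j
    ... | tri< _ _ ¬gt = ⊥-elim (¬gt gt)
    ... | tri≈ _ _ ¬gt = ⊥-elim (¬gt gt)
    ... | tri> _ _ _  = refl

  blowup-≡ : ∀ i x y → adj blowup (combine i x) (combine i y) ≡ adj Q x y
  blowup-≡ i x y = trans (blowup-adj i x i y) lemma
    where
    lemma : blockAdj (i , x) (i , y) ≡ adj Q x y
    lemma with Fin-<-cmp i i
    ... | tri< lt _ _ = ⊥-elim (<-irrefl refl lt)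
    ... | tri≈ _ _ _ = refl
    ... | tri> _ _ gt = ⊥-elim (<-irrefl refl gt)

slice : VSet (m * n) → Fin m → VSet n
slice A i x = A (combine i x)

slice-pigeonhole : (A : VSet (m * n)) → 0 < count A → ∃ λ i → count A ≤ m * count (slice {m} {n} A i)
slice-pigeonhole {m} {n} A 0<A = sum-pigeonhole (λ i → count (slice {m} {n} A i)) 0<A (≤-reflexive (count-combine m A))

another : ∀ {c} → 0 < c → (a : Fin (suc c)) → ∃ λ b → b ≢ a
another {suc c} _ Fin.zero    = Fin.suc Fin.zero , λ ()
another {suc c} _ (Fin.suc a) = Fin.zero , λ ()

module _ {n c ρ : ℕ} (0<c : 0 < c) (χ : Polychromatic n c ρ) (m : ℕ) (a : Fin (suc c)) where
  private
    module χ = Polychromatic χ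
    Q = orderT n c χ.f
    β : Fin n → Fin n → Bool
    β x y = ⌊ χ.f x y Fin.≟ a ⌋
    T = blowup m Q β

  -- Between copies, a pair of colour `a` or a pair of another colour spoils completeness, according
  -- to the order of the copies. Inside one copy the increasing pairs from `A` to `B` or those from
  -- `B` to `A` number at least ρ, which is why `2 * ρ` is demanded.
  not-complete : ∀ A B → Disjoint A B → ∀ i j → 2 * ρ ≤ count (slice {m} {n} A i) * count (slice {m} {n} B j) → ¬ CompleteTo T A B
  not-complete A B A#B i j big complete = cases (Fin-<-cmp i j)
    where
    Aᵢ Bⱼ : VSet n
    Aᵢ = slice {m} {n} A i
    Bⱼ = slice {m} {n} B j
    clash : ∀ {x y b} → x ∈ₛ Aᵢ → y ∈ₛ Bⱼ → adj T (combine i x) (combine j y) ≡ b → b ≡ false → ⊥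
    clash {x} {y} x∈ y∈ e b≡ = true≢false (complete (combine i x) (combine j y) x∈ y∈) (trans e b≡)
    ρ≤ : ρ ≤ count Aᵢ * count Bⱼ
    ρ≤ = ≤-trans (m≤m+n ρ (ρ + 0)) big
    cases : Tri (i Fin.< j) (i ≡ j) (j Fin.< i) → ⊥
    cases (tri< lt _ _) = let x , y , x∈ , y∈ , eq = χ.hits-any Aᵢ Bⱼ (≤-trans ρ≤ (≤-reflexive (sym (edges-any Aᵢ Bⱼ)))) a in
      clash x∈ y∈ (blowup-< m Q β x y lt) (cong not (⌊⌋-complete (χ.f x y Fin.≟ a) eq))
    cases (tri> _ _ gt) = let b , b≢a = another 0<c a
                              y , x , y∈ , x∈ , eq = χ.hits-any Bⱼ Aᵢ (≤-trans ρ≤ (≤-reflexive (trans (*-comm (count Aᵢ) _) (sym (edges-any Bⱼ Aᵢ))))) b in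
      clash x∈ y∈ (blowup-> m Q β x y gt) (⌊⌋-complete¬ (χ.f y x Fin.≟ a) λ eq' → b≢a (trans (sym eq) eq'))
    cases (tri≈ _ refl _) with ρ ≤? edges increasing Aᵢ Bⱼ
    ... | yes up = let b , b≢0 = another 0<c Fin.zero
                       x , y , x∈ , y∈ , lt , eq = χ.hits-increasing Aᵢ Bⱼ up b in
      clash x∈ y∈ (trans (blowup-≡ m Q β i x y) (orderT-< n c χ.f lt)) (⌊⌋-complete¬ (χ.f x y Fin.≟ Fin.zero) λ eq' → b≢0 (trans (sym eq) eq'))
    ... | no ¬up = let y , x , y∈ , x∈ , lt , eq = χ.hits-increasing Bⱼ Aᵢ down Fin.zero in
      clash x∈ y∈ (trans (blowup-≡ m Q β i x y) (trans (tourn Q x y (λ e → <-irrefl (cong toℕ (sym e)) lt)) (cong not (orderT-< n c χ.f lt))))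
        (cong not (⌊⌋-complete (χ.f y x Fin.≟ Fin.zero) eq))
      where
      down : ρ ≤ edges increasing Bⱼ Aᵢ
      down = +-cancelˡ-≤ ρ _ _ (≤-trans (≤-reflexive (cong (ρ +_) (sym (+-identityʳ ρ)))) (≤-trans big
        (≤-trans (increasing-half Aᵢ Bⱼ λ x x∈ → A#B (combine i x) x∈) (+-monoˡ-≤ _ (<⇒≤ (≰⇒> ¬up))))))

  -- As ρ = gn is linear in n, a slice of `A` with n/W vertices needs only the constant number 2Wg
  -- of vertices in a slice of `B`. Even a transitive `B` provides them, because transitive sets
  -- have logarithmic size and n = 2^K with `K` large.
  no-BigPair-blowup : ∀ W g K → 0 < m → 0 < W → 0 < n → ρ ≡ g * n → n ≡ 2 ^ K → W * m * (2 * W * g) ≤ K → ¬ BigPair T W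
  no-BigPair-blowup W g K 0<m 0<W 0<n ρ≡ n≡ K≥ (A , B , A#B , bigA , bigB , complete) = contradict complete
    where
    open ≤-Reasoning
    0<T : 0 < m * n
    0<T = *-mono-≤ 0<m 0<n
    2^K≤ : 2 ^ K ≤ count (full {m * n})
    2^K≤ = ≤-trans (≤-reflexive (sym n≡)) (≤-trans (m≤n*m n m ⦃ >-nonZero 0<m ⦄) (≤-reflexive (sym (count-full (m * n)))))
    K≤W|B| : K ≤ W * count B
    K≤W|B| = [ (λ h → ≤-trans (n≤2^n K) (≤-trans 2^K≤ (≤-trans (≤-reflexive (count-full (m * n))) h)))
             , (λ (_ , h) → let S , _ , t , K<S = transitive-log T K full 2^K≤ in ≤-trans (<⇒≤ K<S) (h S t)) ]′ bigB
    x₀ : Fin (m * n)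
    x₀ = Fin.fromℕ< 0<T
    0<B : 0 < count B
    0<B = [ factor>0 {b = W} 0<T
          , (λ (_ , h) → factor>0 {b = W} (≤-reflexive (sym (count-⁅⁆ x₀))) (h ⁅ x₀ ⁆ (EdgeTrans-⁅⁆ T x₀))) ]′ bigB
    pigeonA = slice-pigeonhole {m} {n} A (factor>0 {b = W} 0<T bigA)
    pigeonB = slice-pigeonhole {m} {n} B 0<B
    i j : Fin m
    i = proj₁ pigeonA
    j = proj₁ pigeonB
    α γ : ℕ
    α = count (slice {m} {n} A i)
    γ = count (slice {m} {n} B j)
    regroup₁ : ∀ W m α → W * (m * α) ≡ m * (W * α)
    regroup₁ = solve-∀
    regroup₂ : ∀ W m α → W * (m * α) ≡ W * m * α
    regroup₂ = solve-∀
    regroup₃ : ∀ W g n → W * (2 * (g * n)) ≡ n * (2 * W * g)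
    regroup₃ = solve-∀
    n≤Wα : n ≤ W * α
    n≤Wα = *-cancelˡ-≤ m ⦃ >-nonZero 0<m ⦄ (begin
      m * n ≤⟨ bigA ⟩
      W * count A ≤⟨ *-monoʳ-≤ W (proj₂ pigeonA) ⟩
      W * (m * α) ≡⟨ regroup₁ W m α ⟩
      m * (W * α) ∎)
    2Wg≤γ : 2 * W * g ≤ γ
    2Wg≤γ = *-cancelˡ-≤ (W * m) ⦃ >-nonZero (*-mono-≤ 0<W 0<m) ⦄ (begin
      W * m * (2 * W * g) ≤⟨ K≥ ⟩
      K ≤⟨ K≤W|B| ⟩
      W * count B ≤⟨ *-monoʳ-≤ W (proj₂ pigeonB) ⟩
      W * (m * γ) ≡⟨ regroup₂ W m γ ⟩
      W * m * γ ∎)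
    2ρ≤ : 2 * ρ ≤ α * γ
    2ρ≤ = *-cancelˡ-≤ W ⦃ >-nonZero 0<W ⦄ (begin
      W * (2 * ρ) ≡⟨ cong (λ r → W * (2 * r)) ρ≡ ⟩
      W * (2 * (g * n)) ≡⟨ regroup₃ W g n ⟩
      n * (2 * W * g) ≤⟨ *-mono-≤ n≤Wα 2Wg≤γ ⟩
      W * α * γ ≡⟨ *-assoc W α γ ⟩
      W * (α * γ) ∎)
    contradict : CompleteTo T A B ⊎ CompleteTo T B A → ⊥
    contradict (inj₁ h) = not-complete A B A#B i j 2ρ≤ h
    contradict (inj₂ h) = not-complete B A (Disjoint-sym {X = A} {B} A#B) j i (≤-trans 2ρ≤ (≤-reflexive (*-comm α γ))) h

-- An m-sequence in the blow-up

⇔⇒≡ : ∀ {a b} → (a ≡ true → b ≡ true) → (b ≡ true → a ≡ true) → a ≡ b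
⇔⇒≡ {true}  {b}     f g = sym (f refl)
⇔⇒≡ {false} {true}  f g = g refl
⇔⇒≡ {false} {false} f g = refl

count-image-∧ : (f : Fin k → Fin n) → Injective _≡_ _≡_ f → (X : VSet k) (p : Fin n → Bool) →
  count (λ w → image f X w ∧ p w) ≡ count (λ x → X x ∧ p (f x))
count-image-∧ f inj X p = trans (count-cong λ w → ⇔⇒≡ (to w) (from w)) (count-image f inj (λ x → X x ∧ p (f x)))
  where
  to : ∀ w → image f X w ∧ p w ≡ true → image f (λ x → X x ∧ p (f x)) w ≡ true
  to w h with ∧-elim {image f X w} h
  ... | im , pw with image-elim f X im
  ...   | x , x∈ , refl = image-intro f (λ x → X x ∧ p (f x)) (∧-intro x∈ pw)
  from : ∀ w → image f (λ x → X x ∧ p (f x)) w ≡ true → image f X w ∧ p w ≡ true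
  from w h with image-elim f (λ x → X x ∧ p (f x)) h
  ... | x , x∈ , refl with ∧-elim {X x} x∈
  ...   | xX , px = ∧-intro (image-intro f X xX) px

edges-imageʳ : (R : Fin l → Fin n → Bool) (X : VSet l) (g : Fin k → Fin n) → Injective _≡_ _≡_ g → (Y : VSet k) →
  edges R X (image g Y) ≡ edges (λ z y → R z (g y)) X Y
edges-imageʳ R X g inj Y = sum-cong-≗ row
  where
  row : ∀ z → count (λ w → X z ∧ (image g Y w ∧ R z w)) ≡ count (λ y → X z ∧ (Y y ∧ R z (g y)))
  row z = trans (count-∧ (X z) (λ w → image g Y w ∧ R z w)) (trans (cong (ind (X z) *_) (count-image-∧ g inj Y (R z)))
    (sym (count-∧ (X z) (λ y → Y y ∧ R z (g y)))))

edges-image : (R : Fin n → Fin n → Bool) (f g : Fin k → Fin n) → Injective _≡_ _≡_ f → Injective _≡_ _≡_ g → (X Y : VSet k) →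
  edges R (image f X) (image g Y) ≡ edges (λ x y → R (f x) (g y)) X Y
edges-image R f g injf injg X Y = trans (edges-imageʳ R (image f X) g injg Y)
  (trans (edges-swap (λ z y → R z (g y)) (image f X) Y)
    (trans (edges-imageʳ (λ y z → R z (g y)) Y f injf X) (edges-swap (λ y x → R (f x) (g y)) Y X)))

module _ {n c m : ℕ} (f : Fin n → Fin n → Fin (suc c)) (X : Fin m → VSet n) (L : ℕ) where
  private
    P : Fin m → Fin m → VSet (n * n)
    P i j = pairs anyPair (X i) (X j)

    colourAt : Fin (n * n) → Fin (suc c)
    colourAt e = f (proj₁ (remQuot {n} n e)) (proj₂ (remQuot {n} n e))

    coloured : Fin (suc c) → Fin (n * n) → Bool
    coloured a e = ⌊ colourAt e Fin.≟ a ⌋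

    popular : Fin m → Fin m → VSet (suc c)
    popular i j a = not ⌊ L * count (λ e → P i j e ∧ coloured a e) ≤? count (P i j) ⌋

    few-popular-colours : ∀ i j → count (popular i j) ≤ L
    few-popular-colours i j with 0 <? count (P i j)
    -- Every pair of vertices has exactly one colour, so double counting pairs against colours
    -- leaves at most `L` popular colours.
    ... | yes 0<P = *-cancelˡ-≤ (suc c) (begin
        suc c * count (popular i j) ≤⟨ few-popular (λ e a → coloured a e) (P i j) full (suc c) L 0<P one ⟩
        L * count (full {suc c}) ≡⟨ cong (L *_) (count-full (suc c)) ⟩
        L * suc c ≡⟨ *-comm L (suc c) ⟩
        suc c * L ∎)
      where
      open ≤-Reasoning
      one : ∀ e → e ∈ₛ P i j → suc c * count (λ a → coloured a e) ≤ count (full {suc c})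
      one e _ = ≤-reflexive (trans (cong (suc c *_) (count-⁅⁆ (colourAt e)))
        (trans (*-identityʳ (suc c)) (sym (count-full (suc c)))))
    ... | no ¬0<P = ≤-trans (≤-reflexive (count-none {X = popular i j} unpopular)) z≤n
      where
      unpopular : ∀ a → popular i j a ≡ false
      unpopular a = cong not (⌊⌋-complete (L * count (λ e → P i j e ∧ coloured a e) ≤? count (P i j))
        (≤-trans (*-monoʳ-≤ L (≤-trans (count-mono {X = λ e → P i j e ∧ coloured a e} {P i j} λ e h → proj₁ (∧-elim {P i j e} h))
          (≮⇒≥ ¬0<P))) (≤-trans (≤-reflexive (*-zeroʳ L)) z≤n)))

    anyPopular : VSet (suc c)
    anyPopular = ⋃ₛ λ i → ⋃ₛ (popular i)

    unpopular-colour : m * (m * L) ≤ c → ∃ λ a → a ∈ₛ (full ∖ anyPopular)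
    unpopular-colour m²L≤c = count>0⇒∃ {X = full ∖ anyPopular} (+-cancelˡ-< (count anyPopular) 0 (count (full ∖ anyPopular)) (begin-strict
      count anyPopular + 0 ≡⟨ +-identityʳ (count anyPopular) ⟩
      count anyPopular ≤⟨ count-⋃≤ (λ i → ⋃ₛ (popular i)) ⟩
      sum (λ i → count (⋃ₛ (popular i))) ≤⟨ sum-mono (λ i → ≤-trans (count-⋃≤ (popular i)) (≤-trans (sum-mono (few-popular-colours i)) (≤-reflexive (sum-const m L)))) ⟩
      sum {m} (λ _ → m * L) ≡⟨ sum-const m (m * L) ⟩
      m * (m * L) ≤⟨ m²L≤c ⟩
      c <⟨ n<1+n c ⟩
      suc c ≡⟨ count-full (suc c) ⟨
      count (full {suc c}) ≡⟨ count-∖ full anyPopular (λ _ _ → refl) ⟩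
      count anyPopular + count (full ∖ anyPopular) ∎))
      where open ≤-Reasoning

    ofColour : Fin (suc c) → Fin n → Fin n → Bool
    ofColour a x y = ⌊ f x y Fin.≟ a ⌋

    ∧-regroup : ∀ p q r → p ∧ (q ∧ r) ≡ (p ∧ (q ∧ true)) ∧ r
    ∧-regroup true  true  r = refl
    ∧-regroup true  false r = refl
    ∧-regroup false q     r = refl

    edges-ofColour : ∀ a i j → edges (ofColour a) (X i) (X j) ≡ count (λ e → P i j e ∧ coloured a e)
    edges-ofColour a i j = trans (sym (count-pairs (ofColour a) (X i) (X j)))
      (count-cong λ e → ∧-regroup (X i (proj₁ (remQuot {n} n e))) (X j (proj₂ (remQuot {n} n e))) (coloured a e))

    unpopular-sparse : ∀ a → a ∈ₛ (full ∖ anyPopular) → ∀ i j →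
      L * count (λ e → P i j e ∧ coloured a e) ≤ count (P i j)
    unpopular-sparse a free i j with L * count (λ e → P i j e ∧ coloured a e) ≤? count (P i j) in eq
    ... | yes p = p
    ... | no _ = ⊥-elim (true≢false (⋃-intro (λ i → ⋃ₛ (popular i)) i a (⋃-intro (popular i) j a (cong (not ∘ ⌊_⌋) eq)))
          (not-elim free))

  -- For each of the m² choices of `i` and `j` at most `L` colours are popular, so one of the
  -- `c + 1` colours is popular for none. This works for sets of any size.
  sparse-colour : m * (m * L) ≤ c → ∃ λ a → ∀ i j → L * edges (λ x y → ⌊ f x y Fin.≟ a ⌋) (X i) (X j) ≤ count (X i) * count (X j)
  sparse-colour m²L≤c with unpopular-colour m²L≤c
  ... | a , free = a , λ i j → ≤-trans (≤-reflexive (cong (L *_) (edges-ofColour a i j))) (≤-trans (unpopular-sparse a free i j)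
        (≤-reflexive (trans (count-pairs anyPair (X i) (X j)) (edges-any (X i) (X j)))))

max-transitive : (Q : Tournament) → ∃ λ U → EdgeTrans Q U × (∀ S → EdgeTrans Q S → count S ≤ count U)
max-transitive Q = search (size Q) λ S _ → count-≤ S
  where
  search : ∀ k → (∀ S → EdgeTrans Q S → count S ≤ k) → ∃ λ U → EdgeTrans Q U × (∀ S → EdgeTrans Q S → count S ≤ count U)
  search zero    h = ∅ , (λ _ _ _ ()) , λ S t → ≤-trans (h S t) z≤n
  search (suc k) h with ∃-subset? {P = λ S → EdgeTrans Q S × suc k ≤ count S}
      (λ {X} {Y} eq (t , c) → EdgeTrans-⊆ Q (λ x y∈ → trans (eq x) y∈) t , ≤-trans c (≤-reflexive (count-cong eq)))
      (λ S → EdgeTrans? Q S ×-dec (suc k ≤? count S))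
  ... | yes (U , t , c) = U , t , λ S tS → ≤-trans (h S tS) c
  ... | no none = search k λ S tS → ≤-pred (≰⇒> λ le → none (S , tS , le))

module _ {m : ℕ} {v : Vec Bool m} {η : Vec ℕ (ζ v)} (valid : Valid v (partsOf v η)) (Q : Tournament) (β : Fin (size Q) → Fin (size Q) → Bool)
         (first : ∀ i → FirstSet Q (lookup v i) (lookup (partsOf v η) i) (2 * lookup (partsOf v η) i * 1) full) where
  private
    T = blowup m Q β
    q : ℕ
    q = size Q
    module first i = FirstSet (first i)
    ι : Fin m → Fin q → Fin (m * q)
    ι = combine
    ι-injective : ∀ i → Injective _≡_ _≡_ (ι i)
    ι-injective i {x} {y} = combine-injectiveʳ i x i y
    part : ∀ i → Fin (lookup (partsOf v η) i) → VSet (m * q)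
    part i a = image (ι i) (first.part i a)

  blockSet : Fin m → VSet q
  blockSet i = ⋃ₛ (first.part i)

  private
    ⋃part : ∀ i w → ⋃ₛ (part i) w ≡ image (ι i) (blockSet i) w
    ⋃part i w = ⇔⇒≡ to from
      where
      to : w ∈ₛ ⋃ₛ (part i) → w ∈ₛ image (ι i) (blockSet i)
      to h with ⋃-elim (part i) w h
      ... | a , h' with image-elim (ι i) (first.part i a) h'
      ...   | x , x∈ , refl = image-intro (ι i) (blockSet i) (⋃-intro (first.part i) a x x∈)
      from : w ∈ₛ image (ι i) (blockSet i) → w ∈ₛ ⋃ₛ (part i)
      from h with image-elim (ι i) (blockSet i) h
      ... | x , x∈ , refl with ⋃-elim (first.part i) x x∈
      ...   | a , x∈' = ⋃-intro (part i) a (ι i x) (image-intro (ι i) (first.part i a) x∈')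

    count-part : ∀ i a → count (part i a) ≡ count (first.part i a)
    count-part i a = count-image (ι i) (ι-injective i) (first.part i a)

    count-⋃part : ∀ i → count (⋃ₛ (part i)) ≡ count (blockSet i)
    count-⋃part i = trans (count-cong (⋃part i)) (count-image (ι i) (ι-injective i) (blockSet i))

    complete : ∀ i a b → a Fin.< b → CompleteTo T (part i a) (part i b)
    complete i a b a<b z w z∈ w∈ with image-elim (ι i) (first.part i a) z∈ | image-elim (ι i) (first.part i b) w∈
    ... | x , x∈ , refl | y , y∈ , refl = trans (blowup-≡ m Q β i x y) (first.complete i a b a<b x y x∈ y∈)

    disjS : ∀ i j → i ≢ j → Disjoint (⋃ₛ (part i)) (⋃ₛ (part j))
    disjS i j i≢j w w∈ = ≢true⇒≡false λ w∈' →
      let x , _ , e = image-elim (ι i) (blockSet i) (trans (sym (⋃part i w)) w∈)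
          y , _ , e' = image-elim (ι j) (blockSet j) (trans (sym (⋃part j w)) w∈')
      in i≢j (combine-injectiveˡ i x j y (trans e (sym e')))

    disjPart : ∀ i a b → a ≢ b → Disjoint (part i a) (part i b)
    disjPart i a b a≢b with Fin-<-cmp a b
    ... | tri< lt _ _ = CompleteTo⇒Disjoint T (complete i a b lt)
    ... | tri≈ _ e _  = ⊥-elim (a≢b e)
    ... | tri> _ _ gt = Disjoint-sym {X = part i b} {part i a} (CompleteTo⇒Disjoint T (complete i b a gt))

  -- The set S_i is placed in the i-th copy of `Q`. Passing from `Q` to the blow-up multiplies the
  -- number of vertices by m and the size of a largest transitive set by at most m, hence the factor
  -- `m` in the constant.
  blowup-MSeq : ∀ C L → (∀ i → m * (2 * lookup (partsOf v η) i * 1) ≤ suc C) →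
    (∀ i j → suc L * edges β (blockSet i) (blockSet j) ≤ count (blockSet i) * count (blockSet j)) → MSeq T v η (unit C) (unit L)
  blowup-MSeq C L C≥ sparse = record
    { part = part
    ; disjS = disjS
    ; disjPart = disjPart
    ; transS = λ i vi → EdgeTrans⇒Transitive T (EdgeTrans-⊆ T (λ w w∈ → trans (sym (⋃part i w)) w∈)
        (EdgeTrans-image T Q (ι i) (blowup-≡ m Q β i) (first.transitive i vi)))
    ; complS = λ i _ → complete i
    ; bigPart = λ i vi a S t → unit-≤ C (scale i a (bigTr i vi a S (Transitive⇒EdgeTrans T t)))
    ; bigS = λ i vi → let a = Fin.fromℕ< (proj₁ (valid i)) in
        unit-≤ C (≤-trans (scale i a (≤-trans (*-monoʳ-≤ m (first.bigSize i vi a)) (≤-reflexive (sym (*-assoc m _ _)))))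
          (*-monoʳ-≤ (suc C) (count-mono {X = part i a} {⋃ₛ (part i)} (⋃-intro (part i) a))))
    ; dense = λ i j i<j → density-unit L (eXY-dual T {⋃ₛ (part i)} {⋃ₛ (part j)} (disjS i j (λ { refl → <-irrefl refl i<j }))) (dense i j i<j) }
    where
    open ≤-Reasoning
    scale : ∀ i a {N} → N ≤ m * (2 * lookup (partsOf v η) i * 1) * count (first.part i a) → N ≤ suc C * count (part i a)
    scale i a h = ≤-trans h (≤-trans (*-monoˡ-≤ _ (C≥ i)) (≤-reflexive (cong (suc C *_) (sym (count-part i a)))))
    bigTr : ∀ i → lookup v i ≡ true → ∀ a S → EdgeTrans T S → count S ≤ m * (2 * lookup (partsOf v η) i * 1) * count (first.part i a)
    bigTr i vi a S t with 0 <? count S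
    ... | no ¬0<S = ≤-trans (≮⇒≥ ¬0<S) z≤n
    -- Some copy contains a share 1/m of `S`, and what lies there is transitive in `Q`.
    ... | yes 0<S with slice-pigeonhole {m} {q} S 0<S
    ...   | j , S≤ = ≤-trans S≤ (≤-trans (*-monoʳ-≤ m (first.bigTr i vi a (slice {m} {q} S j) sliceTrans)) (≤-reflexive (sym (*-assoc m _ _))))
      where
      sliceTrans : EdgeTrans Q (slice {m} {q} S j)
      sliceTrans x y z x∈ y∈ z∈ xy yz = trans (sym (blowup-≡ m Q β j x z))
        (t (combine j x) (combine j y) (combine j z) x∈ y∈ z∈ (trans (blowup-≡ m Q β j x y) xy) (trans (blowup-≡ m Q β j y z) yz))
    dense : ∀ i j → i Fin.< j → suc L * eXY T (⋃ₛ (part j)) (⋃ₛ (part i)) ≤ count (⋃ₛ (part i)) * count (⋃ₛ (part j))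
    dense i j i<j = begin
      suc L * eXY T (⋃ₛ (part j)) (⋃ₛ (part i)) ≡⟨ cong (suc L *_) (eXY≡edges T (⋃ₛ (part j)) (⋃ₛ (part i))) ⟩
      suc L * edges (adj T) (⋃ₛ (part j)) (⋃ₛ (part i)) ≤⟨ *-monoʳ-≤ (suc L) (edges-mono λ z w z∈ w∈ r →
          trans (sym (⋃part j z)) z∈ , trans (sym (⋃part i w)) w∈ , r) ⟩
      suc L * edges (adj T) (image (ι j) (blockSet j)) (image (ι i) (blockSet i)) ≡⟨ cong (suc L *_) (edges-image (adj T) (ι j) (ι i) (ι-injective j) (ι-injective i) (blockSet j) (blockSet i)) ⟩
      suc L * edges (λ y x → adj T (ι j y) (ι i x)) (blockSet j) (blockSet i) ≡⟨ cong (suc L *_) (trans (edges-cong {X = blockSet j} {blockSet i} λ y x _ _ → blowup-> m Q β y x i<j) (edges-swap (λ y x → β x y) (blockSet j) (blockSet i))) ⟩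
      suc L * edges β (blockSet i) (blockSet j) ≤⟨ sparse i j ⟩
      count (blockSet i) * count (blockSet j) ≡⟨ cong₂ _*_ (count-⋃part i) (count-⋃part j) ⟨
      count (⋃ₛ (part i)) * count (⋃ₛ (part j)) ∎

-- Empty families

point : Tournament
point .size = 1
point .adj _ _ = false
point .irrefl _ = refl
point .tourn Fin.zero Fin.zero h = ⊥-elim (h refl)

no-BigPair-point : ∀ {W} → ¬ BigPair point W
no-BigPair-point {W} (A , B , A#B , bigA , bigB , _) = true≢false (at-zero B 0<B) (A#B Fin.zero (at-zero A (factor>0 {b = W} (s≤s z≤n) bigA)))
  where
  at-zero : (X : VSet 1) → 0 < count X → X Fin.zero ≡ true
  at-zero X h with count>0⇒∃ {X = X} h
  ... | Fin.zero , p = p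
  0<B : 0 < count B
  0<B = [ factor>0 {b = W} (s≤s z≤n) , (λ (_ , h) → factor>0 {b = W} (s≤s z≤n) (h full (λ { Fin.zero Fin.zero Fin.zero _ _ _ () }))) ]′ bigB

-- The quantifiers negate the strong property: one size constant for which no choice of density and
-- pair constant works. If the sequence has no sets, a single vertex suffices, as it has no two
-- disjoint nonempty sets.
no-BigPair-free : ∀ {m} (v : Vec Bool m) (η : Vec ℕ (ζ v)) → Valid v (partsOf v η) →
  ∃ λ C → ∀ L N → ∃ λ T → MSeq T v η (unit C) (unit L) × ¬ BigPair T (suc N)
no-BigPair-free [] [] valid = 0 , λ L N → point , record
  { part = λ () ; disjS = λ () ; disjPart = λ () ; transS = λ () ; complS = λ () ; bigPart = λ () ; bigS = λ () ; dense = λ () } ,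
  no-BigPair-point {suc N}
no-BigPair-free {m@(suc _)} v@(_ ∷ _) η valid = m * (2 * parts * 1) , construct
  where
  ps = partsOf v η
  parts : ℕ
  parts = sumV ps
  construct : ∀ L N → ∃ λ T → MSeq T v η (unit (m * (2 * parts * 1))) (unit L) × ¬ BigPair T (suc N)
  construct L N = blowup m Q β , blowup-MSeq {v = v} {η} valid Q β first (m * (2 * parts * 1)) L
      (λ i → ≤-trans (*-monoʳ-≤ m (*-monoˡ-≤ 1 (*-monoʳ-≤ 2 (lookup≤sumV ps i)))) (n≤1+n _)) (proj₂ colour) ,
    no-BigPair-blowup 0<colours χ m (proj₁ colour) W g K (s≤s z≤n) (s≤s z≤n) 0<order refl refl
      (≤-trans (m≤m+n _ (colours + 3)) (m≤m+n _ parts))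
    where
    W colours g K order : ℕ
    W = suc N
    colours = m * (m * suc L)
    g = 16 * colours
    -- The summands serve the absence of strong pairs, the count of colouring demands, and a
    -- transitive set that can be cut into the prescribed parts.
    K = W * m * (2 * W * g) + (colours + 3) + parts
    order = 2 ^ K
    0<colours : 0 < colours
    0<colours = s≤s z≤n
    0<order : 0 < order
    0<order = m^n>0 2 K
    colours+2<order : colours + 2 < order
    colours+2<order = begin-strict
      colours + 2 <⟨ +-monoʳ-< colours (s≤s (s≤s (s≤s z≤n))) ⟩
      colours + 3 ≤⟨ ≤-trans (m≤n+m (colours + 3) (W * m * (2 * W * g))) (m≤m+n _ parts) ⟩
      K ≤⟨ n≤2^n K ⟩
      order ∎
      where open ≤-Reasoning
    χ : Polychromatic order colours (g * order)
    χ = polychromatic-pairs order colours (g * order) (enough-colours order colours 0<colours colours+2<order)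
    Q : Tournament
    Q = orderT order colours (Polychromatic.f χ)
    U = max-transitive Q
    parts≤U : parts ≤ count (proj₁ U)
    parts≤U = let S , _ , t , K<S = transitive-log Q K full (≤-reflexive (sym (count-full order))) in
      ≤-trans (m≤n+m parts (W * m * (2 * W * g) + (colours + 3))) (≤-trans (<⇒≤ K<S) (proj₂ (proj₂ U) S t))
    first : ∀ i → FirstSet Q (lookup v i) (lookup ps i) (2 * lookup ps i * 1) full
    -- The constant is 1: the ambient set is all of `Q`, and `proj₁ U` is a largest transitive set.
    first i = firstSet Q (lookup v i) (lookup ps i) (proj₁ (valid i)) (proj₂ (valid i)) 1 0<order full (proj₁ U)
      (≤-reflexive (sym (trans (+-identityʳ _) (count-full order)))) (λ _ _ → refl) (proj₁ (proj₂ U))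
      (λ S t → ≤-trans (proj₂ (proj₂ U) S t) (≤-reflexive (sym (+-identityʳ _)))) (≤-trans (lookup≤sumV ps i) parts≤U)
    X : Fin m → VSet order
    -- The blocks do not depend on the reversed pairs. An empty β stands in here, since the colour
    -- to reverse is selected only afterwards, for these very blocks.
    X = blockSet {v = v} {η} valid Q (λ _ _ → false) first
    colour = sparse-colour (Polychromatic.f χ) X (suc L) ≤-refl
    β : Fin order → Fin order → Bool
    β x y = ⌊ Polychromatic.f χ x y Fin.≟ proj₁ colour ⌋

¬StrongEH-∅ : ∀ {m} (v : Vec Bool m) (η : Vec ℕ (ζ v)) → All (1 ≤_) η → (H : Fin 0 → Tournament)
  (F : (i : Fin 0) → Fin (size (H i)) → Fin (kOf v η)) → ¬ StrongEH v η H F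
¬StrongEH-∅ v η η≥1 H F strong =
  let C , construct = no-BigPair-free v η (partsOf-valid v η η≥1)
      L , N , property = StrongEH⇒IntegralEH v η H F strong C
      T , χ , none = construct L N
  in [ (λ ()) , none ]′ (property T χ)

theorem10 : ∀ {m : ℕ} (v : Vec Bool m) (η : Vec ℕ (ζ v)) → All (1 ≤_) η →
    ∀ {r s : ℕ}
    (H₁ : Fin r → Tournament) (F : (i : Fin r) → Fin (size (H₁ i)) → Fin (kOf v η))
    (H₂ : Fin s → Tournament) (G : (j : Fin s) → Fin (size (H₂ j)) → Fin (kOf v η)) →
    (∀ i → Injective _≡_ _≡_ (F i)) → (∀ j → Injective _≡_ _≡_ (G j)) →
    StrongEH v η H₁ F → StrongEH v η H₂ G →
    (∀ i j → Compatible (F i) (G j)) →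
    EHProperty (λ (p : Fin r × Fin s) → let (i , j) = p in prod (H₁ i) (H₂ j) (F i) (G j))
theorem10 v η η≥1 {zero} H₁ F H₂ G injF injG EH₁ EH₂ compat = ⊥-elim (¬StrongEH-∅ v η η≥1 H₁ F EH₁)
theorem10 v η η≥1 {suc r} {zero} H₁ F H₂ G injF injG EH₁ EH₂ compat = ⊥-elim (¬StrongEH-∅ v η η≥1 H₂ G EH₂)
theorem10 v η η≥1 {suc r} {suc s} H₁ F H₂ G injF injG EH₁ EH₂ compat = nonempty-case v η η≥1 H₁ F H₂ G injF EH₁ EH₂ compat
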